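{- Let $p \geq 5$ be a prime and consider the Cayley cubic \[ x^2 + y^2 + z^2 = xyz + 4 \] over $\mathbb{F}_p$. Let $G$ be the group of permutations of the set of solutions $(x,y,z)\in\mathbb{F}_p^3$ generated by the Markoff moves $m_1:(x,y,z)\mapsto(yz-x,y,z)$, $m_2:(x,y,z)\mapsto(x,xz-y,z)$, $m_3:(x,y,z)\mapsto(x,y,xy-z)$ and all permutations of the three coordinates. Write $\varepsilon = (-1)^{(p-1)/2}$, and for each prime $q$ dividing $p^2-1$ let $e_q$ be the exponent of $q$ in $p^2-1$. Let $Q^+$ and $Q^-$ be the (disjoint) sets of odd primes dividing $p+\varepsilon$ and $p-\varepsilon$ respectively, so that \[ p+\varepsilon = 2\prod_{q\in Q^+} q^{e_q}, \qquad p-\varepsilon = 2^{e_2-1}\prod_{q\in Q^- } q^{e_q}. \] Let $D$ be the set of positive divisors $t$ of $p^2-1$ such that $p+1 \mid t$ or $p-1\mid t$. Then there is a bijection $\Phi$ from $D$ to the set of $G$-orbits on the solutions of the Cayley cubic over $\mathbb{F}_p$ such that: for $t=\prod_{q\mid p^2-1} q^{f_q}\in D$ with $t\neq p^2-1$ and $t\neq \frac{p^2-1}{2}$, the orbit $\Phi(t)$ has size \[ \frac{1}{2}\prod_{q\mid p^2-1,\ f_q<e_q} (q^2-1)\, q^{2(e_q-f_q-1)}, \] while for $t = p^2-1$ and $t=\frac{p^2-1}{2}$ the orbit $\Phi(t)$ has twice the size given by this expression. In particular the number of $G$-orbits equals \[ e_2\prod_{q\in Q^- }(e_q+1) + 2\prod_{q\in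 Q^+}(e_q+1) - 2. \]
   Context: Here $\mathbb{F}_p$ is the field with $p$ elements. The orbits are those of the group generated by the three Vieta (Markoff) moves and the coordinate permutations acting on the set of all triples $(x,y,z)\in\mathbb{F}_p^3$ satisfying the equation. Empty products equal $1$. -}

module Defs where

open import Data.Nat using (ℕ; zero; suc; _+_; _*_; _∸_; _^_; _<_; _<ᵇ_; _≡ᵇ_; NonZero)
open import Data.Nat.DivMod using (_mod_; _/_; _%_)
open import Data.Nat.Divisibility using (_∣_; _∣?_)
open import Data.Nat.Primality using (Prime; prime?)
open import Data.Fin using (Fin; toℕ)
open import Data.Bool using (Bool; true; false; if_then_else_)
open import Data.Nat.ListAction using (product)
open import Data.List using (List; []; _∷_; map; filter; upTo; length)
open import Data.List.Membership.Propositional using (_∈_)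
open import Data.List.Relation.Unary.Unique.Propositional using (Unique)
open import Data.Product using (Σ; ∃; _×_; _,_)
open import Data.Sum using (_⊎_)
open import Relation.Nullary using (yes; no; ¬_; ¬?)
open import Data.Nat using (_≟_)
open import Data.List.Relation.Unary.All using (All)
open import Data.List.Relation.Unary.Any using (Any)
open import Data.List.Relation.Unary.AllPairs using (AllPairs)
open import Relation.Nullary.Decidable using (_×-dec_)
open import Relation.Binary.PropositionalEquality using (_≡_)
open import Relation.Binary.Construct.Closure.Equivalence using (EqClosure)
open import Function.Bundles using (_⇔_)

-- q-adic valuation of n (number of times q divides n); meaningful for q ≥ 2, n > 0.
-- By convention val 0 n = 0 (never used: only primes q are used).
val : ℕ → ℕ → ℕ
val zero    n = 0
val (suc r) n = go n n
  where
  go : ℕ → ℕ → ℕ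
  go zero    m = 0
  go (suc k) m with suc r ∣? m
  ... | yes _ = suc (go k (m / suc r))
  ... | no  _ = 0

primeDivisors : ℕ → List ℕ
primeDivisors N = filter (λ q → prime? q ×-dec (q ∣? N)) (upTo (suc N))

oddPrimeDivisors : ℕ → List ℕ
oddPrimeDivisors N = filter (λ q → ¬? (q ≟ 2)) (primeDivisors N)

N : ℕ → ℕ
N p = p * p ∸ 1

-- ε = (-1)^((p-1)/2) is +1 iff p ≡ 1 (mod 4) (p odd).
-- pPlusε p = p + ε,  pMinusε p = p - ε.
pPlusε : ℕ → ℕ
pPlusε p = if p % 4 ≡ᵇ 1 then p + 1 else p ∸ 1

pMinusε : ℕ → ℕ
pMinusε p = if p % 4 ≡ᵇ 1 then p ∸ 1 else p + 1

InD : ℕ → ℕ → Set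
InD p t = 0 < t × t ∣ N p × (p + 1 ∣ t ⊎ p ∸ 1 ∣ t)

sizeFactor : ℕ → ℕ → ℕ → ℕ
sizeFactor M t q =
  if val q t <ᵇ val q M then (q * q ∸ 1) * q ^ (2 * (val q M ∸ val q t ∸ 1)) else 1

-- ∏_{q ∣ p²-1, f_q < e_q} (q² - 1) q^(2(e_q - f_q - 1))   (twice the orbit size in general)
sizeProduct : ℕ → ℕ → ℕ
sizeProduct p t = product (map (sizeFactor (N p) t) (primeDivisors (N p)))

orbitCount : ℕ → ℕ
orbitCount p =
  val 2 (N p) * product (map (λ q → val q (N p) + 1) (oddPrimeDivisors (pMinusε p)))
  + 2 * product (map (λ q → val q (N p) + 1) (oddPrimeDivisors (pPlusε p)))
  ∸ 2

module _ (p : ℕ) .{{_ : NonZero p}} where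

  Point : Set
  Point = Fin p × Fin p × Fin p

  IsSol : Point → Set
  IsSol (x , y , z) =
    (toℕ x * toℕ x + toℕ y * toℕ y + toℕ z * toℕ z) mod p
      ≡ (toℕ x * toℕ y * toℕ z + 4) mod p

  mulSub : Fin p → Fin p → Fin p → Fin p
  mulSub u v w = (toℕ u * toℕ v + (p ∸ toℕ w)) mod p

  data Gen : Set where
    m₁ m₂ m₃ s₁₂ s₁₃ s₂₃ c₁₂₃ c₁₃₂ : Gen

  act : Gen → Point → Point
  act m₁  (x , y , z) = (mulSub y z x , y , z)
  act m₂  (x , y , z) = (x , mulSub x z y , z)
  act m₃  (x , y , z) = (x , y , mulSub x y z)
  act s₁₂ (x , y , z) = (y , x , z)
  act s₁₃ (x , y , z) = (z , y , x)
  act s₂₃ (x , y , z) = (x , z , y)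
  act c₁₂₃ (x , y , z) = (y , z , x)
  act c₁₃₂ (x , y , z) = (z , x , y)

  Step : Point → Point → Set
  Step a b = IsSol a × IsSol b × ∃ λ g → b ≡ act g a

  -- same G-orbit: equivalence closure of the generator steps
  -- (G is generated by the bijections act g, so this is exactly the orbit relation)
  SameOrbit : Point → Point → Set
  SameOrbit = EqClosure Step

  OrbitSize : Point → ℕ → Set
  OrbitSize s n = Σ (List Point) λ xs →
    Unique xs × length xs ≡ n × (∀ a → (a ∈ xs) ⇔ SameOrbit s a)

  NumOrbits : ℕ → Set
  NumOrbits k = Σ (List Point) λ reps →
    All IsSol reps × AllPairs (λ a b → ¬ SameOrbit a b) reps × length reps ≡ k
    × (∀ s → IsSol s → Any (SameOrbit s) reps)

{-# OPTIONS --safe #-}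

-- Write K = 𝔽ₚ[√d] for a non-square d, let g generate the cyclic group Kˣ of order N = p² - 1, and put
-- τ a = gᵃ + g⁻ᵃ.  Every solution has the form (τ a , τ b , τ (a + b)): the discriminant x² - 4 is a square
-- in K, so x = τ a and y = τ b for some a and b, and then the cubic leaves z = τ (a + b) or z = τ (a - b),
-- which m₃ exchanges.  In these coordinates the moves perform Euclid's algorithm on (a , b), and since
-- τ 0 = τ N also on (gcd a b , N); hence a solution lies in the orbit of Φ t = (τ 0 , τ t , τ t) with
-- t = gcd (a , b , N).  Conversely, divisibility of all three logarithms by a given divisor of N is invariant
-- under the moves, so t is determined by the orbit.  By Frobenius, τ t ∈ 𝔽ₚ iff p + 1 ∣ t or p - 1 ∣ t.
-- The orbit of Φ t is the image of the pairs (a , b) modulo M = N / t with gcd (a , b , M) = 1 under a map whose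
-- fibres are the classes {±(a , b)}; the number J₂(M) of these pairs satisfies J₂(q M) = q² J₂(M) if q ∣ M and
-- J₂(q M) = (q² - 1) J₂(M) otherwise, for q prime.  Finally t ↦ N / t identifies D with the set of divisors of
-- p - 1 or p + 1, and the two numbers have only the divisors 1 and 2 in common.

module Submission where

open import Defs
open import Algebra.Bundles using (CommutativeRing)
open import Algebra.Structures using (IsCommutativeRing)
import Algebra.Properties.AbelianGroup
import Algebra.Properties.CommutativeSemiring.Binomial
import Algebra.Properties.CommutativeSemiring.Exp
import Algebra.Properties.Ring
import Algebra.Properties.Semiring.Mult
import Algebra.Properties.Semiring.Mult.TCOptimised
import Algebra.Properties.Semiring.Sum
import Algebra.Solver.Ring
open import Algebra.Solver.Ring.AlmostCommutativeRing using (fromCommutativeRing; _-Raw-AlmostCommutative⟶_)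
open import Data.Bool using (if_then_else_)
open import Data.Empty using (⊥; ⊥-elim)
open import Data.Fin using (Fin; toℕ; fromℕ; inject₁)
import Data.Fin as Fin
open import Data.Fin.Properties using (toℕ<n; toℕ-fromℕ; toℕ-fromℕ<; toℕ-inject₁; toℕ-injective)
open import Data.Integer.Base using (ℤ)
import Data.Integer.Base as ℤ
import Data.Integer.Properties as ℤ
open import Data.List using (List; []; _∷_; _++_; allFin; cartesianProduct; concatMap; deduplicate; filter; length; map; upTo)
open import Data.List.Membership.Propositional using (_∈_; find; lose)
open import Data.List.Membership.Propositional.Properties
open import Data.List.Properties using (length-++; length-map; length-tabulate; length-upTo; map-cong-local)
open import Data.List.Relation.Unary.All using (All; []; _∷_; all?)
import Data.List.Relation.Unary.All as All
import Data.List.Relation.Unary.All.Properties as AllP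
open import Data.List.Relation.Unary.AllPairs using (AllPairs; []; _∷_)
import Data.List.Relation.Unary.AllPairs as AllPairs
import Data.List.Relation.Unary.AllPairs.Properties as AllPairsP
open import Data.List.Relation.Unary.Any using (Any; here; there)
import Data.List.Relation.Unary.Any as Any
open import Data.List.Relation.Unary.Unique.DecPropositional.Properties using (deduplicate-!)
open import Data.List.Relation.Unary.Unique.Propositional using (Unique)
import Data.List.Relation.Unary.Unique.Propositional.Properties as Uniq
open import Data.Maybe.Base using (Maybe)
import Data.Maybe.Base as Maybe
open import Data.Nat hiding (_+_; _*_; _^_)
import Data.Nat as ℕ
open import Data.Nat.Combinatorics using (_C_; nCn≡1; nCk≡n!/k![n-k]!; k![n∸k]!∣n!)
open import Data.Nat.Coprimality using (Coprime; coprime-divisor)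
import Data.Nat.Coprimality as Coprime
open import Data.Nat.DivMod
open import Data.Nat.Divisibility
open import Data.Nat.GCD
open GCD using (GCD)
open import Data.Nat.Induction using (<-rec)
open import Data.Nat.ListAction using (product)
open import Data.Nat.Primality
open import Data.Nat.Primality.Factorisation using (factorise)
open import Data.Nat.Properties using (≤-trans; ≤-refl; ≤-reflexive; <-irrefl; <⇒≤; _!≢0)
import Data.Nat.Properties as ℕ
open import Data.Nat.Solver using (module +-*-Solver)
open import Data.Product using (Σ; ∃; ∃₂; _,_; proj₁; proj₂) renaming (_×_ to _∧_)
open import Data.Product.Properties using (≡-dec)
open import Data.Sum using (_⊎_; inj₁; inj₂; [_,_]′)
import Data.Sum as Sum
open import Data.Vec.Functional using (replicate)
open import Function using (_∘_; id; case_of_; mk⇔)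
open import Level using (0ℓ)
open import Relation.Binary.Construct.Closure.ReflexiveTransitive using (ε; _◅_; _◅◅_)
open import Relation.Binary.Construct.Closure.Symmetric using (fwd; bwd)
import Relation.Binary.Construct.Closure.Equivalence as EqC
open import Relation.Binary.Definitions using (DecidableEquality; tri<; tri≈; tri>)
open import Relation.Binary.PropositionalEquality hiding ([_])
open import Relation.Nullary using (¬_; ¬?; contradiction; no; yes)
open import Relation.Nullary.Decidable using (_×-dec_; dec⇒maybe; decidable-stable)

-- A coordinate τ a determines a up to sign modulo N, and the third coordinate of a solution
-- excludes independent signs for a and b unless one of the two is its own negative; this is why the
-- fibres are the classes {±(a , b)} and nothing larger. Such a class has one element exactly when
-- (a , b) ≡ -(a , b) modulo M, and as a and b together generate ℤ/M this means M ∣ 2. Hence the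
-- exceptional values t = N and t = N / 2, where M is 1 or 2 and the orbit has J₂(M) points instead
-- of J₂(M) / 2. The product in the statement is J₂(N / t), written as the product of the local
-- values J₂(q^(e_q - f_q)).
--
-- In the orbit count, p + ε ≡ 2 modulo 4, so p + ε contributes a single factor 2 to N. The number
-- of divisors of p - ε therefore has e₂ as its factor at the prime 2, instead of e₂ + 1, and the
-- number of divisors of p + ε has 2; the final subtraction removes the overlap {1 , 2}.

-- Counting with duplicate-free lists

module Arithmetic where

  open import Data.Nat using (_+_; _*_; _^_)
  open import Data.Nat.Properties
  open import Data.Product using (_×_)

  unique-⊆⇒length≤ : ∀ {A : Set} {xs ys : List A} → Unique xs → (∀ {x} → x ∈ xs → x ∈ ys) → length xs ≤ length ys
  unique-⊆⇒length≤ {xs = []} _ _ = z≤n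
  unique-⊆⇒length≤ {A} {x ∷ xs} (x≢ ∷ u) sub with ∈-∃++ (sub (here refl))
  ... | as , bs , refl = begin
      suc (length xs)           ≤⟨ s≤s (unique-⊆⇒length≤ u sub′) ⟩
      suc (length (as ++ bs))   ≡⟨ cong suc (length-++ as) ⟩
      suc (length as + length bs) ≡⟨ +-suc (length as) (length bs) ⟨
      length as + suc (length bs) ≡⟨ length-++ as ⟨
      length (as ++ x ∷ bs) ∎
    where
    open ≤-Reasoning
    sub′ : ∀ {y} → y ∈ xs → y ∈ as ++ bs
    sub′ y∈ with ∈-++⁻ as (sub (there y∈))
    ... | inj₁ y∈as = ∈-++⁺ˡ y∈as
    ... | inj₂ (here refl) = contradiction refl (All.lookup x≢ y∈)
    ... | inj₂ (there y∈bs) = ∈-++⁺ʳ as y∈bs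

  unique-⇔⇒length≡ : ∀ {A : Set} {xs ys : List A} → Unique xs → Unique ys →
    (∀ {x} → x ∈ xs → x ∈ ys) → (∀ {x} → x ∈ ys → x ∈ xs) → length xs ≡ length ys
  unique-⇔⇒length≡ ux uy f g = ≤-antisym (unique-⊆⇒length≤ ux f) (unique-⊆⇒length≤ uy g)

  allPairs-map∈ : ∀ {A : Set} {R S : A → A → Set} {xs : List A} →
    (∀ {x y} → x ∈ xs → y ∈ xs → R x y → S x y) → AllPairs R xs → AllPairs S xs
  allPairs-map∈ f [] = []
  allPairs-map∈ f (r ∷ rs) =
    All.tabulate (λ y∈ → f (here refl) (there y∈) (All.lookup r y∈)) ∷ allPairs-map∈ (λ x∈ y∈ → f (there x∈) (there y∈)) rs

  length-concatMap : ∀ {A B : Set} (f : A → List B) c xs → (∀ {x} → x ∈ xs → length (f x) ≡ c) →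
    length (concatMap f xs) ≡ c * length xs
  length-concatMap f c [] h = sym (*-zeroʳ c)
  length-concatMap f c (x ∷ xs) h = begin
    length (f x ++ concatMap f xs)          ≡⟨ length-++ (f x) ⟩
    length (f x) + length (concatMap f xs)  ≡⟨ cong₂ _+_ (h (here refl)) (length-concatMap f c xs (h ∘ there)) ⟩
    c + c * length xs                       ≡⟨ *-suc c (length xs) ⟨
    c * suc (length xs)                     ∎
    where open ≡-Reasoning

  -- The fibres over `ys`, listed one after another, are a rearrangement of `xs`: both lists are
  -- duplicate-free, so mutual inclusion gives equal lengths.
  length-fibres : ∀ {A B : Set} (_≟B_ : DecidableEquality B) (f : A → B) c {xs : List A} {ys : List B} →
    Unique xs → Unique ys → (∀ {x} → x ∈ xs → f x ∈ ys) →
    (∀ {y} → y ∈ ys → length (filter (λ x → f x ≟B y) xs) ≡ c) → length xs ≡ c * length ys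
  length-fibres {A} {B} _≟B_ f c {xs} {ys} ux uy into fib =
    trans (unique-⇔⇒length≡ ux uz to from) (length-concatMap g c ys fib)
    where
    g : B → List A
    g y = filter (λ x → f x ≟B y) xs
    uz : Unique (concatMap g ys)
    uz = Uniq.concat⁺ (AllP.map⁺ (All.tabulate (λ {y} _ → Uniq.filter⁺ (λ x → f x ≟B y) ux)))
           (AllPairsP.map⁺ (AllPairs.map (λ {y} {y′} y≢y′ {_} (p , q) →
             y≢y′ (trans (sym (proj₂ (∈-filter⁻ (λ x → f x ≟B y) {xs = xs} p))) (proj₂ (∈-filter⁻ (λ x → f x ≟B y′) {xs = xs} q)))) uy))
    to : ∀ {x} → x ∈ xs → x ∈ concatMap g ys
    to {x} x∈ = ∈-concatMap⁺ g (Any.map (λ { refl → ∈-filter⁺ (λ z → f z ≟B f x) x∈ refl }) (into x∈))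
    from : ∀ {x} → x ∈ concatMap g ys → x ∈ xs
    from {x} x∈ with Any.satisfied (∈-concatMap⁻ g {xs = ys} x∈)
    ... | y , p = proj₁ (∈-filter⁻ (λ z → f z ≟B y) {xs = xs} p)

  -- Valuations

  -- The recursion local to `val`, restated so that it has a name. The prime is `suc r`, the second
  -- argument is fuel, and the third is the number being divided.
  val′ : (r : ℕ) → ℕ → ℕ → ℕ
  val′ r zero    m = 0
  val′ r (suc k) m with suc r ∣? m
  ... | yes _ = suc (val′ r k (m / suc r))
  ... | no  _ = 0

  mutual
    val≡val′ : ∀ r n → val (suc r) n ≡ val′ r n n
    val≡val′ r zero = refl
    val≡val′ r (suc n) with suc r ∣? suc n
    ... | no _ = refl
    -- The quotient and the number itself become variables, so that the constraint on the
    -- placeholder in `go≡val′` is a pattern with a unique solution.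
    ... | yes _ with suc n / suc r
    ...   | m with suc n
    ...     | n₀ = cong suc (go≡val′ r n₀ n m)

    -- The left-hand side is the local function of val, which has no name here: it is found by unification with the goal above.
    go≡val′ : ∀ r n₀ k m → _ ≡ val′ r k m
    go≡val′ r n₀ zero m = refl
    go≡val′ r n₀ (suc k) m with suc r ∣? m
    ... | no _ = refl
    ... | yes _ = cong suc (go≡val′ r n₀ k (m / suc r))

  n<q^n : ∀ q n → 1 < q → n < q ^ n
  n<q^n q zero    1<q = s≤s z≤n
  n<q^n q (suc n) 1<q = begin
    suc (suc n)       ≤⟨ s≤s (n<q^n q n 1<q) ⟩
    suc (q ^ n)       ≤⟨ +-monoˡ-≤ (q ^ n) (≤-trans (s≤s z≤n) (n<q^n q n 1<q)) ⟩
    q ^ n + q ^ n     ≡⟨ cong (q ^ n +_) (+-identityʳ (q ^ n)) ⟨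
    2 * q ^ n         ≤⟨ *-monoˡ-≤ (q ^ n) 1<q ⟩
    q * q ^ n         ∎
    where open ≤-Reasoning

  val′-power : ∀ r fuel k m → k ≤ fuel → ¬ (suc r ∣ m) → val′ r fuel (suc r ^ k * m) ≡ k
  val′-power r zero zero m _ _ = refl
  val′-power r (suc fuel) zero m _ ∤m with suc r ∣? (1 * m)
  ... | yes d = contradiction (subst (suc r ∣_) (*-identityˡ m) d) ∤m
  ... | no _ = refl
  val′-power r (suc fuel) (suc k) m (s≤s le) ∤m with suc r ∣? (suc r ^ suc k * m)
  ... | no ∤ = contradiction (∣m⇒∣m*n m (m∣m*n (suc r ^ k))) ∤
  ... | yes _ = cong suc (trans (cong (val′ r fuel) quot) (val′-power r fuel k m le ∤m))
    where
    quot : (suc r ^ suc k * m) / suc r ≡ suc r ^ k * m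
    quot = trans (/-congˡ (trans (*-assoc (suc r) (suc r ^ k) m) (*-comm (suc r) (suc r ^ k * m)))) (m*n/n≡m (suc r ^ k * m) (suc r))

  val-power : ∀ {q} k m → 1 < q → ¬ (q ∣ m) → val q (q ^ k * m) ≡ k
  val-power {suc r} k zero 1<q ∤m = contradiction (suc r ∣0) ∤m
  val-power {suc r} k m@(suc _) 1<q ∤m = trans (val≡val′ r n) (val′-power r n k m k≤n ∤m)
    where
    n = suc r ^ k * m
    -- `val` takes the number itself as fuel, which suffices because k < qᵏ.
    k≤n : k ≤ n
    k≤n = ≤-trans (<⇒≤ (n<q^n (suc r) k 1<q)) (m≤m*n (suc r ^ k) m)

  prime>1 : ∀ {q} → Prime q → 1 < q
  prime>1 pq = nonTrivial⇒n>1 _ {{prime⇒nonTrivial pq}}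

  -- Brings a positive number into the form that `val-power` reads; the laws of valuations follow by
  -- comparing such forms.
  power-split : ∀ {q} → 1 < q → ∀ n .{{_ : NonZero n}} → ∃₂ λ k m → n ≡ q ^ k * m × ¬ (q ∣ m)
  power-split {q} 1<q n {{nz}} = <-rec P step n nz
    where
    P : ℕ → Set
    P n = .(NonZero n) → ∃₂ λ k m → n ≡ q ^ k * m × ¬ (q ∣ m)
    step : ∀ n → (∀ {m} → m < n → P m) → P n
    step n rec nz with q ∣? n
    ... | no ∤ = 0 , n , sym (*-identityˡ n) , ∤
    ... | yes d with rec (quotient-< d {{n>1⇒nonTrivial 1<q}} {{nz}}) (quotient≢0 d {{nz}})
    ...   | k , m , eq , ∤ = suc k , m , trans (m∣n⇒n≡m*quotient d) (trans (cong (q *_) eq) (sym (*-assoc q (q ^ k) m))) , ∤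

  module _ {q : ℕ} (pq : Prime q) where

    val-* : ∀ m n .{{_ : NonZero m}} .{{_ : NonZero n}} → val q (m * n) ≡ val q m + val q n
    val-* m n with power-split (prime>1 pq) m | power-split (prime>1 pq) n
    ... | k , a , refl , ∤a | l , b , refl , ∤b = begin
      val q (q ^ k * a * (q ^ l * b))  ≡⟨ cong (val q) eq ⟩
      val q (q ^ (k + l) * (a * b))    ≡⟨ val-power (k + l) (a * b) 1<q (λ d → [ ∤a , ∤b ]′ (euclidsLemma a b pq d)) ⟩
      k + l                            ≡⟨ cong₂ _+_ (val-power k a 1<q ∤a) (val-power l b 1<q ∤b) ⟨
      val q (q ^ k * a) + val q (q ^ l * b) ∎
      where
      open ≡-Reasoning
      1<q = prime>1 pq
      eq : q ^ k * a * (q ^ l * b) ≡ q ^ (k + l) * (a * b)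
      eq = trans ([m*n]*[o*p]≡[m*o]*[n*p] (q ^ k) a (q ^ l) b) (cong (_* (a * b)) (sym (^-distribˡ-+-* q k l)))

    val-∤ : ∀ {n} → ¬ (q ∣ n) → val q n ≡ 0
    val-∤ {n} ∤n = trans (cong (val q) (sym (*-identityˡ n))) (val-power 0 n (prime>1 pq) ∤n)

    val-self : val q q ≡ 1
    val-self = trans (cong (val q) (sym (trans (*-identityʳ (q * 1)) (*-identityʳ q))))
      (val-power 1 1 (prime>1 pq) (λ d → <⇒≢ (prime>1 pq) (sym (∣1⇒≡1 d))))

    val-∣ : ∀ {n} .{{_ : NonZero n}} → q ∣ n → ∃ λ c → val q n ≡ suc c
    val-∣ {n} d with power-split (prime>1 pq) n
    ... | zero , m , refl , ∤m = contradiction (subst (q ∣_) (*-identityˡ m) d) ∤m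
    ... | suc k , m , refl , ∤m = k , val-power (suc k) m (prime>1 pq) ∤m

  prime∣prime⇒≡ : ∀ {q r} → Prime q → Prime r → q ∣ r → q ≡ r
  prime∣prime⇒≡ pq pr d with prime⇒irreducible pr d
  ... | inj₁ refl = contradiction pq ¬prime[1]
  ... | inj₂ e = e

  prime∣prime^⇒≡ : ∀ {q r} → Prime q → Prime r → ∀ e → r ∣ q ^ e → r ≡ q
  prime∣prime^⇒≡ pq pr zero d = contradiction (subst Prime (∣1⇒≡1 d) pr) ¬prime[1]
  prime∣prime^⇒≡ {q} pq pr (suc e) d = [ prime∣prime⇒≡ pr pq , prime∣prime^⇒≡ pq pr e ]′ (euclidsLemma q (q ^ e) pr d)

  ∃-primeDivisor : ∀ n → n ≢ 0 → n ≢ 1 → ∃ λ r → Prime r × r ∣ n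
  ∃-primeDivisor n n≢0 n≢1 with factorise n {{≢-nonZero n≢0}}
  ... | record { factors = [] ; isFactorisation = eq } = contradiction eq n≢1
  ... | record { factors = r ∷ rs ; isFactorisation = eq ; factorsPrime = pr ∷ _ } = r , pr , subst (r ∣_) (sym eq) (m∣m*n (product rs))

  -- Pairs of residues generating ℤ/M, counted by Jordan's totient J₂

  Coprime₃ : ℕ → ℕ → ℕ → Set
  Coprime₃ a b M = gcd (gcd a b) M ≡ 1

  -- `Coprime₃` tested prime by prime. In this form it passes to residues, multiples and negatives
  -- through plain divisibility, where `Coprime₃` would call for gcd identities.
  NoCommonPrime : ℕ → ℕ → ℕ → Set
  NoCommonPrime a b M = ∀ r → Prime r → r ∣ a → r ∣ b → r ∣ M → ⊥

  coprime₃⇒noCommonPrime : ∀ {a b M} → Coprime₃ a b M → NoCommonPrime a b M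
  coprime₃⇒noCommonPrime {a} {b} {M} eq r pr ra rb rM =
    ¬prime[1] (subst Prime (∣1⇒≡1 (subst (r ∣_) eq (gcd-greatest (gcd-greatest ra rb) rM))) pr)

  noCommonPrime⇒coprime₃ : ∀ {a b M} .{{_ : NonZero M}} → NoCommonPrime a b M → Coprime₃ a b M
  noCommonPrime⇒coprime₃ {a} {b} {M} {{nz}} nc with gcd (gcd a b) M ≟ 1
  ... | yes e = e
  ... | no ≢1 with ∃-primeDivisor _ (gcd[m,n]≢0 (gcd a b) M (inj₂ (≢-nonZero⁻¹ M {{nz}}))) ≢1
  ...   | r , pr , d = ⊥-elim (nc r pr (∣-trans d′ (gcd[m,n]∣m a b)) (∣-trans d′ (gcd[m,n]∣n a b)) (∣-trans d (gcd[m,n]∣n (gcd a b) M)))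
    where d′ = ∣-trans d (gcd[m,n]∣m (gcd a b) M)

  abstract

    -- The range B is separate from the modulus M because the pairs below q * M that are coprime to
    -- M alone mediate between the counts for M and for q * M.
    boundedCoprimePairs : ℕ → ℕ → List (ℕ × ℕ)
    boundedCoprimePairs B M = filter (λ { (a , b) → gcd (gcd a b) M ≟ 1 }) (cartesianProduct (upTo B) (upTo B))

    ∈-boundedCoprimePairs⁺ : ∀ {B M a b} → a < B → b < B → Coprime₃ a b M → (a , b) ∈ boundedCoprimePairs B M
    ∈-boundedCoprimePairs⁺ a< b< c = ∈-filter⁺ _ (∈-cartesianProduct⁺ (∈-upTo⁺ a<) (∈-upTo⁺ b<)) c

    ∈-boundedCoprimePairs⁻ : ∀ {B M a b} → (a , b) ∈ boundedCoprimePairs B M → a < B × b < B × Coprime₃ a b M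
    ∈-boundedCoprimePairs⁻ {B} {M} {a} {b} m with ∈-filter⁻ (λ { (a , b) → gcd (gcd a b) M ≟ 1 }) {xs = cartesianProduct (upTo B) (upTo B)} m
    ... | m′ , c with ∈-cartesianProduct⁻ (upTo B) (upTo B) m′
    ...   | ma , mb = ∈-upTo⁻ ma , ∈-upTo⁻ mb , c

    boundedCoprimePairs-unique : ∀ {B M} → Unique (boundedCoprimePairs B M)
    boundedCoprimePairs-unique {B} = Uniq.filter⁺ _ (Uniq.cartesianProduct⁺ (Uniq.upTo⁺ B) (Uniq.upTo⁺ B))

  coprimePairs : ℕ → List (ℕ × ℕ)
  coprimePairs M = boundedCoprimePairs M M

  abstract

    length-coprimePairs-1 : length (coprimePairs 1) ≡ 1
    length-coprimePairs-1 = refl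

  length-cartesianProduct : ∀ {A B : Set} (xs : List A) (ys : List B) → length (cartesianProduct xs ys) ≡ length xs * length ys
  length-cartesianProduct [] ys = refl
  length-cartesianProduct (x ∷ xs) ys = trans (length-++ (map (x ,_) ys)) (cong₂ _+_ (length-map (x ,_) ys) (length-cartesianProduct xs ys))

  module _ (M : ℕ) .{{_ : NonZero M}} where

    private
      ∣-%⁺ : ∀ {r} a → r ∣ M → r ∣ a → r ∣ a % M
      ∣-%⁺ a rM ra = %-presˡ-∣ ra rM
      ∣-%⁻ : ∀ {r} a → r ∣ M → r ∣ a % M → r ∣ a
      ∣-%⁻ a rM ra = ∣n∣m%n⇒∣m rM ra

    coprime₃-%⁺ : ∀ {a b} → Coprime₃ a b M → Coprime₃ (a % M) (b % M) M
    coprime₃-%⁺ {a} {b} c = noCommonPrime⇒coprime₃ (λ r pr ra rb rM → coprime₃⇒noCommonPrime {a} {b} c r pr (∣-%⁻ a rM ra) (∣-%⁻ b rM rb) rM)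

    coprime₃-%⁻ : ∀ {a b} → Coprime₃ (a % M) (b % M) M → Coprime₃ a b M
    coprime₃-%⁻ {a} {b} c = noCommonPrime⇒coprime₃ (λ r pr ra rb rM → coprime₃⇒noCommonPrime {a % M} {b % M} c r pr (∣-%⁺ a rM ra) (∣-%⁺ b rM rb) rM)

    private
      divmod : ℕ × ℕ → (ℕ × ℕ) × (ℕ × ℕ)
      divmod (a , b) = (a / M , b / M) , (a % M , b % M)

      divmod-injective : ∀ {x y} → divmod x ≡ divmod y → x ≡ y
      divmod-injective {a , b} {a′ , b′} eq = cong₂ _,_
        (inj (cong (proj₁ ∘ proj₁) eq) (cong (proj₁ ∘ proj₂) eq)) (inj (cong (proj₂ ∘ proj₁) eq) (cong (proj₂ ∘ proj₂) eq))
        where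
        inj : ∀ {a a′} → a / M ≡ a′ / M → a % M ≡ a′ % M → a ≡ a′
        inj {a} {a′} e f = trans (m≡m%n+[m/n]*n a M) (trans (cong₂ (λ x y → x + y * M) f e) (sym (m≡m%n+[m/n]*n a′ M)))

      divmod-combine : ∀ i a → a < M → (a + i * M) / M ≡ i × (a + i * M) % M ≡ a
      divmod-combine i a a< = trans (+-distrib-/-∣ʳ a (n∣m*n i)) (cong₂ _+_ (m<n⇒m/n≡0 a<) (m*n/n≡m i M)) ,
        trans ([m+kn]%n≡m%n a i M) (m<n⇒m%n≡m a<)

      combine-< : ∀ q i a → i < q → a < M → a + i * M < q * M
      combine-< q i a i< a< = ≤-trans (+-monoˡ-≤ (i * M) a<) (*-monoˡ-≤ M i<)

    -- Division with remainder by M splits each coordinate into a quotient below q, which is free,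
    -- and a residue; the residues alone decide coprimality to M. The q² choices of quotients give
    -- the factor.
    length-boundedCoprimePairs : ∀ q → length (boundedCoprimePairs (q * M) M) ≡ q * q * length (coprimePairs M)
    length-boundedCoprimePairs q = begin
      length A                ≡⟨ length-map divmod A ⟨
      length (map divmod A)   ≡⟨ unique-⇔⇒length≡ (Uniq.map⁺ divmod-injective boundedCoprimePairs-unique)
                                   (Uniq.cartesianProduct⁺ (Uniq.cartesianProduct⁺ (Uniq.upTo⁺ q) (Uniq.upTo⁺ q)) boundedCoprimePairs-unique)
                                   to from ⟩
      length (cartesianProduct Q (coprimePairs M)) ≡⟨ length-cartesianProduct Q _ ⟩
      length Q * length (coprimePairs M) ≡⟨ cong (_* length (coprimePairs M)) (trans (length-cartesianProduct (upTo q) _) (cong₂ _*_ (length-upTo q) (length-upTo q))) ⟩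
      q * q * length (coprimePairs M) ∎
      where
      open ≡-Reasoning
      A = boundedCoprimePairs (q * M) M
      Q = cartesianProduct (upTo q) (upTo q)
      to : ∀ {x} → x ∈ map divmod A → x ∈ cartesianProduct Q (coprimePairs M)
      to x∈ with ∈-map⁻ divmod x∈
      ... | (a , b) , ab∈ , refl with ∈-boundedCoprimePairs⁻ ab∈
      ...   | a< , b< , c = ∈-cartesianProduct⁺ (∈-cartesianProduct⁺ (∈-upTo⁺ (m<n*o⇒m/o<n {a} {q} a<)) (∈-upTo⁺ (m<n*o⇒m/o<n {b} {q} b<)))
                (∈-boundedCoprimePairs⁺ (m%n<n a M) (m%n<n b M) (coprime₃-%⁺ {a} {b} c))
      from : ∀ {x} → x ∈ cartesianProduct Q (coprimePairs M) → x ∈ map divmod A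
      from {(i , j) , (a , b)} x∈ with ∈-cartesianProduct⁻ Q (coprimePairs M) x∈
      ... | ij∈ , ab∈ with ∈-cartesianProduct⁻ (upTo q) (upTo q) ij∈ | ∈-boundedCoprimePairs⁻ {M} {M} ab∈
      ...   | i∈ , j∈ | a< , b< , c = subst (_∈ map divmod A)
                (cong₂ _,_ (cong₂ _,_ (proj₁ ai) (proj₁ bj)) (cong₂ _,_ (proj₂ ai) (proj₂ bj)))
                (∈-map⁺ divmod (∈-boundedCoprimePairs⁺ (combine-< q i a (∈-upTo⁻ i∈) a<) (combine-< q j b (∈-upTo⁻ j∈) b<)
                  (coprime₃-%⁻ {a + i * M} {b + j * M} (trans (cong₂ (λ x y → gcd (gcd x y) M) (proj₂ ai) (proj₂ bj)) c))))
        where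
        ai = divmod-combine i a a<
        bj = divmod-combine j b b<

    module _ (q : ℕ) (pq : Prime q) where

      private
        instance
          q≢0 : NonZero q
          q≢0 = prime⇒nonZero pq
          qM≢0 : NonZero (q * M)
          qM≢0 = m*n≢0 q M

      -- If q ∣ M, the numbers M and q * M have the same prime divisors, so coprimality to one is
      -- coprimality to the other.
      length-coprimePairs-∣ : q ∣ M → length (coprimePairs (q * M)) ≡ q * q * length (coprimePairs M)
      length-coprimePairs-∣ q∣M = trans (unique-⇔⇒length≡ boundedCoprimePairs-unique boundedCoprimePairs-unique to from) (length-boundedCoprimePairs q)
        where
        to : ∀ {x} → x ∈ coprimePairs (q * M) → x ∈ boundedCoprimePairs (q * M) M
        to {a , b} x∈ with ∈-boundedCoprimePairs⁻ {q * M} {q * M} x∈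
        ... | a< , b< , c = ∈-boundedCoprimePairs⁺ a< b< (noCommonPrime⇒coprime₃ λ r pr ra rb rM → coprime₃⇒noCommonPrime {a} {b} c r pr ra rb (∣n⇒∣m*n q rM))
        from : ∀ {x} → x ∈ boundedCoprimePairs (q * M) M → x ∈ coprimePairs (q * M)
        from {a , b} x∈ with ∈-boundedCoprimePairs⁻ {q * M} {M} x∈
        ... | a< , b< , c = ∈-boundedCoprimePairs⁺ a< b< (noCommonPrime⇒coprime₃ λ r pr ra rb rqM →
                coprime₃⇒noCommonPrime {a} {b} c r pr ra rb ([ (λ rq → ∣-trans rq q∣M) , id ]′ (euclidsLemma q M pr rqM)))

      -- A pair below q * M that is coprime to M fails to be coprime to q * M only if q divides both
      -- entries. Such pairs are q times the coprime pairs for M, since scaling by q preserves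
      -- coprimality to M when q ∤ M; hence X + Y = q² Y.
      length-coprimePairs-∤ : ¬ (q ∣ M) → length (coprimePairs (q * M)) ≡ (q * q ∸ 1) * length (coprimePairs M)
      length-coprimePairs-∤ q∤M = begin
        X               ≡⟨ m+n∸n≡m X Y ⟨
        X + Y ∸ Y       ≡⟨ cong (_∸ Y) total ⟩
        q * q * Y ∸ Y   ≡⟨ cong (q * q * Y ∸_) (*-identityˡ Y) ⟨
        q * q * Y ∸ 1 * Y ≡⟨ *-distribʳ-∸ Y (q * q) 1 ⟨
        (q * q ∸ 1) * Y ∎
        where
        open ≡-Reasoning
        X = length (coprimePairs (q * M))
        Y = length (coprimePairs M)
        scale : ℕ × ℕ → ℕ × ℕ
        scale (a , b) = q * a , q * b
        scale-injective : ∀ {x y} → scale x ≡ scale y → x ≡ y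
        scale-injective eq = cong₂ _,_ (*-cancelˡ-≡ _ _ q (cong proj₁ eq)) (*-cancelˡ-≡ _ _ q (cong proj₂ eq))
        L = coprimePairs (q * M) ++ map scale (coprimePairs M)
        disj : ∀ {x} → ¬ (x ∈ coprimePairs (q * M) × x ∈ map scale (coprimePairs M))
        disj (x∈ , x∈′) with ∈-map⁻ scale x∈′
        ... | (a , b) , _ , refl with ∈-boundedCoprimePairs⁻ {q * M} {q * M} x∈
        ...   | _ , _ , c = coprime₃⇒noCommonPrime {q * a} {q * b} c q pq (m∣m*n a) (m∣m*n b) (m∣m*n M)
        to : ∀ {x} → x ∈ L → x ∈ boundedCoprimePairs (q * M) M
        to {a , b} x∈ with ∈-++⁻ (coprimePairs (q * M)) x∈
        ... | inj₁ x∈₁ = case ∈-boundedCoprimePairs⁻ {q * M} {q * M} x∈₁ of λ { (a< , b< , c) → ∈-boundedCoprimePairs⁺ a< b<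
                  (noCommonPrime⇒coprime₃ λ r pr ra rb rM → coprime₃⇒noCommonPrime {a} {b} c r pr ra rb (∣n⇒∣m*n q rM)) }
        ... | inj₂ x∈₂ with ∈-map⁻ scale x∈₂
        ...   | (a′ , b′) , y∈ , refl with ∈-boundedCoprimePairs⁻ {M} {M} y∈
        ...     | a< , b< , c = ∈-boundedCoprimePairs⁺ (*-monoʳ-< q a<) (*-monoʳ-< q b<) (noCommonPrime⇒coprime₃ λ r pr ra rb rM →
                    coprime₃⇒noCommonPrime {a′} {b′} c r pr (unscale r pr rM ra) (unscale r pr rM rb) rM)
          where
          unscale : ∀ r {a} → Prime r → r ∣ M → r ∣ q * a → r ∣ a
          unscale r {a} pr rM d with euclidsLemma q a pr d
          ... | inj₂ ra = ra
          ... | inj₁ rq = contradiction (subst (_∣ M) (prime∣prime⇒≡ pr pq rq) rM) q∤M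
        from : ∀ {x} → x ∈ boundedCoprimePairs (q * M) M → x ∈ L
        from {a , b} x∈ with ∈-boundedCoprimePairs⁻ {q * M} {M} x∈
        ... | a< , b< , c with (q ∣? a) ×-dec (q ∣? b)
        ...   | yes (qa@(divides a′ refl) , qb@(divides b′ refl)) = ∈-++⁺ʳ (coprimePairs (q * M))
                  (subst (_∈ map scale (coprimePairs M)) (cong₂ _,_ (*-comm q a′) (*-comm q b′))
                  (∈-map⁺ scale (∈-boundedCoprimePairs⁺ {a = a′} {b = b′} (unscale-< a′ a<) (unscale-< b′ b<)
                    (noCommonPrime⇒coprime₃ {a′} {b′} λ r pr ra rb rM → coprime₃⇒noCommonPrime {a′ * q} {b′ * q} c r pr (∣m⇒∣m*n q ra) (∣m⇒∣m*n q rb) rM))))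
          where
          unscale-< : ∀ x → x * q < q * M → x < M
          unscale-< x lt = *-cancelˡ-< q x M (subst (_< q * M) (*-comm x q) lt)
        ...   | no ¬qab = ∈-++⁺ˡ (∈-boundedCoprimePairs⁺ a< b< (noCommonPrime⇒coprime₃ λ r pr ra rb rqM → case euclidsLemma q M pr rqM of λ where
                  (inj₁ rq) → case prime∣prime⇒≡ pr pq rq of λ { refl → ¬qab (ra , rb) }
                  (inj₂ rM) → coprime₃⇒noCommonPrime {a} {b} c r pr ra rb rM))
        total : X + Y ≡ q * q * Y
        total = begin
          X + Y  ≡⟨ cong (X +_) (length-map scale (coprimePairs M)) ⟨
          X + length (map scale (coprimePairs M)) ≡⟨ length-++ (coprimePairs (q * M)) ⟨
          length L ≡⟨ unique-⇔⇒length≡ (Uniq.++⁺ boundedCoprimePairs-unique (Uniq.map⁺ scale-injective boundedCoprimePairs-unique) disj)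
                        boundedCoprimePairs-unique to from ⟩
          length (boundedCoprimePairs (q * M) M) ≡⟨ length-boundedCoprimePairs q ⟩
          q * q * Y ∎

  -- Products over primes: the size formula and the number of divisors

  product-map-update : ∀ (f g : ℕ → ℕ) c q xs → Unique xs → q ∈ xs → (∀ {r} → r ∈ xs → r ≢ q → f r ≡ g r) →
    f q ≡ c * g q → product (map f xs) ≡ c * product (map g xs)
  product-map-update f g c q (x ∷ xs) (x∉ ∷ u) (here refl) same at =
    trans (cong₂ _*_ at (rest xs x∉ (λ m → same (there m)))) (*-assoc c (g q) (product (map g xs)))
    where
    rest : ∀ ys → All (q ≢_) ys → (∀ {r} → r ∈ ys → r ≢ q → f r ≡ g r) → product (map f ys) ≡ product (map g ys)
    rest [] _ _ = refl
    rest (y ∷ ys) (q≢y ∷ a) s = cong₂ _*_ (s (here refl) (q≢y ∘ sym)) (rest ys a (s ∘ there))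
  product-map-update f g c q (x ∷ xs) (x∉ ∷ u) (there q∈) same at = begin
    f x * product (map f xs)        ≡⟨ cong₂ _*_ (same (here refl) (All.lookup x∉ q∈)) (product-map-update f g c q xs u q∈ (same ∘ there) at) ⟩
    g x * (c * product (map g xs))  ≡⟨ *-assoc (g x) c _ ⟨
    g x * c * product (map g xs)    ≡⟨ cong (_* product (map g xs)) (*-comm (g x) c) ⟩
    c * g x * product (map g xs)    ≡⟨ *-assoc c (g x) _ ⟩
    c * (g x * product (map g xs))  ∎
    where open ≡-Reasoning

  product-map-1 : ∀ (f : ℕ → ℕ) xs → (∀ {r} → r ∈ xs → f r ≡ 1) → product (map f xs) ≡ 1
  product-map-1 f [] h = refl
  product-map-1 f (x ∷ xs) h = cong₂ _*_ (h (here refl)) (product-map-1 f xs (h ∘ there))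

  primeDivisors⁻ : ∀ {n q} → q ∈ primeDivisors n → Prime q × q ∣ n
  primeDivisors⁻ {n} m = proj₂ (∈-filter⁻ (λ q → prime? q ×-dec (q ∣? n)) {xs = upTo (suc n)} m)

  primeDivisors⁺ : ∀ {n q} .{{_ : NonZero n}} → Prime q → q ∣ n → q ∈ primeDivisors n
  primeDivisors⁺ {n} pq d = ∈-filter⁺ (λ q → prime? q ×-dec (q ∣? n)) (∈-upTo⁺ (s≤s (∣⇒≤ d))) (pq , d)

  primeDivisors-unique : ∀ n → Unique (primeDivisors n)
  primeDivisors-unique n = Uniq.filter⁺ (λ q → prime? q ×-dec (q ∣? n)) (Uniq.upTo⁺ (suc n))

  private
    -- `sizeFactor` with the valuations e of n and f of t as arguments; for prime q and f ≤ e it is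
    -- J₂(q^(e - f)).
    factor : ℕ → ℕ → ℕ → ℕ
    factor q e f = if f <ᵇ e then (q * q ∸ 1) * q ^ (2 * (e ∸ f ∸ 1)) else 1

    factor-≡ : ∀ q e → factor q e e ≡ 1
    factor-≡ q zero = refl
    factor-≡ q (suc e) = factor-≡ q e

    factor-< : ∀ q f c → factor q (suc (f + c)) f ≡ (q * q ∸ 1) * q ^ (2 * c)
    factor-< q zero c = refl
    factor-< q (suc f) c = factor-< q f c

    -- This and `factor-last` mirror the two recursions for coprime pairs: with e = f + 1 + val q M,
    -- lowering the exponent in t from f + 1 to f multiplies the factor by q² if q ∣ M, and by q² -
    -- 1 otherwise.
    factor-suc : ∀ q f c → factor q (suc (f + suc c)) f ≡ q * q * factor q (suc (f + suc c)) (suc f)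
    factor-suc q f c = begin
      factor q (suc (f + suc c)) f            ≡⟨ factor-< q f (suc c) ⟩
      (q * q ∸ 1) * q ^ (2 * suc c)           ≡⟨ cong (λ k → (q * q ∸ 1) * q ^ k) (*-suc 2 c) ⟩
      (q * q ∸ 1) * (q * (q * q ^ (2 * c)))   ≡⟨ solve 3 (λ d q r → d :* (q :* (q :* r)) := q :* q :* (d :* r)) refl (q * q ∸ 1) q (q ^ (2 * c)) ⟩
      q * q * ((q * q ∸ 1) * q ^ (2 * c))     ≡⟨ cong (q * q *_) (factor-< q (suc f) c) ⟨
      q * q * factor q (suc (suc f + c)) (suc f) ≡⟨ cong (λ e → q * q * factor q (suc e) (suc f)) (+-suc f c) ⟨
      q * q * factor q (suc (f + suc c)) (suc f) ∎
      where
      open ≡-Reasoning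
      open +-*-Solver

    factor-last : ∀ q f → factor q (suc (f + 0)) f ≡ (q * q ∸ 1) * factor q (suc (f + 0)) (suc f)
    factor-last q f = trans (factor-< q f 0) (cong ((q * q ∸ 1) *_) (sym (trans (cong (λ e → factor q (suc e) (suc f)) (+-identityʳ f)) (factor-≡ q f))))

  module _ (n : ℕ) .{{_ : NonZero n}} where

    sizes : ℕ → ℕ
    sizes t = product (map (sizeFactor n t) (primeDivisors n))

    private
      -- Moving the prime q from t to M leaves every factor of the product other than the one at q
      -- unchanged.
      sizes-step : ∀ q M t → Prime q → n ≡ q * M * t →
        length (coprimePairs M) ≡ sizes (q * t) → length (coprimePairs (q * M)) ≡ sizes t
      sizes-step q M t pq eq ih = case q ∣? M of λ where
          (yes q∣M) → trans (length-coprimePairs-∣ M q pq q∣M) (trans (cong (q * q *_) ih) (sym (upd (q * q)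
            (let c , vM = val-∣ pq q∣M in at (q * q) (suc c) vM (factor-suc q f c)))))
          (no q∤M) → trans (length-coprimePairs-∤ M q pq q∤M) (trans (cong ((q * q ∸ 1) *_) ih) (sym (upd (q * q ∸ 1)
            (at (q * q ∸ 1) 0 (val-∤ pq q∤M) (factor-last q f)))))
        where
        instance
          q≢0 : NonZero q
          q≢0 = prime⇒nonZero pq
          nz : NonZero (q * M * t)
          nz = subst NonZero eq (≢-nonZero (≢-nonZero⁻¹ n))
          qM≢0 : NonZero (q * M)
          qM≢0 = m*n≢0⇒m≢0 (q * M)
          M≢0 : NonZero M
          M≢0 = m*n≢0⇒n≢0 q
          t≢0 : NonZero t
          t≢0 = m*n≢0⇒n≢0 (q * M)
        f = val q t
        val-n : val q n ≡ suc (f + val q M)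
        val-n = begin
          val q n                  ≡⟨ cong (val q) eq ⟩
          val q (q * M * t)        ≡⟨ val-* pq (q * M) t ⟩
          val q (q * M) + f        ≡⟨ cong (_+ f) (trans (val-* pq q M) (cong (_+ val q M) (val-self pq))) ⟩
          suc (val q M) + f        ≡⟨ cong suc (+-comm (val q M) f) ⟩
          suc (f + val q M)        ∎
          where open ≡-Reasoning
        at : ∀ c k → val q M ≡ k → factor q (suc (f + k)) f ≡ c * factor q (suc (f + k)) (suc f) →
          sizeFactor n t q ≡ c * sizeFactor n (q * t) q
        at c k vM e = begin
          factor q (val q n) f               ≡⟨ cong (λ x → factor q x f) vn ⟩
          factor q (suc (f + k)) f           ≡⟨ e ⟩
          c * factor q (suc (f + k)) (suc f) ≡⟨ cong₂ (λ x y → c * factor q x y) vn (trans (val-* pq q t) (cong (_+ f) (val-self pq))) ⟨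
          c * factor q (val q n) (val q (q * t)) ∎
          where
          open ≡-Reasoning
          vn = trans val-n (cong (λ x → suc (f + x)) vM)
        upd : ∀ c → sizeFactor n t q ≡ c * sizeFactor n (q * t) q → sizes t ≡ c * sizes (q * t)
        upd c = product-map-update (sizeFactor n t) (sizeFactor n (q * t)) c q (primeDivisors n) (primeDivisors-unique n)
          (primeDivisors⁺ pq (subst (q ∣_) (sym eq) (∣m⇒∣m*n t (m∣m*n M))))
          (λ {r} r∈ r≢q → let pr = proj₁ (primeDivisors⁻ {n} r∈) in cong (factor r (val r n))
            (sym (trans (val-* pr q t) (cong (_+ val r t) (val-∤ pr (λ d → r≢q (prime∣prime⇒≡ pr pq d)))))))

      -- Induction on the prime factors of M with n fixed: each prime removed from M is passed to t,
      -- until M = 1 and t = n, where all factors are 1.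
      sizes-list : ∀ rs → All Prime rs → ∀ t → n ≡ product rs * t → length (coprimePairs (product rs)) ≡ sizes t
      sizes-list [] _ t eq = trans length-coprimePairs-1 (sym (product-map-1 (sizeFactor n t) (primeDivisors n)
        (λ {r} _ → trans (cong (λ x → factor r x (val r t)) (cong (val r) (trans eq (*-identityˡ t)))) (factor-≡ r (val r t)))))
      sizes-list (q ∷ rs) (pq ∷ prs) t eq = sizes-step q (product rs) t pq eq (sizes-list rs prs (q * t)
        (trans eq (trans (cong (_* t) (*-comm q (product rs))) (*-assoc (product rs) q t))))

    length-coprimePairs : ∀ M t → n ≡ M * t → length (coprimePairs M) ≡ sizes t
    length-coprimePairs M t eq with factorise M {{m*n≢0⇒m≢0 M {{subst NonZero eq (≢-nonZero (≢-nonZero⁻¹ n))}}}}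
    ... | record { factors = rs ; isFactorisation = refl ; factorsPrime = prs } = sizes-list rs prs t eq

  -- Induction on the primes: for n = qᵉ m with q ∤ m, every divisor of n is qⁱ d for exactly one i
  -- ≤ e and one d ∣ m. Valuations of the product recover i, hence uniqueness.
  divisors-of : ∀ qs n .{{_ : NonZero n}} → Unique qs → All Prime qs → (∀ {r} → Prime r → r ∣ n → r ∈ qs) →
    Σ (List ℕ) λ ds → Unique ds × (∀ {d} → d ∈ ds → d ∣ n) × (∀ {d} → d ∣ n → d ∈ ds) × length ds ≡ product (map (λ q → val q n + 1) qs)
  divisors-of [] n u ps complete = 1 ∷ [] , [] ∷ [] , (λ { (here refl) → 1∣ n }) , (λ d∣n → here (∣1⇒≡1 (subst (_ ∣_) n≡1 d∣n))) , refl
    where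
    n≡1 : n ≡ 1
    n≡1 with n ≟ 1
    ... | yes e = e
    ... | no ≢1 = case complete (proj₁ (proj₂ (∃-primeDivisor n (≢-nonZero⁻¹ n) ≢1))) (proj₂ (proj₂ (∃-primeDivisor n (≢-nonZero⁻¹ n) ≢1))) of λ ()
  divisors-of (q ∷ qs) n (q∉ ∷ u) (pq ∷ ps) complete with power-split (prime>1 pq) n
  ... | e , m , refl , q∤m = ds′ , unique′ , sound′ , complete′ , length′
    where
    instance
      q≢0 : NonZero q
      q≢0 = prime⇒nonZero pq
      m≢0 : NonZero m
      m≢0 = m*n≢0⇒n≢0 (q ^ e)
      qe≢0 : ∀ {i} → NonZero (q ^ i)
      qe≢0 {i} = m^n≢0 q i
    rest = divisors-of qs m u ps complete-m
      where
      complete-m : ∀ {r} → Prime r → r ∣ m → r ∈ qs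
      complete-m pr d with complete pr (∣n⇒∣m*n (q ^ e) d)
      ... | here refl = contradiction d q∤m
      ... | there r∈ = r∈
    ds = proj₁ rest
    mk : ℕ × ℕ → ℕ
    mk (i , d) = q ^ i * d
    I = cartesianProduct (upTo (suc e)) ds
    ds′ = map mk I
    ∤-ds : ∀ {d} → d ∈ ds → ¬ (q ∣ d)
    ∤-ds d∈ q∣d = q∤m (∣-trans q∣d (proj₁ (proj₂ (proj₂ rest)) d∈))
    inj : ∀ {x y} → x ∈ I → y ∈ I → x ≢ y → mk x ≢ mk y
    inj {i , d} {j , d′} x∈ y∈ x≢y eq = x≢y (cong₂ _,_ i≡j (*-cancelˡ-≡ d d′ (q ^ i) {{qe≢0 {i}}} (trans eq (cong (λ k → q ^ k * d′) (sym i≡j)))))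
      where
      i≡j : i ≡ j
      i≡j = trans (sym (val-power i d (prime>1 pq) (∤-ds (proj₂ (∈-cartesianProduct⁻ (upTo (suc e)) ds x∈)))))
        (trans (cong (val q) eq) (val-power j d′ (prime>1 pq) (∤-ds (proj₂ (∈-cartesianProduct⁻ (upTo (suc e)) ds y∈)))))
    unique′ : Unique ds′
    unique′ = AllPairsP.map⁺ (allPairs-map∈ inj (Uniq.cartesianProduct⁺ (Uniq.upTo⁺ (suc e)) (proj₁ (proj₂ rest))))
    sound′ : ∀ {d} → d ∈ ds′ → d ∣ q ^ e * m
    sound′ d∈ with ∈-map⁻ mk d∈
    ... | (i , d) , id∈ , refl with ∈-cartesianProduct⁻ (upTo (suc e)) ds id∈
    ...   | i∈ , d∈ds = *-pres-∣ (q^-mono (≤-pred (∈-upTo⁻ i∈))) (proj₁ (proj₂ (proj₂ rest)) d∈ds)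
      where
      q^-mono : ∀ {i j} → i ≤ j → q ^ i ∣ q ^ j
      q^-mono {i} {j} i≤j = subst (q ^ i ∣_) (trans (sym (^-distribˡ-+-* q i (j ∸ i))) (cong (q ^_) (m+[n∸m]≡n i≤j))) (m∣m*n (q ^ (j ∸ i)))
    -- In q^(e + 1) m = k d the prime q divides k or d; it is cancelled there, and only in the
    -- second case does the exponent i grow.
    split : ∀ e {d} → d ∣ q ^ e * m → ∃₂ λ i d′ → i ≤ e × d′ ∣ m × d ≡ q ^ i * d′
    split zero {d} d∣ = 0 , d , z≤n , subst (d ∣_) (*-identityˡ m) d∣ , sym (*-identityˡ d)
    split (suc e) {d} (divides k eq) with euclidsLemma k d pq (subst (q ∣_) (trans (sym (*-assoc q (q ^ e) m)) eq) (m∣m*n (q ^ e * m)))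
    ... | inj₁ (divides k′ refl) = case split e (divides k′ (*-cancelˡ-≡ _ _ q (begin
            q * (q ^ e * m)  ≡⟨ *-assoc q (q ^ e) m ⟨
            q * q ^ e * m    ≡⟨ eq ⟩
            k′ * q * d       ≡⟨ cong (_* d) (*-comm k′ q) ⟩
            q * k′ * d       ≡⟨ *-assoc q k′ d ⟩
            q * (k′ * d)     ∎))) of λ { (i , d′ , i≤ , d∣ , e) → i , d′ , m≤n⇒m≤1+n i≤ , d∣ , e }
      where open ≡-Reasoning
    ... | inj₂ (divides d₁ refl) = case split e {d₁} (divides k (*-cancelˡ-≡ _ _ q (begin
            q * (q ^ e * m)  ≡⟨ *-assoc q (q ^ e) m ⟨
            q * q ^ e * m    ≡⟨ eq ⟩
            k * (d₁ * q)     ≡⟨ *-assoc k d₁ q ⟨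
            k * d₁ * q       ≡⟨ *-comm (k * d₁) q ⟩
            q * (k * d₁)     ∎))) of λ { (i , d′ , i≤ , d∣ , refl) → suc i , d′ , s≤s i≤ , d∣ , trans (*-comm _ q) (sym (*-assoc q (q ^ i) d′)) }
      where open ≡-Reasoning
    complete′ : ∀ {d} → d ∣ q ^ e * m → d ∈ ds′
    complete′ d∣ with split e d∣
    ... | i , d′ , i≤ , d∣ , refl = ∈-map⁺ mk (∈-cartesianProduct⁺ (∈-upTo⁺ (s≤s i≤)) (proj₁ (proj₂ (proj₂ (proj₂ rest))) d∣))
    length′ : length ds′ ≡ (val q (q ^ e * m) + 1) * product (map (λ r → val r (q ^ e * m) + 1) qs)
    length′ = begin
      length ds′  ≡⟨ length-map mk I ⟩
      length I    ≡⟨ length-cartesianProduct (upTo (suc e)) ds ⟩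
      length (upTo (suc e)) * length ds  ≡⟨ cong₂ _*_ (trans (length-upTo (suc e)) (trans (+-comm 1 e) (cong (_+ 1) (sym (val-power e m (prime>1 pq) q∤m)))))
                                              (trans (proj₂ (proj₂ (proj₂ (proj₂ rest)))) (vals qs q∉ ps)) ⟩
      (val q (q ^ e * m) + 1) * product (map (λ r → val r (q ^ e * m) + 1) qs) ∎
      where
      open ≡-Reasoning
      vals : ∀ rs → All (q ≢_) rs → All Prime rs → product (map (λ r → val r m + 1) rs) ≡ product (map (λ r → val r (q ^ e * m) + 1) rs)
      vals [] _ _ = refl
      vals (r ∷ rs) (q≢r ∷ a) (pr ∷ prs) = cong₂ _*_ (cong (_+ 1) (sym (trans (val-* pr (q ^ e) m {{qe≢0 {e}}}) (cong (_+ val r m) (val-∤ pr (λ d → q≢r (sym (prime∣prime^⇒≡ pq pr e d)))))))) (vals rs a prs)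

  N-factor : ∀ p .{{_ : NonZero p}} → N p ≡ (p + 1) * (p ∸ 1)
  N-factor (suc m) = solve 1 (λ m → m :+ m :* (con 1 :+ m) := (con 1 :+ m :+ con 1) :* m) refl m
    where open +-*-Solver

open Arithmetic

-- Commutative rings with propositional equality

module IntegerSolver (R : CommutativeRing 0ℓ 0ℓ) where

  private
    open import Data.Integer.Base using (+_; -[1+_]; _⊖_)
    open CommutativeRing R hiding (refl; sym; trans)
    module R = CommutativeRing R
    open Algebra.Properties.Ring ring using (-0#≈0#; -‿distribˡ-*; -‿distribʳ-*; -‿involutive)
    open Algebra.Properties.AbelianGroup +-abelianGroup using (⁻¹-∙-comm)
    open Algebra.Properties.Semiring.Mult.TCOptimised semiring
    open import Relation.Binary.Reasoning.Setoid R.setoid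

    -- The canonical map from ℤ. Integer coefficients have decidable equality, so the solver can
    -- combine numerals and cancel opposite terms in any commutative ring.
    embed : ℤ → Carrier
    embed (+ n)    = n × 1#
    embed -[1+ n ] = - (suc n × 1#)

    embed-neg : ∀ i → embed (ℤ.- i) ≈ - embed i
    embed-neg (+ zero)  = R.sym -0#≈0#
    embed-neg (+ suc n) = R.refl
    embed-neg -[1+ n ]  = R.sym (-‿involutive _)

    embed-⊖ : ∀ m n → embed (m ⊖ n) ≈ m × 1# + - (n × 1#)
    embed-⊖ zero    zero    = R.sym (-‿inverseʳ 0#)
    embed-⊖ zero    (suc n) = R.sym (+-identityˡ _)
    embed-⊖ (suc m) zero    = R.sym (R.trans (+-congˡ -0#≈0#) (+-identityʳ _))
    embed-⊖ (suc m) (suc n) = begin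
      embed (suc m ⊖ suc n)                        ≡⟨ cong embed (ℤ.[1+m]⊖[1+n]≡m⊖n m n) ⟩
      embed (m ⊖ n)                                ≈⟨ embed-⊖ m n ⟩
      m × 1# + - (n × 1#)                          ≈⟨ +-congˡ (+-identityˡ _) ⟨
      m × 1# + (0# + - (n × 1#))                   ≈⟨ +-congˡ (+-congʳ (-‿inverseʳ 1#)) ⟨
      m × 1# + ((1# + - 1#) + - (n × 1#))          ≈⟨ +-congˡ (+-assoc _ _ _) ⟩
      m × 1# + (1# + (- 1# + - (n × 1#)))          ≈⟨ +-assoc _ _ _ ⟨
      (m × 1# + 1#) + (- 1# + - (n × 1#))          ≈⟨ +-cong (+-comm _ _) (⁻¹-∙-comm _ _) ⟩
      (1# + m × 1#) + - (1# + n × 1#)              ≈⟨ +-cong (1+× m 1#) (-‿cong (1+× n 1#)) ⟨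
      suc m × 1# + - (suc n × 1#)                  ∎

    embed-+ : ∀ i j → embed (i ℤ.+ j) ≈ embed i + embed j
    embed-+ (+ m)    (+ n)    = ×-homo-+ 1# m n
    embed-+ (+ m)    -[1+ n ] = embed-⊖ m (suc n)
    embed-+ -[1+ m ] (+ n)    = R.trans (embed-⊖ n (suc m)) (+-comm _ _)
    embed-+ -[1+ m ] -[1+ n ] = begin
      - (suc (suc (m ℕ.+ n)) × 1#)           ≡⟨ cong (λ k → - (suc k × 1#)) (ℕ.+-suc m n) ⟨
      - ((suc m ℕ.+ suc n) × 1#)             ≈⟨ -‿cong (×-homo-+ 1# (suc m) (suc n)) ⟩
      - (suc m × 1# + suc n × 1#)            ≈⟨ ⁻¹-∙-comm _ _ ⟨
      - (suc m × 1#) + - (suc n × 1#)        ∎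

    embed-* : ∀ i j → embed (i ℤ.* j) ≈ embed i * embed j
    embed-*⁺ : ∀ m j → embed (+ m ℤ.* j) ≈ embed (+ m) * embed j
    embed-*⁺ m (+ n) = R.trans (R.reflexive (cong embed (sym (ℤ.pos-* m n)))) (×1-homo-* m n)
    embed-*⁺ m -[1+ n ] = begin
      embed (+ m ℤ.* ℤ.- + suc n)    ≡⟨ cong embed (ℤ.neg-distribʳ-* (+ m) (+ suc n)) ⟨
      embed (ℤ.- (+ m ℤ.* + suc n))  ≈⟨ embed-neg (+ m ℤ.* + suc n) ⟩
      - embed (+ m ℤ.* + suc n)      ≈⟨ -‿cong (embed-*⁺ m (+ suc n)) ⟩
      - (m × 1# * (suc n × 1#))      ≈⟨ -‿distribʳ-* _ _ ⟩
      m × 1# * - (suc n × 1#)        ∎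
    embed-* (+ m) j = embed-*⁺ m j
    embed-* -[1+ m ] j = begin
      embed (ℤ.- + suc m ℤ.* j)      ≡⟨ cong embed (ℤ.neg-distribˡ-* (+ suc m) j) ⟨
      embed (ℤ.- (+ suc m ℤ.* j))    ≈⟨ embed-neg (+ suc m ℤ.* j) ⟩
      - embed (+ suc m ℤ.* j)        ≈⟨ -‿cong (embed-*⁺ (suc m) j) ⟩
      - (suc m × 1# * embed j)       ≈⟨ -‿distribˡ-* _ _ ⟩
      - (suc m × 1#) * embed j       ∎

    morphism : CommutativeRing.rawRing ℤ.+-*-commutativeRing -Raw-AlmostCommutative⟶ fromCommutativeRing R
    morphism = record
      { ⟦_⟧ = embed ; +-homo = embed-+ ; *-homo = embed-* ; -‿homo = embed-neg ; 0-homo = R.refl ; 1-homo = R.refl }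

    decide : ∀ i j → Maybe (embed i ≈ embed j)
    decide i j = Maybe.map (R.reflexive ∘ cong embed) (dec⇒maybe (i ℤ.≟ j))

  open Algebra.Solver.Ring _ _ morphism decide public

-- Binomial coefficients at a prime

prime∤! : ∀ {p} → Prime p → ∀ k → k < p → ¬ (p ∣ k !)
prime∤! pp zero k<p d = ¬prime[1] (subst Prime (∣1⇒≡1 d) pp)
prime∤! {p} pp (suc k) k<p d with euclidsLemma (suc k) (k !) pp d
... | inj₁ d′ = <-irrefl refl (≤-trans k<p (∣⇒≤ d′))
... | inj₂ d′ = prime∤! pp k (<⇒≤ k<p) d′

-- The prime p divides p! = (p C k) k! (p - k)!, but neither of the two factorials of numbers below
-- p.
prime∣binomial : ∀ {p} → Prime p → ∀ k → 0 < k → k < p → p ∣ (p C k)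
prime∣binomial {p@(suc p-1)} pp k 0<k k<p with euclidsLemma (p C k) (k ! ℕ.* (p ∸ k) !) pp (subst (p ∣_) eq (m∣m*n (p-1 !)))
  where
  instance
    nz : NonZero (k ! ℕ.* (p ∸ k) !)
    nz = ℕ.m*n≢0 (k !) ((p ∸ k) !) {{k !≢0}} {{(p ∸ k) !≢0}}
  eq : p ! ≡ (p C k) ℕ.* (k ! ℕ.* (p ∸ k) !)
  eq = trans (sym (m/n*n≡m (k![n∸k]!∣n! (<⇒≤ k<p)))) (cong (ℕ._* (k ! ℕ.* (p ∸ k) !)) (sym (nCk≡n!/k![n-k]! (<⇒≤ k<p))))
... | inj₁ d = d
... | inj₂ d with euclidsLemma (k !) ((p ∸ k) !) pp d
...   | inj₁ d′ = contradiction d′ (prime∤! pp k k<p)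
...   | inj₂ d′ = contradiction d′ (prime∤! pp (p ∸ k) (ℕ.∸-monoʳ-< 0<k (<⇒≤ k<p)))

-- Powers, Frobenius, roots of polynomials and primitive elements

module RingTheory {A : Set} {add mul : A → A → A} {neg : A → A} {0# 1# : A}
  (isCR : IsCommutativeRing _≡_ add mul neg 0# 1#) where

  ring : CommutativeRing 0ℓ 0ℓ
  ring = record { isCommutativeRing = isCR }

  open CommutativeRing ring public
    using (_+_; _*_; -_; semiring; commutativeSemiring; *-comm; *-assoc; +-comm; +-assoc; *-identityˡ; *-identityʳ; +-identityˡ; +-identityʳ; zeroˡ; zeroʳ; -‿inverseʳ; distribˡ; distribʳ)
  open Algebra.Properties.CommutativeSemiring.Exp commutativeSemiring public using (_^_; ^-homo-*; ^-assocʳ; ^-distrib-*)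
  open Algebra.Properties.Semiring.Mult semiring public using (_×_; ×-assoc-*; ×-assocˡ)
  module S = IntegerSolver ring
  open S using (solve; _:=_; _:+_; _:*_; :-_; _:-_; con)

  1^ : ∀ n → 1# ^ n ≡ 1#
  1^ zero = refl
  1^ (suc n) = trans (*-identityˡ _) (1^ n)

  0^suc : ∀ n → 0# ^ suc n ≡ 0#
  0^suc n = zeroˡ _

  ^-∣ : ∀ {x m k} → x ^ m ≡ 1# → m ∣ k → x ^ k ≡ 1#
  ^-∣ {x} {m} e (divides c refl) = trans (cong (x ^_) (ℕ.*-comm c m)) (trans (sym (^-assocʳ x m c)) (trans (cong (_^ c) e) (1^ c)))

  -- Over ℕ the Bézout identity takes the form d + k = l with k and l multiples of the given
  -- exponents; x^k = 1 can then be multiplied onto x^d.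
  ^-difference : ∀ {x d k l} → d ℕ.+ k ≡ l → x ^ k ≡ 1# → x ^ l ≡ 1# → x ^ d ≡ 1#
  ^-difference {x} {d} {k} eq ek el = trans (sym (*-identityʳ _)) (trans (cong (x ^ d *_) (sym ek)) (trans (sym (^-homo-* x d k)) (trans (cong (x ^_) eq) el)))

  ^-gcd : ∀ {x} m n → x ^ m ≡ 1# → x ^ n ≡ 1# → x ^ gcd m n ≡ 1#
  ^-gcd {x} m n em en with Bézout.identity (gcd-GCD m n)
  ... | Bézout.+- a b eq = ^-difference {x} {gcd m n} {b ℕ.* n} eq (^-∣ {x} {n} en (n∣m*n b)) (^-∣ {x} {m} em (n∣m*n a))
  ... | Bézout.-+ a b eq = ^-difference {x} {gcd m n} {a ℕ.* m} eq (^-∣ {x} {m} em (n∣m*n a)) (^-∣ {x} {n} en (n∣m*n b))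

  x-y≡0⇒x≡y : ∀ {x y} → (x + (- y)) ≡ 0# → x ≡ y
  x-y≡0⇒x≡y {x} {y} e = begin
    x               ≡⟨ solve 2 (λ x y → x := (x :- y) :+ y) refl x y ⟩
    (x + (- y)) + y ≡⟨ cong (_+ y) e ⟩
    0# + y          ≡⟨ +-identityˡ y ⟩
    y               ∎
    where open ≡-Reasoning

  inverse-unique : ∀ {x y z} → x * y ≡ 1# → x * z ≡ 1# → y ≡ z
  inverse-unique {x} {y} {z} xy xz = begin
    y           ≡⟨ *-identityʳ y ⟨
    y * 1#      ≡⟨ cong (y *_) xz ⟨
    y * (x * z) ≡⟨ solve 3 (λ x y z → y :* (x :* z) := (x :* y) :* z) refl x y z ⟩
    (x * y) * z ≡⟨ cong (_* z) xy ⟩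
    1# * z      ≡⟨ *-identityˡ z ⟩
    z           ∎
    where open ≡-Reasoning

  module Frobenius {p} (pp : Prime p) (char : p × 1# ≡ 0#) where

    ∣⇒×≡0 : ∀ {m} → p ∣ m → ∀ a → m × a ≡ 0#
    ∣⇒×≡0 (divides c refl) a = begin
      (c ℕ.* p) × a   ≡⟨ cong (_× a) (ℕ.*-comm c p) ⟩
      (p ℕ.* c) × a   ≡⟨ ×-assocˡ a p c ⟨
      p × (c × a)     ≡⟨ cong (p ×_) (*-identityˡ (c × a)) ⟨
      p × (1# * (c × a)) ≡⟨ ×-assoc-* p 1# (c × a) ⟨
      (p × 1#) * (c × a) ≡⟨ cong (_* (c × a)) char ⟩
      0# * (c × a)     ≡⟨ zeroˡ _ ⟩
      0#               ∎
      where open ≡-Reasoning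

    open Algebra.Properties.CommutativeSemiring.Binomial commutativeSemiring using (theorem; binomialTerm)
    open Algebra.Properties.Semiring.Sum semiring using (sum; sum-init-last; sum-cong-≗; sum-replicate-zero)

    ^p-+ : ∀ x y → (x + y) ^ p ≡ (x ^ p) + (y ^ p)
    ^p-+ x y = expand p pp (λ k 0<k k<p → ∣⇒×≡0 (prime∣binomial pp k 0<k k<p))
      where
      open ≡-Reasoning
      -- The exponent is generalised to n so that it can be matched as a successor, which separates
      -- the outer two terms of the binomial sum from the middle terms that vanish.
      expand : ∀ n → Prime n → (∀ k → 0 < k → k < n → ∀ a → (n C k) × a ≡ 0#) → (x + y) ^ n ≡ (x ^ n) + (y ^ n)
      expand zero pr _ = contradiction pr ¬prime[0]
      expand n@(suc n-1) pr vanish = begin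
        (x + y) ^ n                                 ≡⟨ theorem n x y ⟩
        f Fin.zero + sum (λ i → f (Fin.suc i))       ≡⟨ cong₂ _+_ first (sum-init-last (λ i → f (Fin.suc i))) ⟩
        (y ^ n) + (sum (λ i → f (Fin.suc (inject₁ i))) + f (Fin.suc (fromℕ n-1)))
          ≡⟨ cong ((y ^ n) +_) (cong₂ _+_ (trans (sum-cong-≗ middle) (sum-replicate-zero n-1)) last) ⟩
        (y ^ n) + (0# + (x ^ n))                     ≡⟨ solve 2 (λ a b → a :+ (con (ℤ.+ 0) :+ b) := b :+ a) refl (y ^ n) (x ^ n) ⟩
        (x ^ n) + (y ^ n)                            ∎
        where
        f : Fin (suc n) → A
        f = binomialTerm x y n
        first : f Fin.zero ≡ y ^ n
        first = trans (+-identityʳ _) (*-identityˡ _)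
        middle : ∀ i → f (Fin.suc (inject₁ i)) ≡ replicate n-1 0# i
        middle i = vanish (suc (toℕ (inject₁ i))) (s≤s z≤n) (s≤s (subst (_< n-1) (sym (toℕ-inject₁ i)) (toℕ<n i))) _
        last : f (Fin.suc (fromℕ n-1)) ≡ x ^ n
        last = begin
          (n C suc (toℕ (fromℕ n-1))) × ((x ^ suc (toℕ (fromℕ n-1))) * (y ^ (n ∸ suc (toℕ (fromℕ n-1)))))
            ≡⟨ cong (λ k → (n C suc k) × ((x ^ suc k) * (y ^ (n ∸ suc k)))) (toℕ-fromℕ n-1) ⟩
          (n C n) × ((x ^ n) * (y ^ (n ∸ n)))  ≡⟨ cong₂ (λ c k → c × ((x ^ n) * (y ^ k))) (nCn≡1 n) (ℕ.n∸n≡0 n) ⟩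
          ((x ^ n) * 1#) + 0#                 ≡⟨ trans (+-identityʳ _) (*-identityʳ _) ⟩
          x ^ n                               ∎

  module Domain (domain : ∀ {x y} → x * y ≡ 0# → x ≡ 0# ⊎ y ≡ 0#) (1≢0 : 1# ≢ 0#) (_≟A_ : DecidableEquality A) where

    *-cancel : ∀ {x y z} → x ≢ 0# → x * y ≡ x * z → y ≡ z
    *-cancel {x} {y} {z} x≢0 e with domain {x} {y + (- z)} (begin
        x * (y + (- z))         ≡⟨ solve 3 (λ x y z → x :* (y :- z) := x :* y :- x :* z) refl x y z ⟩
        (x * y) + (- (x * z))   ≡⟨ cong (λ w → w + (- (x * z))) e ⟩
        (x * z) + (- (x * z))   ≡⟨ -‿inverseʳ _ ⟩
        0#                      ∎)
      where open ≡-Reasoning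
    ... | inj₁ x≡0 = contradiction x≡0 x≢0
    ... | inj₂ e′ = x-y≡0⇒x≡y e′

    ^≢0 : ∀ {x} n → x ≢ 0# → x ^ n ≢ 0#
    ^≢0 zero x≢0 = 1≢0
    ^≢0 (suc n) x≢0 e = [ x≢0 , ^≢0 n x≢0 ]′ (domain e)

    -- Monic polynomial functions of degree n in Horner form.
    Monic : ℕ → (A → A) → Set
    Monic zero    f = ∀ x → f x ≡ 1#
    Monic (suc n) f = Σ (A → A) λ g → Σ A λ c → Monic n g ∧ (∀ x → f x ≡ (x * g x) + c)

    -- Synthetic division: if g x = (x - a) g′ x + g a, then x g x + c has quotient x g′ x + g a by
    -- x - a and remainder a g a + c.
    monic-divide : ∀ n {f} → Monic (suc n) f → ∀ a → Σ (A → A) λ g → Monic n g ∧ (∀ x → f x ≡ ((x + (- a)) * g x) + f a)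
    monic-divide zero {f} (g , c , mg , eq) a = g , mg , λ x → begin
      f x                                       ≡⟨ eq x ⟩
      (x * g x) + c                             ≡⟨ cong (λ w → (x * w) + c) (mg x) ⟩
      (x * 1#) + c                              ≡⟨ solve 3 (λ x a c → x :* con (ℤ.+ 1) :+ c := (x :- a) :* con (ℤ.+ 1) :+ (a :* con (ℤ.+ 1) :+ c)) refl x a c ⟩
      ((x + (- a)) * 1#) + ((a * 1#) + c)       ≡⟨ cong₂ (λ v w → ((x + (- a)) * v) + ((a * w) + c)) (mg x) (mg a) ⟨
      ((x + (- a)) * g x) + ((a * g a) + c)     ≡⟨ cong (((x + (- a)) * g x) +_) (eq a) ⟨
      ((x + (- a)) * g x) + f a                 ∎
      where open ≡-Reasoning
    monic-divide (suc n) {f} (g , c , mg , eq) a with monic-divide n mg a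
    ... | g′ , mg′ , eq′ = (λ x → (x * g′ x) + g a) , (g′ , g a , mg′ , λ _ → refl) , λ x → begin
      f x                                                        ≡⟨ eq x ⟩
      (x * g x) + c                                              ≡⟨ cong (λ w → (x * w) + c) (eq′ x) ⟩
      (x * (((x + (- a)) * g′ x) + g a)) + c                     ≡⟨ solve 5 (λ x a g′ ga c → x :* ((x :- a) :* g′ :+ ga) :+ c := (x :- a) :* (x :* g′ :+ ga) :+ (a :* ga :+ c)) refl x a (g′ x) (g a) c ⟩
      ((x + (- a)) * ((x * g′ x) + g a)) + ((a * g a) + c)       ≡⟨ cong (((x + (- a)) * ((x * g′ x) + g a)) +_) (eq a) ⟨
      ((x + (- a)) * ((x * g′ x) + g a)) + f a                   ∎
      where open ≡-Reasoning

    monic-roots : ∀ n {f} → Monic n f → ∀ {xs} → Unique xs → (∀ {x} → x ∈ xs → f x ≡ 0#) → length xs ≤ n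
    monic-roots n mf {[]} _ _ = z≤n
    monic-roots zero mf {x ∷ xs} _ roots = contradiction (trans (sym (mf x)) (roots (here refl))) 1≢0
    monic-roots (suc n) {f} mf {x ∷ xs} (x∉ ∷ u) roots with monic-divide n mf x
    ... | g , mg , eq = s≤s (monic-roots n mg u λ {y} y∈ → case domain {y + (- x)} {g y} (root y y∈) of λ where
            (inj₁ e) → contradiction (sym (x-y≡0⇒x≡y e)) (All.lookup x∉ y∈)
            (inj₂ e) → e)
      where
      open ≡-Reasoning
      root : ∀ y → y ∈ xs → (y + (- x)) * g y ≡ 0#
      root y y∈ = begin
        (y + (- x)) * g y          ≡⟨ +-identityʳ _ ⟨
        ((y + (- x)) * g y) + 0#   ≡⟨ cong (((y + (- x)) * g y) +_) (roots (here refl)) ⟨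
        ((y + (- x)) * g y) + f x  ≡⟨ eq y ⟨
        f y                        ≡⟨ roots (there y∈) ⟩
        0#                         ∎

    monic-^ : ∀ n → Monic n (_^ n)
    monic-^ zero x = refl
    monic-^ (suc n) = (_^ n) , 0# , monic-^ n , λ x → sym (+-identityʳ _)

    roots-of-unity≤ : ∀ n {xs} → Unique xs → (∀ {x} → x ∈ xs → x ^ suc n ≡ 1#) → length xs ≤ suc n
    roots-of-unity≤ n u h = monic-roots (suc n) {λ x → (x ^ suc n) + (- 1#)} ((_^ n) , (- 1#) , monic-^ n , λ _ → refl) u
      (λ x∈ → trans (cong (_+ (- 1#)) (h x∈)) (-‿inverseʳ 1#))

    -- The polynomial is x^(n + 2) - x rather than x^(n + 1) - 1, so that 0 is a root too and the
    -- bound applies to a list of all elements of a finite field.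
    fixed-by-power≤ : ∀ n {xs} → Unique xs → (∀ {x} → x ∈ xs → x ^ suc (suc n) ≡ x) → length xs ≤ suc (suc n)
    fixed-by-power≤ n u h = monic-roots (suc (suc n)) {λ x → (x ^ suc (suc n)) + (- x)}
      ((λ x → (x ^ suc n) + (- 1#)) , 0# , ((_^ n) , (- 1#) , monic-^ n , λ _ → refl) ,
        λ x → solve 2 (λ x y → x :* y :- x := x :* (y :- con (ℤ.+ 1)) :+ con (ℤ.+ 0)) refl x (x ^ suc n)) u
      (λ {x} x∈ → trans (cong (_+ (- x)) (h x∈)) (-‿inverseʳ x))

    record HasOrder (x : A) (m : ℕ) : Set where
      field
        ^order  : x ^ m ≡ 1#
        order∣  : ∀ {k} → x ^ k ≡ 1# → m ∣ k
    open HasOrder public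

    order⇒≢0 : ∀ {x n} .{{_ : NonZero n}} → HasOrder x n → x ≢ 0#
    order⇒≢0 {n = suc n} ox x≡0 = 1≢0 (trans (sym (^order ox)) (trans (cong (_^ suc n) x≡0) (0^suc n)))

    ^-injective-< : ∀ {x n} .{{_ : NonZero n}} → HasOrder x n → ∀ {i j} → i < j → j < n → x ^ i ≢ x ^ j
    ^-injective-< {x} ox {i} {j} i<j j<n eq = ℕ.<⇒≱ (ℕ.≤-<-trans (ℕ.m∸n≤m j i) j<n) (∣⇒≤ {{>-nonZero (ℕ.m<n⇒0<n∸m i<j)}} (order∣ ox one))
      where
      one : x ^ (j ∸ i) ≡ 1#
      one = sym (*-cancel {x ^ i} (^≢0 i (order⇒≢0 ox)) (trans (*-identityʳ _) (trans eq (trans (cong (x ^_) (sym (ℕ.m+[n∸m]≡n (<⇒≤ i<j)))) (^-homo-* x i (j ∸ i))))))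

    ^-injective : ∀ {x n} .{{_ : NonZero n}} → HasOrder x n → ∀ {i j} → i < n → j < n → x ^ i ≡ x ^ j → i ≡ j
    ^-injective ox {i} {j} i<n j<n eq with ℕ.<-cmp i j
    ... | tri< i<j _ _ = contradiction eq (^-injective-< ox i<j j<n)
    ... | tri≈ _ i≡j _ = i≡j
    ... | tri> _ _ j<i = contradiction (sym eq) (^-injective-< ox j<i i<n)

    -- If (x y)^k = 1, the exponent n k removes y and leaves x^(n k) = 1, so m ∣ n k and m ∣ k by
    -- coprimality; symmetrically n ∣ k.
    hasOrder-* : ∀ {x y m n} → HasOrder x m → HasOrder y n → Coprime m n → HasOrder (x * y) (m ℕ.* n)
    hasOrder-* {x} {y} {m} {n} ox oy cop = record
      { ^order = trans (^-distrib-* x y (m ℕ.* n)) (trans (cong₂ _*_ (^-∣ {x} {m} (^order ox) (m∣m*n n)) (^-∣ {y} {n} (^order oy) (n∣m*n m))) (*-identityˡ 1#))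
      ; order∣ = λ {k} e → coprime-*∣ (m∣ k e) (n∣ k e)
      }
      where
      m∣ : ∀ k → (x * y) ^ k ≡ 1# → m ∣ k
      m∣ k e = coprime-divisor cop (order∣ ox {n ℕ.* k} (begin
        x ^ (n ℕ.* k)                        ≡⟨ *-identityʳ _ ⟨
        x ^ (n ℕ.* k) * 1#                   ≡⟨ cong (x ^ (n ℕ.* k) *_) (^-∣ {y} {n} (^order oy) (m∣m*n k)) ⟨
        x ^ (n ℕ.* k) * y ^ (n ℕ.* k)        ≡⟨ ^-distrib-* x y (n ℕ.* k) ⟨
        (x * y) ^ (n ℕ.* k)                  ≡⟨ ^-∣ {x * y} {k} e (n∣m*n n) ⟩
        1#                                   ∎))
        where open ≡-Reasoning
      n∣ : ∀ k → (x * y) ^ k ≡ 1# → n ∣ k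
      n∣ k e = coprime-divisor (Coprime.sym cop) (order∣ oy {m ℕ.* k} (begin
        y ^ (m ℕ.* k)                        ≡⟨ *-identityˡ _ ⟨
        1# * y ^ (m ℕ.* k)                   ≡⟨ cong (_* y ^ (m ℕ.* k)) (^-∣ {x} {m} (^order ox) (m∣m*n k)) ⟨
        x ^ (m ℕ.* k) * y ^ (m ℕ.* k)        ≡⟨ ^-distrib-* x y (m ℕ.* k) ⟨
        (x * y) ^ (m ℕ.* k)                  ≡⟨ ^-∣ {x * y} {k} e (n∣m*n m) ⟩
        1#                                   ∎))
        where open ≡-Reasoning
      coprime-*∣ : ∀ {k} → m ∣ k → n ∣ k → m ℕ.* n ∣ k
      coprime-*∣ {k} (divides c refl) nk = subst (m ℕ.* n ∣_) (ℕ.*-comm m c)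
        (*-monoʳ-∣ m (coprime-divisor (Coprime.sym cop) (subst (n ∣_) (ℕ.*-comm c m) nk)))

    -- If x^k = 1, then x^d = 1 for d = gcd k (q^(e + 1)). A proper divisor of q^(e + 1) divides
    -- q^e, which is excluded, so d is q^(e + 1) itself.
    hasOrder-primePower : ∀ {q x} e → Prime q → x ^ (q ℕ.^ suc e) ≡ 1# → x ^ (q ℕ.^ e) ≢ 1# → HasOrder x (q ℕ.^ suc e)
    hasOrder-primePower {q} {x} e pq one ≢one = record { ^order = one ; order∣ = λ {k} ek → go k ek }
      where
      instance
        q≢0 : NonZero q
        q≢0 = prime⇒nonZero pq
      proper : ∀ {d} → d ∣ q ℕ.^ suc e → d ≡ q ℕ.^ suc e ⊎ d ∣ q ℕ.^ e
      proper {d} (divides k eq) with k ℕ.≟ 1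
      ... | yes refl = inj₁ (sym (trans eq (ℕ.+-identityʳ d)))
      ... | no k≢1 with ∃-primeDivisor k (λ { refl → ≢-nonZero⁻¹ _ {{ℕ.m^n≢0 q (suc e)}} eq }) k≢1
      ...   | r , pr , r∣k with prime∣prime^⇒≡ pq pr (suc e) (subst (r ∣_) (sym eq) (∣m⇒∣m*n d r∣k))
      ...     | refl with r∣k
      ...       | divides k′ refl = inj₂ (divides k′ (ℕ.*-cancelˡ-≡ _ _ q (trans eq (trans (cong (ℕ._* d) (ℕ.*-comm k′ q)) (ℕ.*-assoc q k′ d)))))
      go : ∀ k → x ^ k ≡ 1# → q ℕ.^ suc e ∣ k
      go k ek with proper (gcd[m,n]∣n k (q ℕ.^ suc e))
      ... | inj₁ eq = subst (_∣ k) eq (gcd[m,n]∣m k (q ℕ.^ suc e))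
      ... | inj₂ d = contradiction (^-∣ {x} {gcd k (q ℕ.^ suc e)} (^-gcd k (q ℕ.^ suc e) ek one) d) ≢one

    -- Here n counts the units; `elements` contains 0 as well, hence the length `suc n`.
    module Cyclic (n : ℕ) .{{n≢0 : NonZero n}} (lagrange : ∀ {x} → x ≢ 0# → x ^ n ≡ 1#)
      (elements : List A) (unique : Unique elements) (size : length elements ≡ suc n) where

      private
        -- Put k = n / q = q^e c. If x^(k + 1) = x held for all n + 1 elements, a polynomial of
        -- degree k + 1 ≤ n would have too many roots. For an x violating it, x^c has order q^(e +
        -- 1).
        ∃-primePowerOrder : ∀ {q} e → Prime q → q ℕ.^ suc e ∣ n → ∃ λ y → HasOrder y (q ℕ.^ suc e)
        ∃-primePowerOrder {q} e pq (divides c eq) with all? (λ x → (x ^ suc (q ℕ.^ e ℕ.* c)) ≟A x) elements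
        ... | no ¬all with find (AllP.¬All⇒Any¬ (λ x → (x ^ suc (q ℕ.^ e ℕ.* c)) ≟A x) elements ¬all)
        ...   | x , _ , x^≢x = (x ^ c) , hasOrder-primePower e pq (trans (^-assocʳ x c (q ℕ.^ suc e)) (trans (cong (x ^_) (sym eq)) (lagrange x≢0)))
                  (λ one → x^≢x (trans (cong (x *_) (trans (cong (x ^_) (ℕ.*-comm (q ℕ.^ e) c)) (trans (sym (^-assocʳ x c (q ℕ.^ e))) one))) (*-identityʳ x)))
          where
          x≢0 : x ≢ 0#
          x≢0 refl = x^≢x (0^suc (q ℕ.^ e ℕ.* c))
        ∃-primePowerOrder {q} e pq (divides c eq) | yes all = contradiction bound (ℕ.<⇒≱ k<n)
          where
          k = q ℕ.^ e ℕ.* c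
          instance
            c≢0 : NonZero c
            c≢0 = ℕ.m*n≢0⇒m≢0 c {q ℕ.^ suc e} {{subst NonZero eq (≢-nonZero (≢-nonZero⁻¹ n))}}
            k≢0 : NonZero k
            k≢0 = ℕ.m*n≢0 (q ℕ.^ e) c {{ℕ.m^n≢0 q e {{prime⇒nonZero pq}}}}
          n≡q*k : n ≡ q ℕ.* k
          n≡q*k = trans eq (trans (ℕ.*-comm c _) (ℕ.*-assoc q (q ℕ.^ e) c))
          k<n : k < n
          k<n = subst (k <_) (sym n≡q*k) (subst (_< q ℕ.* k) (ℕ.+-identityʳ k) (ℕ.*-monoˡ-< k (prime>1 pq)))
          bound′ : ∀ k → .(NonZero k) → (∀ {x} → x ∈ elements → x ^ suc k ≡ x) → length elements ≤ suc k
          bound′ (suc k) _ h = fixed-by-power≤ k unique h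
          bound : n ≤ k
          bound = ℕ.≤-pred (subst (_≤ suc k) size (bound′ k k≢0 (λ x∈ → All.lookup all x∈)))

        -- Strong induction on m: the full power of one prime is split off, and elements of the two
        -- coprime orders are multiplied.
        ∃-order : ∀ m → .(NonZero m) → m ∣ n → ∃ λ y → HasOrder y m
        ∃-order = <-rec (λ m → .(NonZero m) → m ∣ n → ∃ λ y → HasOrder y m) step
          where
          step : ∀ m → (∀ {m′} → m′ < m → .(NonZero m′) → m′ ∣ n → ∃ λ y → HasOrder y m′) → .(NonZero m) → m ∣ n → ∃ λ y → HasOrder y m
          step m rec nz m∣n with m ℕ.≟ 1
          ... | yes refl = 1# , record { ^order = *-identityʳ 1# ; order∣ = λ _ → 1∣ _ }
          ... | no m≢1 with ∃-primeDivisor m (≢-nonZero⁻¹ m {{nz}}) m≢1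
          ...   | q , pq , q∣m with power-split (prime>1 pq) m {{nz}}
          ...     | zero , m′ , refl , q∤m′ = contradiction (subst (q ∣_) (ℕ.*-identityˡ m′) q∣m) q∤m′
          ...     | suc e , m′ , refl , q∤m′ = (proj₁ a * proj₁ b) , hasOrder-* (proj₂ a) (proj₂ b) cop
            where
            instance
              q≢0 : NonZero q
              q≢0 = prime⇒nonZero pq
              m′≢0 : NonZero m′
              m′≢0 = ℕ.m*n≢0⇒n≢0 (q ℕ.^ suc e) {{≢-nonZero (≢-nonZero⁻¹ _ {{nz}})}}
            1<q^ : 1 < q ℕ.^ suc e
            1<q^ = ℕ.<-≤-trans (prime>1 pq) (ℕ.m≤m*n q (q ℕ.^ e) {{ℕ.m^n≢0 q e}})
            m′< : m′ < q ℕ.^ suc e ℕ.* m′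
            m′< = subst (_< q ℕ.^ suc e ℕ.* m′) (ℕ.+-identityʳ m′) (ℕ.*-monoˡ-< m′ 1<q^)
            a = ∃-primePowerOrder e pq (∣-trans (m∣m*n m′) m∣n)
            b = rec m′< m′≢0 (∣-trans (n∣m*n (q ℕ.^ suc e)) m∣n)
            cop : Coprime (q ℕ.^ suc e) m′
            cop {d} (d₁ , d₂) with d ℕ.≟ 1
            ... | yes d≡1 = d≡1
            ... | no d≢1 with ∃-primeDivisor d (λ { refl → ≢-nonZero⁻¹ m′ (0∣⇒≡0 d₂) }) d≢1
            ...   | r , pr , r∣d = contradiction (subst (_∣ m′) (prime∣prime^⇒≡ pq pr (suc e) (∣-trans r∣d d₁)) (∣-trans r∣d d₂)) q∤m′

      ∃-generator : ∃ λ g → HasOrder g n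
      ∃-generator = ∃-order n n≢0 ∣-refl

-- The fields 𝔽ₚ and 𝔽ₚ[√d]

module ModularRing (p : ℕ) .{{p≢0 : NonZero p}} where

  infixl 7 _⊗_
  infixl 6 _⊕_

  [_] : ℕ → Fin p
  [ n ] = n mod p

  _⊕_ _⊗_ : Fin p → Fin p → Fin p
  x ⊕ y = [ toℕ x ℕ.+ toℕ y ]
  x ⊗ y = [ toℕ x ℕ.* toℕ y ]

  -- This form makes `mulSub u v w` the residue u v - w; for x = 0 the number p is reduced to 0.
  ⊖_ : Fin p → Fin p
  ⊖ x = [ p ∸ toℕ x ]

  toℕ-[] : ∀ n → toℕ [ n ] ≡ n % p
  toℕ-[] n = toℕ-fromℕ< (m%n<n n p)

  []-cong : ∀ {m n} → m % p ≡ n % p → [ m ] ≡ [ n ]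
  []-cong {m} {n} e = toℕ-injective (trans (toℕ-[] m) (trans e (sym (toℕ-[] n))))

  [toℕ] : ∀ x → [ toℕ x ] ≡ x
  [toℕ] x = toℕ-injective (trans (toℕ-[] (toℕ x)) (m<n⇒m%n≡m (toℕ<n x)))

  []-+ : ∀ m n → [ m ℕ.+ n ] ≡ [ m ] ⊕ [ n ]
  []-+ m n = []-cong (trans (%-distribˡ-+ m n p) (sym (cong₂ (λ a b → (a ℕ.+ b) % p) (toℕ-[] m) (toℕ-[] n))))

  []-* : ∀ m n → [ m ℕ.* n ] ≡ [ m ] ⊗ [ n ]
  []-* m n = []-cong (trans (%-distribˡ-* m n p) (sym (cong₂ (λ a b → (a ℕ.* b) % p) (toℕ-[] m) (toℕ-[] n))))

  []≡0⇒∣ : ∀ {n} → [ n ] ≡ [ 0 ] → p ∣ n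
  []≡0⇒∣ {n} e = m%n≡0⇒n∣m n p (trans (sym (toℕ-[] n)) (trans (cong toℕ e) (trans (toℕ-[] 0) (0%n≡0))))
    where
    0%n≡0 : 0 % p ≡ 0
    0%n≡0 = n∣m⇒m%n≡0 0 p (p ∣0)

  ∣⇒[]≡0 : ∀ {n} → p ∣ n → [ n ] ≡ [ 0 ]
  ∣⇒[]≡0 {n} d = []-cong (trans (n∣m⇒m%n≡0 n p d) (sym (n∣m⇒m%n≡0 0 p (p ∣0))))

  private
    elim : (P : Fin p → Set) → (∀ n → P [ n ]) → ∀ x → P x
    elim P h x = subst P ([toℕ] x) (h (toℕ x))

    -- Every law is the image under [_] of the corresponding law of ℕ.
    ⊕-assoc : ∀ x y z → (x ⊕ y) ⊕ z ≡ x ⊕ (y ⊕ z)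
    ⊕-assoc = elim _ λ a → elim _ λ b → elim _ λ c → begin
      ([ a ] ⊕ [ b ]) ⊕ [ c ]  ≡⟨ cong (_⊕ [ c ]) ([]-+ a b) ⟨
      [ a ℕ.+ b ] ⊕ [ c ]      ≡⟨ []-+ (a ℕ.+ b) c ⟨
      [ a ℕ.+ b ℕ.+ c ]        ≡⟨ cong [_] (ℕ.+-assoc a b c) ⟩
      [ a ℕ.+ (b ℕ.+ c) ]      ≡⟨ []-+ a (b ℕ.+ c) ⟩
      [ a ] ⊕ [ b ℕ.+ c ]      ≡⟨ cong ([ a ] ⊕_) ([]-+ b c) ⟩
      [ a ] ⊕ ([ b ] ⊕ [ c ])  ∎
      where open ≡-Reasoning

    ⊗-assoc : ∀ x y z → (x ⊗ y) ⊗ z ≡ x ⊗ (y ⊗ z)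
    ⊗-assoc = elim _ λ a → elim _ λ b → elim _ λ c → begin
      ([ a ] ⊗ [ b ]) ⊗ [ c ]  ≡⟨ cong (_⊗ [ c ]) ([]-* a b) ⟨
      [ a ℕ.* b ] ⊗ [ c ]      ≡⟨ []-* (a ℕ.* b) c ⟨
      [ a ℕ.* b ℕ.* c ]        ≡⟨ cong [_] (ℕ.*-assoc a b c) ⟩
      [ a ℕ.* (b ℕ.* c) ]      ≡⟨ []-* a (b ℕ.* c) ⟩
      [ a ] ⊗ [ b ℕ.* c ]      ≡⟨ cong ([ a ] ⊗_) ([]-* b c) ⟩
      [ a ] ⊗ ([ b ] ⊗ [ c ])  ∎
      where open ≡-Reasoning

    ⊗-distribʳ-⊕ : ∀ x y z → (y ⊕ z) ⊗ x ≡ (y ⊗ x) ⊕ (z ⊗ x)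
    ⊗-distribʳ-⊕ = elim _ λ a → elim _ λ b → elim _ λ c → begin
      ([ b ] ⊕ [ c ]) ⊗ [ a ]             ≡⟨ cong (_⊗ [ a ]) ([]-+ b c) ⟨
      [ b ℕ.+ c ] ⊗ [ a ]                 ≡⟨ []-* (b ℕ.+ c) a ⟨
      [ (b ℕ.+ c) ℕ.* a ]                 ≡⟨ cong [_] (ℕ.*-distribʳ-+ a b c) ⟩
      [ b ℕ.* a ℕ.+ c ℕ.* a ]             ≡⟨ []-+ (b ℕ.* a) (c ℕ.* a) ⟩
      [ b ℕ.* a ] ⊕ [ c ℕ.* a ]           ≡⟨ cong₂ _⊕_ ([]-* b a) ([]-* c a) ⟩
      ([ b ] ⊗ [ a ]) ⊕ ([ c ] ⊗ [ a ])   ∎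
      where open ≡-Reasoning

    ⊕-comm : ∀ x y → x ⊕ y ≡ y ⊕ x
    ⊕-comm x y = cong [_] (ℕ.+-comm (toℕ x) (toℕ y))

    ⊗-comm : ∀ x y → x ⊗ y ≡ y ⊗ x
    ⊗-comm x y = cong [_] (ℕ.*-comm (toℕ x) (toℕ y))

    ⊕-identityˡ : ∀ x → [ 0 ] ⊕ x ≡ x
    ⊕-identityˡ = elim _ λ a → sym ([]-+ 0 a)

    ⊗-identityˡ : ∀ x → [ 1 ] ⊗ x ≡ x
    ⊗-identityˡ = elim _ λ a → trans (sym ([]-* 1 a)) (cong [_] (ℕ.+-identityʳ a))

    ⊖-inverseˡ : ∀ x → (⊖ x) ⊕ x ≡ [ 0 ]
    ⊖-inverseˡ x = begin
      [ p ∸ toℕ x ] ⊕ x            ≡⟨ cong ([ p ∸ toℕ x ] ⊕_) ([toℕ] x) ⟨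
      [ p ∸ toℕ x ] ⊕ [ toℕ x ]    ≡⟨ []-+ (p ∸ toℕ x) (toℕ x) ⟨
      [ p ∸ toℕ x ℕ.+ toℕ x ]      ≡⟨ cong [_] (ℕ.m∸n+n≡m (<⇒≤ (toℕ<n x))) ⟩
      [ p ]                        ≡⟨ ∣⇒[]≡0 ∣-refl ⟩
      [ 0 ]                        ∎
      where open ≡-Reasoning

  isCommutativeRing : IsCommutativeRing _≡_ _⊕_ _⊗_ ⊖_ [ 0 ] [ 1 ]
  isCommutativeRing = record
    { isRing = record
      { +-isAbelianGroup = record
        { isGroup = record
          { isMonoid = record
            { isSemigroup = record { isMagma = record { isEquivalence = isEquivalence ; ∙-cong = cong₂ _⊕_ } ; assoc = ⊕-assoc }
            ; identity = ⊕-identityˡ , λ x → trans (⊕-comm x _) (⊕-identityˡ x) }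
          ; inverse = ⊖-inverseˡ , λ x → trans (⊕-comm x _) (⊖-inverseˡ x)
          ; ⁻¹-cong = cong ⊖_ }
        ; comm = ⊕-comm }
      ; *-cong = cong₂ _⊗_
      ; *-assoc = ⊗-assoc
      ; *-identity = ⊗-identityˡ , λ x → trans (⊗-comm x _) (⊗-identityˡ x)
      ; distrib = (λ x y z → trans (⊗-comm x (y ⊕ z)) (trans (⊗-distribʳ-⊕ x y z) (cong₂ _⊕_ (⊗-comm y x) (⊗-comm z x)))) , ⊗-distribʳ-⊕ }
    ; *-comm = ⊗-comm }

-- A[√d], with (a , b) standing for a + b √d

module QuadraticExtension {A : Set} {add mul : A → A → A} {neg : A → A} {0# 1# : A}
  (isCR : IsCommutativeRing _≡_ add mul neg 0# 1#) (d : A) where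

  private
    module R = RingTheory isCR
    open R using (_+_; _*_; -_)
    open R.S using (solve; _:=_; _:+_; _:*_; :-_; _:-_; con)

    K : Set
    K = A ∧ A

  addK mulK : K → K → K
  addK (a , b) (c , e) = a + c , b + e
  mulK (a , b) (c , e) = a * c + d * (b * e) , a * e + b * c

  negK : K → K
  negK (a , b) = - a , - b

  ι : A → K
  ι a = a , 0#

  ι-* : ∀ a b → ι (a * b) ≡ mulK (ι a) (ι b)
  ι-* a b = cong₂ _,_ (solve 3 (λ a b d → a :* b := a :* b :+ d :* (con (ℤ.+ 0) :* con (ℤ.+ 0))) refl a b d)
    (solve 2 (λ a b → con (ℤ.+ 0) := a :* con (ℤ.+ 0) :+ con (ℤ.+ 0) :* b) refl a b)

  ι-+ : ∀ a b → ι (a + b) ≡ addK (ι a) (ι b)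
  ι-+ a b = cong (a + b ,_) (sym (R.+-identityˡ 0#))

  ι-neg : ∀ a → ι (- a) ≡ negK (ι a)
  ι-neg a = cong (- a ,_) (solve 0 (con (ℤ.+ 0) := :- con (ℤ.+ 0)) refl)

  isCommutativeRing : IsCommutativeRing _≡_ addK mulK negK (ι 0#) (ι 1#)
  isCommutativeRing = record
    { isRing = record
      { +-isAbelianGroup = record
        { isGroup = record
          { isMonoid = record
            { isSemigroup = record
              { isMagma = record { isEquivalence = isEquivalence ; ∙-cong = cong₂ addK }
              ; assoc = λ { (a , b) (c , e) (f , h) → cong₂ _,_ (R.+-assoc a c f) (R.+-assoc b e h) } }
            ; identity = (λ { (a , b) → cong₂ _,_ (R.+-identityˡ a) (R.+-identityˡ b) }) , (λ { (a , b) → cong₂ _,_ (R.+-identityʳ a) (R.+-identityʳ b) }) }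
          ; inverse = (λ { (a , b) → cong₂ _,_ (trans (R.+-comm _ a) (R.-‿inverseʳ a)) (trans (R.+-comm _ b) (R.-‿inverseʳ b)) }) , (λ { (a , b) → cong₂ _,_ (R.-‿inverseʳ a) (R.-‿inverseʳ b) })
          ; ⁻¹-cong = cong negK }
        ; comm = λ { (a , b) (c , e) → cong₂ _,_ (R.+-comm a c) (R.+-comm b e) } }
      ; *-cong = cong₂ mulK
      ; *-assoc = λ { (a , b) (c , e) (f , h) → cong₂ _,_
          (solve 7 (λ a b c e f h d → (a :* c :+ d :* (b :* e)) :* f :+ d :* ((a :* e :+ b :* c) :* h) := a :* (c :* f :+ d :* (e :* h)) :+ d :* (b :* (c :* h :+ e :* f))) refl a b c e f h d)
          (solve 7 (λ a b c e f h d → (a :* c :+ d :* (b :* e)) :* h :+ (a :* e :+ b :* c) :* f := a :* (c :* h :+ e :* f) :+ b :* (c :* f :+ d :* (e :* h))) refl a b c e f h d) }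
      ; *-identity = identityˡ , λ x → trans (comm x _) (identityˡ x)
      ; distrib = distribˡ , λ x y z → trans (comm (addK y z) x) (trans (distribˡ x y z) (cong₂ addK (comm x y) (comm x z))) }
    ; *-comm = comm }
    where
    comm : ∀ x y → mulK x y ≡ mulK y x
    comm (a , b) (c , e) = cong₂ _,_ (solve 5 (λ a b c e d → a :* c :+ d :* (b :* e) := c :* a :+ d :* (e :* b)) refl a b c e d)
      (solve 4 (λ a b c e → a :* e :+ b :* c := c :* b :+ e :* a) refl a b c e)
    identityˡ : ∀ x → mulK (ι 1#) x ≡ x
    identityˡ (a , b) = cong₂ _,_ (solve 3 (λ a b d → con (ℤ.+ 1) :* a :+ d :* (con (ℤ.+ 0) :* b) := a) refl a b d)
      (solve 2 (λ a b → con (ℤ.+ 1) :* b :+ con (ℤ.+ 0) :* a := b) refl a b)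
    distribˡ : ∀ x y z → mulK x (addK y z) ≡ addK (mulK x y) (mulK x z)
    distribˡ (a , b) (c , e) (f , h) = cong₂ _,_
      (solve 7 (λ a b c e f h d → a :* (c :+ f) :+ d :* (b :* (e :+ h)) := (a :* c :+ d :* (b :* e)) :+ (a :* f :+ d :* (b :* h))) refl a b c e f h d)
      (solve 6 (λ a b c e f h → a :* (e :+ h) :+ b :* (c :+ f) := (a :* e :+ b :* c) :+ (a :* h :+ b :* f)) refl a b c e f h)

  norm : K → A
  norm (a , b) = a * a + - (d * (b * b))

  norm-* : ∀ x y → norm (mulK x y) ≡ norm x * norm y
  norm-* (a , b) (c , e) = solve 5 (λ a b c e d →
    (a :* c :+ d :* (b :* e)) :* (a :* c :+ d :* (b :* e)) :- d :* ((a :* e :+ b :* c) :* (a :* e :+ b :* c))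
      := (a :* a :- d :* (b :* b)) :* (c :* c :- d :* (e :* e))) refl a b c e d

-- Frobenius and a primitive element in the quadratic extension of a prime field

module FiniteField (p : ℕ) .{{p≢0 : NonZero p}} (pp : Prime p) (k : ℕ) (p≡ : p ≡ suc (2 ℕ.* suc k))
  {F : Set} {addF mulF : F → F → F} {negF : F → F} {0F 1F : F}
  (isCR : IsCommutativeRing _≡_ addF mulF negF 0F 1F)
  (domainF : ∀ {x y} → mulF x y ≡ 0F → x ≡ 0F ⊎ y ≡ 0F) (1≢0F : 1F ≢ 0F) (_≟F_ : DecidableEquality F)
  (2x≡0⇒x≡0 : ∀ {x} → addF x x ≡ 0F → x ≡ 0F)
  (charF : RingTheory._×_ isCR p 1F ≡ 0F) (span : ∀ x → ∃ (λ n → RingTheory._×_ isCR n 1F ≡ x))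
  (elements : List F) (elements-unique : Unique elements) (∈-elements : ∀ x → x ∈ elements) (length-elements : length elements ≡ p) where

  module F = RingTheory isCR
  open F using () renaming (_^_ to _^F_; _×_ to _×F_; _+_ to infixl 6 _⊕_; _*_ to infixl 7 _⊗_; -_ to infix 8 ⊖_)
  open F.S using (solve; _:=_; _:+_; _:*_; :-_; _:-_; con)
  module FD = F.Domain domainF 1≢0F _≟F_

  private
    2<p : 2 < p
    2<p = subst (2 <_) (sym p≡) (s≤s (s≤s (subst (1 ≤_) (sym (ℕ.+-suc k (k ℕ.+ 0))) (s≤s z≤n))))

  -- Every element is a multiple of 1, and additivity of the p-th power carries the identity from n
  -- to n + 1.
  fermat : ∀ x → x ^F p ≡ x
  fermat x = let n , n×1≡x = span x in subst (λ y → y ^F p ≡ y) n×1≡x (go n)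
    where
    go : ∀ n → (n ×F 1F) ^F p ≡ n ×F 1F
    go zero = subst (λ m → 0F ^F m ≡ 0F) (sym p≡) (F.0^suc (2 ℕ.* suc k))
    go (suc n) = trans (F.Frobenius.^p-+ pp charF 1F (n ×F 1F)) (cong₂ _⊕_ (F.1^ p) (go n))

  unit-^ : ∀ {x} → x ≢ 0F → x ^F (2 ℕ.* suc k) ≡ 1F
  unit-^ {x} x≢0 = FD.*-cancel {x} x≢0 (trans (subst (λ m → x ^F m ≡ x) p≡ (fermat x)) (sym (F.*-identityʳ x)))

  inverseF : ∀ {x} → x ≢ 0F → ∃ λ y → x ⊗ y ≡ 1F
  -- The exponent is p - 2, written so that one more factor x gives the exponent `2 * suc k` by
  -- computation.
  inverseF {x} x≢0 = (x ^F (k ℕ.+ 1 ℕ.* suc k)) , unit-^ x≢0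

  -- Otherwise a section of squaring is injective, hence surjective, yet it cannot reach both square roots of 1.
  ∃-nonsquare : ∃ λ d → ∀ x → x ⊗ x ≢ d
  ∃-nonsquare with All.all? (λ d → Any.any? (λ x → (x ⊗ x) ≟F d) elements) elements
  ... | no ¬all = let d , _ , ¬sq = find (AllP.¬All⇒Any¬ (λ d → Any.any? (λ x → (x ⊗ x) ≟F d) elements) elements ¬all) in
          d , λ x x²≡d → ¬sq (Any.map (λ { refl → x²≡d }) (∈-elements x))
  ... | yes all = contradiction (unique-⊆⇒length≤ uniq (λ {x} _ → ∈-elements x)) (ℕ.<⇒≱ (≤-reflexive (sym (cong suc (length-map r elements)))))
    where
    root : ∀ d → ∃ λ x → x ⊗ x ≡ d
    root d = Any.satisfied (All.lookup all (∈-elements d))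
    r : F → F
    r d = proj₁ (root d)
    r² : ∀ d → r d ⊗ r d ≡ d
    r² d = proj₂ (root d)
    r-injective : ∀ {d e} → r d ≡ r e → d ≡ e
    r-injective {d} {e} eq = trans (sym (r² d)) (trans (cong₂ _⊗_ eq eq) (r² e))
    w = ⊖ (r 1F)
    w² : w ⊗ w ≡ 1F
    w² = trans (solve 1 (λ x → :- x :* :- x := x :* x) refl (r 1F)) (r² 1F)
    w≢r1 : w ≢ r 1F
    w≢r1 e = 1≢0F (trans (sym (r² 1F)) (trans (cong (_⊗ r 1F) r1≡0) (F.zeroˡ _)))
      where
      r1≡0 : r 1F ≡ 0F
      r1≡0 = 2x≡0⇒x≡0 (trans (cong (r 1F ⊕_) (sym e)) (F.-‿inverseʳ (r 1F)))
    w∉ : ∀ {x} → x ∈ map r elements → w ≢ x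
    w∉ x∈ refl with ∈-map⁻ r x∈
    ... | d , _ , e = w≢r1 (trans e (cong r (trans (sym (r² d)) (trans (sym (cong₂ _⊗_ e e)) w²))))
    uniq : Unique (w ∷ map r elements)
    uniq = All.tabulate w∉ ∷ Uniq.map⁺ r-injective elements-unique

  module Extension (d : F) (nonsquare : ∀ x → x ⊗ x ≢ d) where

    module Q = QuadraticExtension isCR d
    open Q using (ι; ι-*; ι-+; ι-neg; norm; norm-*) public
    K : Set
    K = F ∧ F
    module R = RingTheory Q.isCommutativeRing
    open R

    1≢0K : ι 1F ≢ ι 0F
    1≢0K e = 1≢0F (cong proj₁ e)

    -- If a² = d b² with b ≠ 0, then d = (a / b)² would be a square.
    norm≡0 : ∀ x → norm x ≡ 0F → x ≡ ι 0F
    norm≡0 (a , b) e with b ≟F 0F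
    ... | yes refl = cong (_, 0F) ([ id , id ]′ (domainF {a} {a} (trans (solve 2 (λ a d → a :* a := a :* a :- d :* (con (ℤ.+ 0) :* con (ℤ.+ 0))) refl a d) e)))
    ... | no b≢0 = let c , bc≡1 = inverseF b≢0 in contradiction (begin
        (a ⊗ c) ⊗ (a ⊗ c)           ≡⟨ solve 2 (λ a c → (a :* c) :* (a :* c) := (a :* a) :* (c :* c)) refl a c ⟩
        (a ⊗ a) ⊗ (c ⊗ c)           ≡⟨ cong (_⊗ (c ⊗ c)) (F.x-y≡0⇒x≡y e) ⟩
        (d ⊗ (b ⊗ b)) ⊗ (c ⊗ c)     ≡⟨ solve 3 (λ d b c → (d :* (b :* b)) :* (c :* c) := d :* ((b :* c) :* (b :* c))) refl d b c ⟩
        d ⊗ ((b ⊗ c) ⊗ (b ⊗ c))     ≡⟨ cong (λ u → d ⊗ (u ⊗ u)) bc≡1 ⟩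
        d ⊗ (1F ⊗ 1F)         ≡⟨ solve 1 (λ d → d :* (con (ℤ.+ 1) :* con (ℤ.+ 1)) := d) refl d ⟩
        d                           ∎) (nonsquare (a ⊗ c))
      where open ≡-Reasoning

    domainK : ∀ {x y} → x * y ≡ ι 0F → x ≡ ι 0F ⊎ y ≡ ι 0F
    domainK {x} {y} xy≡0 = [ inj₁ ∘ norm≡0 x , inj₂ ∘ norm≡0 y ]′ (domainF {norm x} {norm y} norm-xy)
      where
      norm-0 : norm (ι 0F) ≡ 0F
      norm-0 = solve 1 (λ d → con (ℤ.+ 0) :* con (ℤ.+ 0) :- d :* (con (ℤ.+ 0) :* con (ℤ.+ 0)) := con (ℤ.+ 0)) refl d
      norm-xy : norm x ⊗ norm y ≡ 0F
      norm-xy = trans (sym (norm-* x y)) (trans (cong norm xy≡0) norm-0)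

    _≟K_ : DecidableEquality K
    _≟K_ = ≡-dec _≟F_ _≟F_

    module D = R.Domain domainK 1≢0K _≟K_
    open D

    ι-^ : ∀ x n → ι (x ^F n) ≡ ι x ^ n
    ι-^ x zero = refl
    ι-^ x (suc n) = trans (ι-* x (x ^F n)) (cong (ι x *_) (ι-^ x n))

    ι^p : ∀ x → ι x ^ p ≡ ι x
    ι^p x = trans (sym (ι-^ x p)) (cong ι (fermat x))

    ι-× : ∀ x n → ι (n ×F x) ≡ n × ι x
    ι-× x zero = refl
    ι-× x (suc n) = trans (ι-+ x (n ×F x)) (cong (ι x +_) (ι-× x n))

    charK : p × ι 1F ≡ ι 0F
    charK = trans (sym (ι-× 1F p)) (cong ι charF)

    open R.Frobenius pp charK using (^p-+) public

    private
      s : K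
      s = 0F , 1F

      split : ∀ a b → (a , b) ≡ ι a + ι b * s
      split a b = cong₂ _,_ (solve 3 (λ a b d → a := a :+ (b :* con (ℤ.+ 0) :+ d :* (con (ℤ.+ 0) :* con (ℤ.+ 1)))) refl a b d)
        (solve 1 (λ b → b := con (ℤ.+ 0) :+ (b :* con (ℤ.+ 1) :+ con (ℤ.+ 0) :* con (ℤ.+ 0))) refl b)

      s² : s * s ≡ ι d
      s² = cong₂ _,_ (solve 1 (λ d → con (ℤ.+ 0) :* con (ℤ.+ 0) :+ d :* (con (ℤ.+ 1) :* con (ℤ.+ 1)) := d) refl d)
        (solve 0 (con (ℤ.+ 0) :* con (ℤ.+ 1) :+ con (ℤ.+ 1) :* con (ℤ.+ 0) := con (ℤ.+ 0)) refl)

      -- The Legendre symbol of d in Euler's form, with `suc k` = (p - 1) / 2. At this stage only e²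
      -- = 1 is shown; e = -1 is derived in `frobenius` from an element of order p² - 1.
      e : F
      e = d ^F suc k

      s^p : s ^ p ≡ ι e * s
      s^p = begin
        s ^ p                         ≡⟨ cong (s ^_) p≡ ⟩
        s * s ^ (2 ℕ.* suc k)         ≡⟨ cong (s *_) (^-assocʳ s 2 (suc k)) ⟨
        s * (s ^ 2) ^ suc k           ≡⟨ cong (λ u → s * u ^ suc k) (trans (cong (s *_) (*-identityʳ s)) s²) ⟩
        s * ι d ^ suc k               ≡⟨ cong (s *_) (ι-^ d (suc k)) ⟨
        s * ι e                       ≡⟨ *-comm s (ι e) ⟩
        ι e * s                       ∎
        where open ≡-Reasoning

      d≢0 : d ≢ 0F
      d≢0 d≡0 = nonsquare 0F (trans (F.zeroˡ 0F) (sym d≡0))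

      e² : e ⊗ e ≡ 1F
      e² = trans (sym (F.^-homo-* d (suc k) (suc k))) (trans (cong (λ m → d ^F (suc k ℕ.+ m)) (sym (ℕ.+-identityʳ (suc k)))) (unit-^ d≢0))

      frobenius-e : ∀ a b → (a , b) ^ p ≡ (a , b ⊗ e)
      frobenius-e a b = begin
        (a , b) ^ p                         ≡⟨ cong (_^ p) (split a b) ⟩
        (ι a + ι b * s) ^ p                 ≡⟨ ^p-+ (ι a) (ι b * s) ⟩
        ι a ^ p + (ι b * s) ^ p             ≡⟨ cong₂ _+_ (ι^p a) (trans (^-distrib-* (ι b) s p) (cong₂ _*_ (ι^p b) s^p)) ⟩
        ι a + ι b * (ι e * s)               ≡⟨ cong (ι a +_) (trans (sym (*-assoc (ι b) (ι e) s)) (cong (_* s) (sym (ι-* b e)))) ⟩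
        ι a + ι (b ⊗ e) * s                 ≡⟨ split a (b ⊗ e) ⟨
        (a , b ⊗ e)                         ∎
        where open ≡-Reasoning

      -- Two applications of Frobenius multiply the second component by e² = 1. Cancelling x gives
      -- the relation x^N = 1 for x ≠ 0 on which the existence of a primitive element rests.
      ^p² : ∀ x → x ^ (p ℕ.* p) ≡ x
      ^p² (a , b) = begin
        (a , b) ^ (p ℕ.* p)   ≡⟨ ^-assocʳ (a , b) p p ⟨
        ((a , b) ^ p) ^ p     ≡⟨ cong (_^ p) (frobenius-e a b) ⟩
        (a , b ⊗ e) ^ p       ≡⟨ frobenius-e a (b ⊗ e) ⟩
        (a , b ⊗ e ⊗ e)       ≡⟨ cong (a ,_) (trans (F.*-assoc b e e) (trans (cong (b ⊗_) e²) (F.*-identityʳ b))) ⟩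
        (a , b)               ∎
        where open ≡-Reasoning

    suc-N : p ℕ.* p ≡ suc (N p)
    suc-N = sym (ℕ.suc-pred (p ℕ.* p) {{ℕ.m*n≢0 p p}})

    p≤N : p ≤ N p
    p≤N = ℕ.≤-pred (subst (p <_) suc-N (subst (_< p ℕ.* p) (ℕ.*-identityʳ p) (ℕ.*-monoʳ-< p (<⇒≤ 2<p))))

    instance
      N≢0 : NonZero (N p)
      N≢0 = >-nonZero (≤-trans (<⇒≤ (<⇒≤ 2<p)) p≤N)

    private
      lagrange : ∀ {x} → x ≢ ι 0F → x ^ N p ≡ ι 1F
      lagrange {x} x≢0 = *-cancel {x} x≢0 (trans (trans (cong (x ^_) (sym suc-N)) (^p² x)) (sym (*-identityʳ x)))

      module C = D.Cyclic (N p) lagrange (cartesianProduct elements elements) (Uniq.cartesianProduct⁺ elements-unique elements-unique)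
        (trans (length-cartesianProduct elements elements) (trans (cong₂ ℕ._*_ length-elements length-elements) suc-N))

    ∃-primitive : ∃ λ g → HasOrder g (N p)
    ∃-primitive = C.∃-generator

    module Generated (g : K) (g-order : HasOrder g (N p)) where

      g≢0 : g ≢ ι 0F
      g≢0 = order⇒≢0 g-order

      -- Were e = 1, Frobenius would fix g and give g^(p - 1) = 1, although the order of g is p² - 1
      -- ≥ p. So the factor e - 1 of e² - 1 = 0 can be cancelled, which leaves e = -1: Frobenius is
      -- conjugation.
      frobenius : ∀ a b → (a , b) ^ p ≡ (a , ⊖ b)
      frobenius a b = trans (frobenius-e a b) (cong (a ,_) (begin
          b ⊗ e                             ≡⟨ solve 2 (λ b e → b :* e := b :* (e :+ con (ℤ.+ 1)) :- b) refl b e ⟩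
          b ⊗ (e ⊕ 1F) ⊕ ⊖ b                ≡⟨ cong (λ u → b ⊗ u ⊕ ⊖ b) e+1≡0 ⟩
          b ⊗ 0F ⊕ ⊖ b                      ≡⟨ solve 1 (λ b → b :* con (ℤ.+ 0) :- b := :- b) refl b ⟩
          ⊖ b                               ∎))
        where
        open ≡-Reasoning
        g^p : e ≡ 1F → g ^ p ≡ g
        g^p e≡1 = trans (frobenius-e (proj₁ g) (proj₂ g)) (cong (proj₁ g ,_) (trans (cong (proj₂ g ⊗_) e≡1) (F.*-identityʳ _)))
        g^≡1 : e ≡ 1F → g ^ pred p ≡ ι 1F
        g^≡1 e≡1 = *-cancel {g} g≢0 (trans (trans (cong (g ^_) (ℕ.suc-pred p)) (g^p e≡1)) (sym (*-identityʳ g)))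
        pred≢0 : NonZero (pred p)
        pred≢0 = subst (NonZero ∘ pred) (sym p≡) _
        e≢1 : e ≢ 1F
        e≢1 e≡1 = ℕ.<⇒≱ (≤-trans (≤-reflexive (ℕ.suc-pred p)) p≤N) (∣⇒≤ {{pred≢0}} (order∣ g-order {pred p} (g^≡1 e≡1)))
        e+1≡0 : e ⊕ 1F ≡ 0F
        e+1≡0 = FD.*-cancel {e ⊕ ⊖ 1F} {e ⊕ 1F} {0F} (λ eq → e≢1 (F.x-y≡0⇒x≡y eq)) (begin
          (e ⊕ ⊖ 1F) ⊗ (e ⊕ 1F)   ≡⟨ solve 1 (λ e → (e :+ :- con (ℤ.+ 1)) :* (e :+ con (ℤ.+ 1)) := e :* e :- con (ℤ.+ 1)) refl e ⟩
          (e ⊗ e) ⊕ ⊖ 1F          ≡⟨ cong (_⊕ ⊖ 1F) e² ⟩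
          1F ⊕ ⊖ 1F               ≡⟨ F.-‿inverseʳ 1F ⟩
          0F                      ≡⟨ F.zeroʳ _ ⟨
          (e ⊕ ⊖ 1F) ⊗ 0F         ∎)

      ^p-fixed : ∀ x → x ^ p ≡ x → ι (proj₁ x) ≡ x
      ^p-fixed (a , b) eq = cong (a ,_) (sym (2x≡0⇒x≡0 (trans (cong (b ⊕_) (sym (cong proj₂ (trans (sym (frobenius a b)) eq)))) (F.-‿inverseʳ b))))

      private
        powers : List K
        powers = map (g ^_) (upTo (N p))

        powers-unique : Unique powers
        powers-unique = AllPairsP.map⁺ (AllPairsP.applyUpTo⁺₁ id (N p) (^-injective-< g-order))

        powers-^N : ∀ {y} → y ∈ powers → y ^ N p ≡ ι 1F
        powers-^N {y} y∈ = let a , _ , eq = ∈-map⁻ (g ^_) y∈ in trans (cong (_^ N p) eq) (lagrange (^≢0 a g≢0))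

        bound : ∀ n .{{_ : NonZero n}} {xs} → Unique xs → length xs ≡ suc n → (∀ {y} → y ∈ xs → y ^ n ≡ ι 1F) → suc n ≤ n
        bound (suc n) u len h = subst (_≤ suc n) len (roots-of-unity≤ n u h)

        -- An x ≠ 0 outside the N distinct powers of g would be a further root of y^N = 1. The
        -- double negation is removed by decidability of membership.
        ∉-powers : ∀ {x} → x ≢ ι 0F → ¬ (¬ (x ∈ powers))
        ∉-powers {x} x≢0 x∉ = <-irrefl refl (bound (N p) {x ∷ powers} (All.tabulate (λ {y} y∈ x≡y → x∉ (subst (_∈ powers) (sym x≡y) y∈)) ∷ powers-unique)
          (cong suc (trans (length-map (g ^_) (upTo (N p))) (length-upTo (N p)))) one)
          where
          one : ∀ {y} → y ∈ x ∷ powers → y ^ N p ≡ ι 1F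
          one (here y≡x) = trans (cong (_^ N p) y≡x) (lagrange x≢0)
          one (there y∈) = powers-^N y∈

      g-generates : ∀ x → x ≢ ι 0F → ∃ λ a → x ≡ g ^ a
      g-generates x x≢0 = let a , _ , eq = ∈-map⁻ (g ^_) (decidable-stable (Any.any? (x ≟K_) powers) (∉-powers x≢0)) in a , eq

-- The torus parametrisation of the cubic

module Torus (p : ℕ) .{{p≢0 : NonZero p}} (k : ℕ) (p≡ : p ≡ suc (2 ℕ.* suc k))
  {K : Set} {addK mulK : K → K → K} {negK : K → K} {0# 1# : K}
  (isCR : IsCommutativeRing _≡_ addK mulK negK 0# 1#)
  (domain : ∀ {x y} → mulK x y ≡ 0# → x ≡ 0# ⊎ y ≡ 0#) (1≢0 : 1# ≢ 0#) (2≢0 : addK 1# 1# ≢ 0#) (_≟K_ : DecidableEquality K)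
  (^p-+ : ∀ x y → RingTheory._^_ isCR (addK x y) p ≡ addK (RingTheory._^_ isCR x p) (RingTheory._^_ isCR y p))
  (ι : Fin p → K) (π : K → Fin p) (π-ι : ∀ x → π (ι x) ≡ x)
  (ι-+ : ∀ x y → ι (ModularRing._⊕_ p x y) ≡ addK (ι x) (ι y)) (ι-* : ∀ x y → ι (ModularRing._⊗_ p x y) ≡ mulK (ι x) (ι y))
  (ι-neg : ∀ x → ι (ModularRing.⊖_ p x) ≡ negK (ι x)) (ι-1 : ι (1 mod p) ≡ 1#)
  (ι^p : ∀ x → RingTheory._^_ isCR (ι x) p ≡ ι x)
  (^p-fixed : ∀ x → RingTheory._^_ isCR x p ≡ x → ι (π x) ≡ x)
  (g : K) (g-order : RingTheory.Domain.HasOrder isCR domain 1≢0 _≟K_ g (N p))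
  (g-generates : ∀ x → x ≢ 0# → ∃ (λ a → x ≡ RingTheory._^_ isCR g a))
  where

  open ModularRing p
  open RingTheory isCR
  open Domain domain 1≢0 _≟K_
  open S using (solve; _:=_; _:+_; _:*_; :-_; _:-_; con)
  open ≡-Reasoning

  private
    N≡ : N p ≡ (p ℕ.+ 1) ℕ.* (p ∸ 1)
    N≡ = N-factor p

    instance
      p-1≢0 : NonZero (p ∸ 1)
      p-1≢0 = subst (λ q → NonZero (q ∸ 1)) (sym p≡) _

      p+1≢0 : NonZero (p ℕ.+ 1)
      p+1≢0 = subst NonZero (ℕ.+-comm 1 p) _

      N≢0 : NonZero (N p)
      N≢0 = subst NonZero (sym N≡) (ℕ.m*n≢0 (p ℕ.+ 1) (p ∸ 1))

    p≡1+ : p ≡ suc (p ∸ 1)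
    p≡1+ = trans p≡ (cong (λ q → suc (q ∸ 1)) (sym p≡))

    2∣p+1 : 2 ∣ p ℕ.+ 1
    2∣p+1 = subst (2 ∣_) (sym (trans (cong (ℕ._+ 1) p≡) (Nat.solve 1 (λ m → Nat.con 1 Nat.:+ Nat.con 2 Nat.:* m Nat.:+ Nat.con 1 Nat.:= Nat.con 2 Nat.:* (Nat.con 1 Nat.:+ m)) refl (suc k)))) (m∣m*n (suc (suc k)))
      where module Nat = +-*-Solver

    g≢0 : g ≢ 0#
    g≢0 = order⇒≢0 g-order

  -- h = 1/g; exponents are natural numbers, so inverses are written with h.
  h : K
  h = g ^ pred (N p)

  g*h : g * h ≡ 1#
  g*h = trans (cong (g ^_) (ℕ.suc-pred (N p))) (^order g-order)

  g^*h^ : ∀ a → g ^ a * h ^ a ≡ 1#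
  g^*h^ a = trans (sym (^-distrib-* g h a)) (trans (cong (_^ a) g*h) (1^ a))

  τ : ℕ → K
  τ a = g ^ a + h ^ a

  h^-cong : ∀ {a b} → g ^ a ≡ g ^ b → h ^ a ≡ h ^ b
  h^-cong {a} {b} e = inverse-unique (g^*h^ a) (trans (cong (_* h ^ b) e) (g^*h^ b))

  inverse⇒h^ : ∀ {a x} → g ^ a * x ≡ 1# → x ≡ h ^ a
  inverse⇒h^ {a} e = inverse-unique e (g^*h^ a)

  -- Negation of exponents modulo `N p`, realised as multiplication by N - 1.
  ν : ℕ → ℕ
  ν a = pred (N p) ℕ.* a

  g^ν : ∀ a → g ^ ν a ≡ h ^ a
  g^ν a = sym (^-assocʳ g (pred (N p)) a)

  h^-flip : ∀ {a b} → g ^ b ≡ h ^ a → h ^ b ≡ g ^ a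
  h^-flip {a} {b} e = sym (inverse⇒h^ {b} (trans (cong (_* g ^ a) e) (trans (*-comm _ _) (g^*h^ a))))

  h^ν : ∀ a → h ^ ν a ≡ g ^ a
  h^ν a = h^-flip {a} {ν a} (g^ν a)

  g^+N : ∀ {a b} → N p ∣ b → g ^ (a ℕ.+ b) ≡ g ^ a
  g^+N {a} {b} d = trans (^-homo-* g a b) (trans (cong (g ^ a *_) (^-∣ (^order g-order) d)) (*-identityʳ _))

  g^*g^≡1⇒∣ : ∀ {a b} → g ^ a * g ^ b ≡ 1# → N p ∣ a ℕ.+ b
  g^*g^≡1⇒∣ {a} {b} e = order∣ g-order {a ℕ.+ b} (trans (^-homo-* g a b) e)

  4# : K
  4# = 1# + 1# + 1# + 1#

  Cubic : K → K → K → Set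
  Cubic x y z = x * x + y * y + z * z ≡ x * y * z + 4#

  private
    -- Adding multiples of u u′ - 1 and v v′ - 1 lets the solver use the relations u u′ = v v′ = 1.
    modulo-units : ∀ {u u′ v v′ r c₁ c₂} → u * u′ ≡ 1# → v * v′ ≡ 1# → r + (u * u′ + - 1#) * c₁ + (v * v′ + - 1#) * c₂ ≡ r
    modulo-units {u} {u′} {v} {v′} {r} {c₁} {c₂} uu′ vv′ = begin
      r + (u * u′ + - 1#) * c₁ + (v * v′ + - 1#) * c₂  ≡⟨ cong₂ (λ a b → r + (a + - 1#) * c₁ + (b + - 1#) * c₂) uu′ vv′ ⟩
      r + (1# + - 1#) * c₁ + (1# + - 1#) * c₂          ≡⟨ solve 3 (λ r c₁ c₂ → r :+ (con (ℤ.+ 1) :- con (ℤ.+ 1)) :* c₁ :+ (con (ℤ.+ 1) :- con (ℤ.+ 1)) :* c₂ := r) refl r c₁ c₂ ⟩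
      r                                                ∎

  cubic-units : ∀ {u u′ v v′} → u * u′ ≡ 1# → v * v′ ≡ 1# → Cubic (u + u′) (v + v′) (u * v + u′ * v′)
  cubic-units {u} {u′} {v} {v′} uu′ vv′ = trans (solve 4 (λ u u′ v v′ →
      let x = u :+ u′ ; y = v :+ v′ ; z = u :* v :+ u′ :* v′ in
      x :* x :+ y :* y :+ z :* z := x :* y :* z :+ con (ℤ.+ 4)
        :+ (u :* u′ :- con (ℤ.+ 1)) :* (con (ℤ.+ 2) :- v :* v :- v′ :* v′)
        :+ (v :* v′ :- con (ℤ.+ 1)) :* (con (ℤ.+ 2) :- u :* u :- u′ :* u′)) refl u u′ v v′)
    (modulo-units uu′ vv′)

  -- The cubic is quadratic in z; the two values have sum x y and product x² + y² - 4, so it factors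
  -- accordingly.
  cubic-roots : ∀ {u u′ v v′ z} → u * u′ ≡ 1# → v * v′ ≡ 1# → Cubic (u + u′) (v + v′) z →
    z ≡ u * v + u′ * v′ ⊎ z ≡ u * v′ + u′ * v
  cubic-roots {u} {u′} {v} {v′} {z} uu′ vv′ cubic = Sum.map x-y≡0⇒x≡y x-y≡0⇒x≡y (domain (begin
    (z + - (u * v + u′ * v′)) * (z + - (u * v′ + u′ * v))
      ≡⟨ solve 5 (λ u u′ v v′ z → let x = u :+ u′ ; y = v :+ v′ in
           (z :- (u :* v :+ u′ :* v′)) :* (z :- (u :* v′ :+ u′ :* v))
             := (x :* x :+ y :* y :+ z :* z) :- (x :* y :* z :+ con (ℤ.+ 4))
             :+ (u :* u′ :- con (ℤ.+ 1)) :* (v :* v :+ v′ :* v′ :- con (ℤ.+ 2))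
             :+ (v :* v′ :- con (ℤ.+ 1)) :* (u :* u :+ u′ :* u′ :- con (ℤ.+ 2))) refl u u′ v v′ z ⟩
    _ ≡⟨ modulo-units uu′ vv′ ⟩
    ((u + u′) * (u + u′) + (v + v′) * (v + v′) + z * z) + - ((u + u′) * (v + v′) * z + 4#)
      ≡⟨ cong (λ w → w + - ((u + u′) * (v + v′) * z + 4#)) cubic ⟩
    ((u + u′) * (v + v′) * z + 4#) + - ((u + u′) * (v + v′) * z + 4#)  ≡⟨ -‿inverseʳ _ ⟩
    0# ∎))

  -- For units, u + 1/u = v + 1/v is equivalent to (u - v) (u v - 1) = 0.
  sum-determines : ∀ {u u′ v v′} → u * u′ ≡ 1# → v * v′ ≡ 1# → u + u′ ≡ v + v′ → u ≡ v ⊎ u * v ≡ 1#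
  sum-determines {u} {u′} {v} {v′} uu′ vv′ e = Sum.map x-y≡0⇒x≡y x-y≡0⇒x≡y (domain (begin
    (u + - v) * (u * v + - 1#)
      ≡⟨ solve 4 (λ u u′ v v′ → (u :- v) :* (u :* v :- con (ℤ.+ 1))
           := u :* v :* ((u :+ u′) :- (v :+ v′)) :+ (u :* u′ :- con (ℤ.+ 1)) :* (:- v) :+ (v :* v′ :- con (ℤ.+ 1)) :* u) refl u u′ v v′ ⟩
    _ ≡⟨ modulo-units uu′ vv′ ⟩
    u * v * ((u + u′) + - (v + v′))  ≡⟨ cong (λ w → u * v * (w + - (v + v′))) e ⟩
    u * v * ((v + v′) + - (v + v′))  ≡⟨ solve 2 (λ a b → a :* (b :- b) := con (ℤ.+ 0)) refl (u * v) (v + v′) ⟩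
    0# ∎))

  τ-≡ : ∀ {a b} → τ a ≡ τ b → g ^ a ≡ g ^ b ⊎ g ^ a * g ^ b ≡ 1#
  τ-≡ {a} {b} = sum-determines (g^*h^ a) (g^*h^ b)

  -- Equal values of τ mean b ≡ ±a modulo N, and neither the sign nor multiples of N affect
  -- divisibility by a divisor of N.
  τ-∣ : ∀ {d a b} → d ∣ N p → τ a ≡ τ b → d ∣ a → d ∣ b
  τ-∣ {d} {a} {b} d∣N e d∣a = [ same , (λ inv → ∣m+n∣m⇒∣n (∣-trans d∣N (g^*g^≡1⇒∣ {a} {b} inv)) d∣a) ]′ (τ-≡ {a} {b} e)
    where
    same : g ^ a ≡ g ^ b → d ∣ b
    same e = ∣m+n∣m⇒∣n {d} {ν a} {b} (∣-trans d∣N (g^*g^≡1⇒∣ {ν a} {b} (trans (cong₂ _*_ (g^ν a) (sym e)) (trans (*-comm _ _) (g^*h^ a))))) (∣n⇒∣m*n (pred (N p)) d∣a)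

  private
    p-1∣⇒ : ∀ {a} → (p ∸ 1) ∣ a → (g ^ a) ^ p ≡ h ^ a
    p-1∣⇒ {a} (divides c refl) = inverse⇒h^ {a} (begin
      g ^ a * (g ^ a) ^ p      ≡⟨ ^-assocʳ g a (suc p) ⟩
      g ^ (a ℕ.* suc p)        ≡⟨ ^-∣ (^order g-order) (subst₂ _∣_ (sym N≡) (trans (cong (ℕ._* a) (ℕ.+-comm p 1)) (ℕ.*-comm (suc p) a)) (*-monoʳ-∣ (p ℕ.+ 1) (n∣m*n c))) ⟩
      1#                       ∎)

    p+1∣⇒ : ∀ {a} → (p ℕ.+ 1) ∣ a → (g ^ a) ^ p ≡ g ^ a
    p+1∣⇒ {a} (divides c refl) = begin
      (g ^ a) ^ p                  ≡⟨ cong ((g ^ a) ^_) p≡1+ ⟩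
      g ^ a * (g ^ a) ^ (p ∸ 1)    ≡⟨ cong (g ^ a *_) (^-assocʳ g a (p ∸ 1)) ⟩
      g ^ a * g ^ (a ℕ.* (p ∸ 1))  ≡⟨ cong (g ^ a *_) (^-∣ (^order g-order) (subst (_∣ a ℕ.* (p ∸ 1)) (sym N≡) (*-monoˡ-∣ (p ∸ 1) (n∣m*n c)))) ⟩
      g ^ a * 1#                   ≡⟨ *-identityʳ _ ⟩
      g ^ a                        ∎

    h^^p : ∀ a → (g ^ a) ^ p * (h ^ a) ^ p ≡ 1#
    h^^p a = trans (sym (^-distrib-* (g ^ a) (h ^ a) p)) (trans (cong (_^ p) (g^*h^ a)) (1^ p))

  ∣⇒τ-fixed : ∀ {a} → (p ℕ.+ 1) ∣ a ⊎ (p ∸ 1) ∣ a → τ a ^ p ≡ τ a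
  ∣⇒τ-fixed {a} (inj₁ d) = trans (^p-+ _ _) (cong₂ _+_ (p+1∣⇒ d) (inverse⇒h^ {a} (trans (cong (_* (h ^ a) ^ p) (sym (p+1∣⇒ d))) (h^^p a))))
  ∣⇒τ-fixed {a} (inj₂ d) = trans (^p-+ _ _) (trans (cong₂ _+_ (p-1∣⇒ d)
    (inverse-unique (trans (cong (_* (h ^ a) ^ p) (sym (p-1∣⇒ d))) (h^^p a)) (trans (*-comm _ _) (g^*h^ a)))) (+-comm _ _))

  g^-fixed⇒∣ : ∀ {a} → (g ^ a) ^ p ≡ g ^ a → (p ℕ.+ 1) ∣ a
  g^-fixed⇒∣ {a} e = *-cancelʳ-∣ (p ∸ 1) (subst (_∣ a ℕ.* (p ∸ 1)) N≡ (order∣ g-order {a ℕ.* (p ∸ 1)} (trans (sym (^-assocʳ g a (p ∸ 1)))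
    (*-cancel {g ^ a} (^≢0 a g≢0) (trans (trans (cong ((g ^ a) ^_) (sym p≡1+)) e) (sym (*-identityʳ _)))))))

  -- By `sum-determines` the p-th power of gᵃ is gᵃ or its inverse, so N divides a (p - 1) or a (p +
  -- 1); cancelling in N = (p + 1) (p - 1) gives the two cases.
  τ-fixed⇒∣ : ∀ {a} → τ a ^ p ≡ τ a → (p ℕ.+ 1) ∣ a ⊎ (p ∸ 1) ∣ a
  τ-fixed⇒∣ {a} e = Sum.map g^-fixed⇒∣ flipped (sum-determines (h^^p a) (g^*h^ a) (trans (sym (^p-+ _ _)) e))
    where
    flipped : (g ^ a) ^ p * g ^ a ≡ 1# → (p ∸ 1) ∣ a
    flipped e = *-cancelˡ-∣ (p ℕ.+ 1) (subst₂ _∣_ N≡ (trans (ℕ.*-comm a (suc p)) (cong (ℕ._* a) (ℕ.+-comm 1 p)))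
      (order∣ g-order {a ℕ.* suc p} (trans (sym (^-assocʳ g a (suc p))) (trans (*-comm _ _) e))))

  private
    -- A nonzero element fixed by Frobenius is gʲ with p + 1 ∣ j, and p + 1 is even.
    ∃-sqrt : ∀ x → x ^ p ≡ x → ∃ λ s → s * s ≡ x
    ∃-sqrt x fix = case x ≟K 0# of λ where
      (yes x≡0) → 0# , trans (zeroˡ 0#) (sym x≡0)
      (no x≢0) → let j , x≡g^j = g-generates x x≢0
                     divides i j≡i*2 = ∣-trans 2∣p+1 (g^-fixed⇒∣ {j} (trans (cong (_^ p) (sym x≡g^j)) (trans fix x≡g^j)))
                 in g ^ i , trans (sym (^-homo-* g i i)) (trans (cong (g ^_) (trans (cong (i ℕ.+_) (sym (ℕ.+-identityʳ i))) (trans (ℕ.*-comm 2 i) (sym j≡i*2)))) (sym x≡g^j))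

  -- The quadratic formula for u + 1/u = X: with s² = X² - 4, the elements (X + s) / 2 and (X - s) /
  -- 2 are mutually inverse with sum X. Division by 2 is multiplication by `half`, obtained from the
  -- logarithm of 2.
  τ-surjective : ∀ x → ∃ λ a → ι x ≡ τ a
  τ-surjective x =
    let m , 2≡g^m = g-generates (1# + 1#) 2≢0
        half = h ^ m
        2half≡1 = trans (cong (_* half) 2≡g^m) (g^*h^ m)
        s , s² = ∃-sqrt (X * X + - 4#) fix
        uu′ = begin
          (X + s) * half * ((X + - s) * half)
            ≡⟨ solve 3 (λ X s c → (X :+ s) :* c :* ((X :- s) :* c) := (X :* X :- s :* s) :* (c :* c)) refl X s half ⟩
          (X * X + - (s * s)) * (half * half)
            ≡⟨ cong (λ w → (X * X + - w) * (half * half)) s² ⟩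
          (X * X + - (X * X + - 4#)) * (half * half)
            ≡⟨ solve 2 (λ X c → (X :* X :- (X :* X :- con (ℤ.+ 4))) :* (c :* c) := (con (ℤ.+ 2) :* c) :* (con (ℤ.+ 2) :* c)) refl X half ⟩
          ((1# + 1#) * half) * ((1# + 1#) * half)  ≡⟨ cong₂ _*_ 2half≡1 2half≡1 ⟩
          1# * 1#  ≡⟨ *-identityˡ 1# ⟩
          1# ∎
        a , u≡ = g-generates ((X + s) * half) (λ u≡0 → 1≢0 (trans (sym uu′) (trans (cong (_* ((X + - s) * half)) u≡0) (zeroˡ _))))
        sum≡ = begin
          X                                     ≡⟨ *-identityʳ X ⟨
          X * 1#                                ≡⟨ cong (X *_) 2half≡1 ⟨
          X * ((1# + 1#) * half)                ≡⟨ solve 3 (λ X s c → X :* (con (ℤ.+ 2) :* c) := (X :+ s) :* c :+ (X :- s) :* c) refl X s half ⟩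
          (X + s) * half + (X + - s) * half     ≡⟨ cong₂ _+_ u≡ (inverse⇒h^ {a} (trans (cong (_* ((X + - s) * half)) (sym u≡)) uu′)) ⟩
          τ a ∎
    in a , sum≡
    where
    X = ι x
    ι4 : ι ([ 1 ] ⊕ [ 1 ] ⊕ [ 1 ] ⊕ [ 1 ]) ≡ 4#
    ι4 = trans (ι-+ _ _) (cong₂ _+_ (trans (ι-+ _ _) (cong₂ _+_ (trans (ι-+ _ _) (cong₂ _+_ ι-1 ι-1)) ι-1)) ι-1)
    disc : ι (x ⊗ x ⊕ ⊖ ([ 1 ] ⊕ [ 1 ] ⊕ [ 1 ] ⊕ [ 1 ])) ≡ X * X + - 4#
    disc = trans (ι-+ _ _) (cong₂ _+_ (ι-* x x) (trans (ι-neg _) (cong -_ ι4)))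
    fix : (X * X + - 4#) ^ p ≡ X * X + - 4#
    fix = subst (λ w → w ^ p ≡ w) disc (ι^p _)

  ι-injective : ∀ {x y} → ι x ≡ ι y → x ≡ y
  ι-injective {x} {y} e = trans (sym (π-ι x)) (trans (cong π e) (π-ι y))

  private
    ι-squares : ∀ x y z → ι [ toℕ x ℕ.* toℕ x ℕ.+ toℕ y ℕ.* toℕ y ℕ.+ toℕ z ℕ.* toℕ z ] ≡ ι x * ι x + ι y * ι y + ι z * ι z
    ι-squares x y z = begin
      ι [ toℕ x ℕ.* toℕ x ℕ.+ toℕ y ℕ.* toℕ y ℕ.+ toℕ z ℕ.* toℕ z ]
        ≡⟨ cong ι (trans ([]-+ _ (toℕ z ℕ.* toℕ z)) (cong (_⊕ (z ⊗ z)) ([]-+ (toℕ x ℕ.* toℕ x) (toℕ y ℕ.* toℕ y)))) ⟩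
      ι (x ⊗ x ⊕ y ⊗ y ⊕ z ⊗ z)          ≡⟨ trans (ι-+ _ _) (cong₂ _+_ (trans (ι-+ _ _) (cong₂ _+_ (ι-* x x) (ι-* y y))) (ι-* z z)) ⟩
      ι x * ι x + ι y * ι y + ι z * ι z  ∎

    ι-product : ∀ x y z → ι [ toℕ x ℕ.* toℕ y ℕ.* toℕ z ℕ.+ 4 ] ≡ ι x * ι y * ι z + 4#
    ι-product x y z = begin
      ι [ toℕ x ℕ.* toℕ y ℕ.* toℕ z ℕ.+ 4 ]  ≡⟨ cong ι ([]-+ (toℕ x ℕ.* toℕ y ℕ.* toℕ z) 4) ⟩
      ι ([ toℕ x ℕ.* toℕ y ℕ.* toℕ z ] ⊕ [ 4 ])  ≡⟨ ι-+ _ _ ⟩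
      ι [ toℕ x ℕ.* toℕ y ℕ.* toℕ z ] + ι [ 4 ]
        ≡⟨ cong₂ _+_ (trans (cong ι (trans ([]-* (toℕ x ℕ.* toℕ y) (toℕ z)) (cong ((x ⊗ y) ⊗_) ([toℕ] z)))) (trans (ι-* _ z) (cong (_* ι z) (ι-* x y)))) ι[4] ⟩
      ι x * ι y * ι z + 4#  ∎
      where
      ι-suc : ∀ n → ι [ n ℕ.+ 1 ] ≡ ι [ n ] + 1#
      ι-suc n = trans (cong ι ([]-+ n 1)) (trans (ι-+ _ _) (cong (ι [ n ] +_) ι-1))
      ι[4] : ι [ 4 ] ≡ 4#
      ι[4] = trans (ι-suc 3) (cong (_+ 1#) (trans (ι-suc 2) (cong (_+ 1#) (trans (ι-suc 1) (cong (_+ 1#) ι-1)))))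

  ι-mulSub : ∀ u v w → ι (mulSub p u v w) ≡ ι u * ι v + - ι w
  ι-mulSub u v w = trans (cong ι ([]-+ (toℕ u ℕ.* toℕ v) (p ∸ toℕ w))) (trans (ι-+ _ _) (cong₂ _+_ (ι-* u v) (ι-neg w)))

  isSol⇒cubic : ∀ {x y z} → IsSol p (x , y , z) → Cubic (ι x) (ι y) (ι z)
  isSol⇒cubic {x} {y} {z} s = trans (sym (ι-squares x y z)) (trans (cong ι s) (ι-product x y z))

  cubic⇒isSol : ∀ {x y z} → Cubic (ι x) (ι y) (ι z) → IsSol p (x , y , z)
  cubic⇒isSol {x} {y} {z} c = ι-injective (trans (ι-squares x y z) (trans c (sym (ι-product x y z))))

  isSol-swap₁₂ : ∀ {x y z} → IsSol p (x , y , z) → IsSol p (y , x , z)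
  isSol-swap₁₂ {x} {y} {z} s = cubic⇒isSol (trans (cong (_+ ι z * ι z) (+-comm _ _)) (trans (isSol⇒cubic {x} {y} {z} s) (cong (λ w → w * ι z + 4#) (*-comm _ _))))

  isSol-swap₂₃ : ∀ {x y z} → IsSol p (x , y , z) → IsSol p (x , z , y)
  isSol-swap₂₃ {x} {y} {z} s = cubic⇒isSol (trans
    (solve 3 (λ a b c → a :* a :+ c :* c :+ b :* b := a :* a :+ b :* b :+ c :* c) refl (ι x) (ι y) (ι z))
    (trans (isSol⇒cubic {x} {y} {z} s) (solve 3 (λ a b c → a :* b :* c :+ con (ℤ.+ 4) := a :* c :* b :+ con (ℤ.+ 4)) refl (ι x) (ι y) (ι z))))

  _∼_ : Point p → Point p → Set
  _∼_ = SameOrbit p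

  ∼-step : ∀ {P} γ → IsSol p P → IsSol p (act p γ P) → P ∼ act p γ P
  ∼-step γ s s′ = fwd (s , s′ , γ , refl) ◅ ε

  ∼-sym : ∀ {P Q} → P ∼ Q → Q ∼ P
  ∼-sym = EqC.symmetric (Step p)

  ∼-isSol : ∀ {P Q} → P ∼ Q → IsSol p P → IsSol p Q
  ∼-isSol ε s = s
  ∼-isSol (fwd (_ , s′ , _) ◅ r) s = ∼-isSol r s′
  ∼-isSol (bwd (s′ , _ , _) ◅ r) s = ∼-isSol r s′

  -- P is the image of (g ^ a , g ^ b) under (u , v) ↦ (u + 1/u , v + 1/v , uv + 1/(uv)).

  record Log (P : Point p) (a b : ℕ) : Set where
    constructor mkLog
    field
      log₁ : ι (proj₁ P) ≡ τ a
      log₂ : ι (proj₁ (proj₂ P)) ≡ τ b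
      log₃ : ι (proj₂ (proj₂ P)) ≡ τ (a ℕ.+ b)
  open Log

  τ-+ : ∀ a b → τ (a ℕ.+ b) ≡ g ^ a * g ^ b + h ^ a * h ^ b
  τ-+ a b = cong₂ _+_ (^-homo-* g a b) (^-homo-* h a b)

  log-isSol : ∀ {P a b} → Log P a b → IsSol p P
  log-isSol {x , y , z} {a} {b} (mkLog l₁ l₂ l₃) = cubic⇒isSol {x} {y} {z}
    (subst (λ X → Cubic X (ι y) (ι z)) (sym l₁) (subst (λ Y → Cubic (τ a) Y (ι z)) (sym l₂) (subst (Cubic (τ a) (τ b)) (sym (trans l₃ (τ-+ a b)))
      (cubic-units (g^*h^ a) (g^*h^ b)))))

  log-cong : ∀ {P a b a′ b′} → g ^ a ≡ g ^ a′ → g ^ b ≡ g ^ b′ → Log P a b → Log P a′ b′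
  log-cong {P} {a} {b} {a′} {b′} ea eb (mkLog l₁ l₂ l₃) = mkLog
    (trans l₁ (cong₂ _+_ ea ha)) (trans l₂ (cong₂ _+_ eb hb))
    (trans l₃ (trans (τ-+ a b) (trans (cong₂ _+_ (cong₂ _*_ ea eb) (cong₂ _*_ ha hb)) (sym (τ-+ a′ b′)))))
    where
    ha = h^-cong {a} {a′} ea
    hb = h^-cong {b} {b′} eb

  log-neg : ∀ {P a b a′ b′} → g ^ a′ ≡ h ^ a → g ^ b′ ≡ h ^ b → Log P a b → Log P a′ b′
  log-neg {P} {a} {b} {a′} {b′} ea eb (mkLog l₁ l₂ l₃) = mkLog
    (trans l₁ (trans (+-comm _ _) (sym (cong₂ _+_ ea ha)))) (trans l₂ (trans (+-comm _ _) (sym (cong₂ _+_ eb hb))))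
    (trans l₃ (trans (τ-+ a b) (trans (+-comm _ _) (trans (sym (cong₂ _+_ (cong₂ _*_ ea eb) (cong₂ _*_ ha hb))) (sym (τ-+ a′ b′))))))
    where
    ha = h^-flip {a} {a′} ea
    hb = h^-flip {b} {b′} eb

  cubic-log₃ : ∀ {x y z a b} → IsSol p (x , y , z) → ι x ≡ τ a → ι y ≡ τ b → ι z ≡ τ (a ℕ.+ b) ⊎ ι z ≡ τ (a ℕ.+ ν b)
  cubic-log₃ {x} {y} {z} {a} {b} s l₁ l₂ = Sum.map (λ e → trans e (sym (τ-+ a b))) (λ e → trans e (trans (sym (cong₂ _+_ (cong (g ^ a *_) (g^ν b)) (cong (h ^ a *_) (h^ν b)))) (sym (τ-+ a (ν b)))))
    (cubic-roots (g^*h^ a) (g^*h^ b) (subst₂ (λ X Y → Cubic X Y (ι z)) l₁ l₂ (isSol⇒cubic {x} {y} {z} s)))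

  ∃-log : ∀ {P} → IsSol p P → ∃₂ λ a b → Log P a b
  ∃-log {x , y , z} s =
    let a , l₁ = τ-surjective x
        b , l₂ = τ-surjective y
    in case cubic-log₃ {x} {y} {z} {a} {b} s l₁ l₂ of λ where
      (inj₁ l₃) → a , b , mkLog l₁ l₂ l₃
      -- Here z = τ (a - b); replacing b by -b keeps τ b and turns z into the value on the sum of
      -- the exponents.
      (inj₂ l₃) → a , ν b , mkLog l₁ (trans l₂ (trans (+-comm _ _) (sym (cong₂ _+_ (g^ν b) (h^ν b))))) l₃

  log-swap : ∀ {P a b} → Log P a b → ∃ λ Q → P ∼ Q ∧ Log Q b a
  log-swap {x , y , z} {a} {b} l = (y , x , z) , ∼-step s₁₂ (log-isSol l) (log-isSol l′) , l′
    where
    l′ : Log (y , x , z) b a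
    l′ = mkLog (log₂ l) (log₁ l) (trans (log₃ l) (cong τ (ℕ.+-comm a b)))

  -- One subtraction of Euclid's algorithm: `m₃` replaces τ (2a + b) by τ a τ (a + b) - τ (2a + b) =
  -- τ b, and `s₂₃` moves τ (a + b) to the end.
  log-sub : ∀ {P a b} → Log P a (a ℕ.+ b) → ∃ λ Q → P ∼ Q ∧ Log Q a b
  log-sub {x , y , z} {a} {b} l = (x , w , y) , (∼-step m₃ (log-isSol l) sol ◅◅ ∼-step s₂₃ sol (log-isSol l′)) , l′
    where
    w = mulSub p x y z
    ιw : ι w ≡ τ b
    ιw = begin
      ι w                                    ≡⟨ ι-mulSub x y z ⟩
      ι x * ι y + - ι z                      ≡⟨ cong₂ _+_ (cong₂ _*_ (log₁ l) (trans (log₂ l) (τ-+ a b))) (cong -_ (trans (log₃ l) (trans (τ-+ a (a ℕ.+ b)) (cong₂ _+_ (cong (g ^ a *_) (^-homo-* g a b)) (cong (h ^ a *_) (^-homo-* h a b)))))) ⟩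
      (u + u′) * (u * v + u′ * v′) + - (u * (u * v) + u′ * (u′ * v′))
        ≡⟨ solve 4 (λ u u′ v v′ → (u :+ u′) :* (u :* v :+ u′ :* v′) :- (u :* (u :* v) :+ u′ :* (u′ :* v′))
             := (v :+ v′) :+ (u :* u′ :- con (ℤ.+ 1)) :* (v :+ v′) :+ (v :* v′ :- con (ℤ.+ 1)) :* con (ℤ.+ 0)) refl u u′ v v′ ⟩
      _ ≡⟨ modulo-units (g^*h^ a) (g^*h^ b) ⟩
      v + v′ ∎
      where
      u = g ^ a
      u′ = h ^ a
      v = g ^ b
      v′ = h ^ b
    l′ : Log (x , w , y) a b
    l′ = mkLog (log₁ l) ιw (log₂ l)
    sol : IsSol p (x , y , w)
    sol = isSol-swap₂₃ {x} {w} {y} (log-isSol l′)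

  private
    -- The gcd enters as the relation `GCD`, whose rules `base`, `sym` and `step` correspond to the
    -- moves of the algorithm.
    Reduced : Point p → ℕ → ℕ → Set
    Reduced P a b = ∃₂ λ Q d → P ∼ Q ∧ Log Q 0 d ∧ GCD a b d

    reduced-swap : ∀ {P a b} → (∀ {Q} → Log Q b a → Reduced Q b a) → Log P a b → Reduced P a b
    reduced-swap {P} {a} {b} reduce l = go (log-swap l)
      where
      go : (∃ λ Q → P ∼ Q ∧ Log Q b a) → Reduced P a b
      go (Q , r , l′) = extend (reduce l′)
        where
        extend : Reduced Q b a → Reduced P a b
        extend (Q′ , d , r′ , l″ , gc) = Q′ , d , r ◅◅ r′ , l″ , GCD.sym gc

    reduced-sub : ∀ {P a b c} → a ℕ.+ c ≡ b → (∀ {Q} → Log Q a c → Reduced Q a c) → Log P a b → Reduced P a b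
    reduced-sub {P} {a} {b} {c} refl reduce l = go (log-sub l)
      where
      go : (∃ λ Q → P ∼ Q ∧ Log Q a c) → Reduced P a b
      go (Q , r , l′) = extend (reduce l′)
        where
        extend : Reduced Q a c → Reduced P a b
        extend (Q′ , d , r′ , l″ , gc) = Q′ , d , r ◅◅ r′ , l″ , GCD.step gc

    euclid : ∀ n {P} a b → a ℕ.+ b ≤ n → Log P a b → Reduced P a b
    euclid n {P} zero b _ l = P , b , ε , l , GCD.base
    euclid n {P} (suc a) zero _ = reduced-swap λ {Q} l → Q , suc a , ε , l , GCD.base
    euclid (suc n) {P} (suc a) (suc b) (s≤s le) = case ℕ.≤-total (suc a) (suc b) of λ where
      (inj₁ a≤b) → reduced-sub (ℕ.m+[n∸m]≡n a≤b)
        (euclid n (suc a) (suc b ∸ suc a) (≤-trans (≤-reflexive (ℕ.m+[n∸m]≡n a≤b)) (≤-trans (ℕ.m≤n+m (suc b) a) le)))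
      (inj₂ b≤a) → reduced-swap (reduced-sub (ℕ.m+[n∸m]≡n b≤a)
        (euclid n (suc b) (suc a ∸ suc b) (≤-trans (≤-reflexive (ℕ.m+[n∸m]≡n b≤a)) (≤-trans (s≤s (ℕ.m≤m+n a b)) (subst (_≤ n) (ℕ.+-suc a b) le)))))

    euclid-gcd : ∀ {P a b} → Reduced P a b → ∃ λ Q → P ∼ Q ∧ Log Q 0 (gcd a b)
    euclid-gcd {P} {a} {b} (Q , d , r , l′ , gc) = Q , r , subst (Log Q 0) (GCD.unique gc (gcd-GCD a b)) l′

  abstract

    log-euclid : ∀ {P a b} → Log P a b → ∃ λ Q → P ∼ Q ∧ Log Q 0 (gcd a b)
    log-euclid {P} {a} {b} l = euclid-gcd (euclid (a ℕ.+ b) a b ≤-refl l)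

  pointAt : ℕ → ℕ → Point p
  pointAt a b = π (τ a) , π (τ b) , π (τ (a ℕ.+ b))

  Φ : ℕ → Point p
  Φ t = pointAt 0 t

  log⇒≡ : ∀ {P a b} → Log P a b → P ≡ pointAt a b
  log⇒≡ {x , y , z} l = cong₂ _,_ (unι x (log₁ l)) (cong₂ _,_ (unι y (log₂ l)) (unι z (log₃ l)))
    where
    unι : ∀ x {X} → ι x ≡ X → x ≡ π X
    unι x e = trans (sym (π-ι x)) (cong π e)

  level : ℕ → ℕ → ℕ
  level a b = gcd (N p) (gcd a b)

  log-normalise : ∀ {P a b} → Log P a b → ∃ λ Q → P ∼ Q ∧ Log Q 0 (level a b)
  log-normalise {P} {a} {b} l =
    let Q , r , l′ = log-euclid l
        Q′ , r′ , l″ = log-euclid (log-cong {a′ = N p} {gcd a b} (sym (^order g-order)) refl l′)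
    in Q′ , (r ◅◅ r′) , l″

  log⇒∼Φ : ∀ {P a b} → Log P a b → P ∼ Φ (level a b)
  log⇒∼Φ {P} l = let Q , r , l′ = log-normalise l in subst (P ∼_) (log⇒≡ l′) r

  -- The orbit contains a point over 𝔽ₚ whose second coordinate is τ of the level, so this value of
  -- τ is fixed by Frobenius.
  level-InD : ∀ {P a b} → Log P a b → InD p (level a b)
  level-InD {P} {a} {b} l =
    let Q , _ , l′ = log-normalise l
        fix = subst (λ X → X ^ p ≡ X) (log₂ l′) (ι^p _)
    in ℕ.n≢0⇒n>0 (gcd[m,n]≢0 (N p) (gcd a b) (inj₁ (≢-nonZero⁻¹ (N p)))) , gcd[m,n]∣m (N p) (gcd a b) , τ-fixed⇒∣ fix

  pointAt-log : ∀ {t} → InD p t → ∀ a b → t ∣ a → t ∣ b → Log (pointAt a b) a b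
  pointAt-log {t} (_ , _ , d) a b t∣a t∣b = mkLog (inF t∣a) (inF t∣b) (inF (∣m∣n⇒∣m+n t∣a t∣b))
    where
    inF : ∀ {c} → t ∣ c → ι (π (τ c)) ≡ τ c
    inF t∣c = ^p-fixed _ (∣⇒τ-fixed (Sum.map (λ d → ∣-trans d t∣c) (λ d → ∣-trans d t∣c) d))

  Φ-log : ∀ {t} → InD p t → Log (Φ t) 0 t
  Φ-log {t} D = pointAt-log D 0 t (t ∣0) ∣-refl

  Φ-isSol : ∀ {t} → InD p t → IsSol p (Φ t)
  Φ-isSol D = log-isSol (Φ-log D)

  Φ-surjective : ∀ P → IsSol p P → ∃ λ t → InD p t ∧ P ∼ Φ t
  Φ-surjective P s = let a , b , l = ∃-log {P} s in level a b , level-InD l , log⇒∼Φ l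

  module Invariant {d : ℕ} (d∣N : d ∣ N p) where

    -- A single logarithm is enough: by `τ-∣`, every other logarithm of x is divisible by d as well.
    Divisible : Fin p → Set
    Divisible x = ∃ λ a → d ∣ a ∧ ι x ≡ τ a

    AllDivisible : Point p → Set
    AllDivisible (x , y , z) = Divisible x ∧ Divisible y ∧ Divisible z

    -- On a solution, two divisible coordinates force the remaining one, whichever root of the
    -- quadratic it is. Each move keeps two coordinates and ends in a solution, so it preserves
    -- divisibility in both directions without using its formula.
    third : ∀ {x y z} → IsSol p (x , y , z) → Divisible x → Divisible y → Divisible z
    third {x} {y} {z} s (a , d∣a , l₁) (b , d∣b , l₂) = case cubic-log₃ {x} {y} {z} {a} {b} s l₁ l₂ of λ where
      (inj₁ l₃) → a ℕ.+ b , ∣m∣n⇒∣m+n d∣a d∣b , l₃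
      (inj₂ l₃) → a ℕ.+ ν b , ∣m∣n⇒∣m+n d∣a (∣n⇒∣m*n (pred (N p)) d∣b) , l₃

    second : ∀ {x y z} → IsSol p (x , y , z) → Divisible x → Divisible z → Divisible y
    second {x} {y} {z} s = third {x} {z} {y} (isSol-swap₂₃ {x} {y} {z} s)

    first : ∀ {x y z} → IsSol p (x , y , z) → Divisible y → Divisible z → Divisible x
    first {x} {y} {z} s = second {y} {x} {z} (isSol-swap₁₂ {x} {y} {z} s)

    step⁺ : ∀ γ P → IsSol p (act p γ P) → AllDivisible P → AllDivisible (act p γ P)
    step⁺ m₁  (x , y , z) s (a , b , c) = first {mulSub p y z x} {y} {z} s b c , b , c
    step⁺ m₂  (x , y , z) s (a , b , c) = a , second {x} {mulSub p x z y} {z} s a c , c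
    step⁺ m₃  (x , y , z) s (a , b , c) = a , b , third {x} {y} {mulSub p x y z} s a b
    step⁺ s₁₂ _ _ (a , b , c) = b , a , c
    step⁺ s₁₃ _ _ (a , b , c) = c , b , a
    step⁺ s₂₃ _ _ (a , b , c) = a , c , b
    step⁺ c₁₂₃ _ _ (a , b , c) = b , c , a
    step⁺ c₁₃₂ _ _ (a , b , c) = c , a , b

    step⁻ : ∀ γ P → IsSol p P → AllDivisible (act p γ P) → AllDivisible P
    step⁻ m₁  (x , y , z) s (a , b , c) = first {x} {y} {z} s b c , b , c
    step⁻ m₂  (x , y , z) s (a , b , c) = a , second {x} {y} {z} s a c , c
    step⁻ m₃  (x , y , z) s (a , b , c) = a , b , third {x} {y} {z} s a b
    step⁻ s₁₂ _ _ (a , b , c) = b , a , c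
    step⁻ s₁₃ _ _ (a , b , c) = c , b , a
    step⁻ s₂₃ _ _ (a , b , c) = a , c , b
    step⁻ c₁₂₃ _ _ (a , b , c) = c , a , b
    step⁻ c₁₃₂ _ _ (a , b , c) = b , c , a

    orbit-invariant : ∀ {P Q} → P ∼ Q → AllDivisible P → AllDivisible Q
    orbit-invariant ε v = v
    orbit-invariant (fwd (_ , s , γ , refl) ◅ r) v = orbit-invariant r (step⁺ γ _ s v)
    orbit-invariant (bwd (s , _ , γ , refl) ◅ r) v = orbit-invariant r (step⁻ γ _ s v)

  Φ-∼⇒∣ : ∀ {t t′} → InD p t → InD p t′ → Φ t ∼ Φ t′ → t ∣ t′
  Φ-∼⇒∣ {t} {t′} D D′ r =
    let l = Φ-log D
        _ , (a , t∣a , e) , _ = orbit-invariant r ((0 , t ∣0 , log₁ l) , (t , ∣-refl , log₂ l) , (t , ∣-refl , log₃ l))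
    in τ-∣ {t} {a} {t′} t∣N (trans (sym e) (log₂ (Φ-log D′))) t∣a
    where
    t∣N = proj₁ (proj₂ D)
    open Invariant t∣N

  Φ-injective : ∀ {t t′} → InD p t → InD p t′ → Φ t ∼ Φ t′ → t ≡ t′
  Φ-injective D D′ r = ∣-antisym (Φ-∼⇒∣ D D′ r) (Φ-∼⇒∣ D′ D (∼-sym r))

  -- If the signs for a and b differ, equality of the third coordinates becomes (u - 1/u) (v - 1/v)
  -- = 0 for u = gᵃ and v = gᵇ. One of the two is then its own inverse, and its sign can be adapted
  -- to the other.
  log-unique : ∀ {P a b a′ b′} → Log P a b → Log P a′ b′ →
    (g ^ a ≡ g ^ a′ ∧ g ^ b ≡ g ^ b′) ⊎ (g ^ a * g ^ a′ ≡ 1# ∧ g ^ b * g ^ b′ ≡ 1#)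
  log-unique {P} {a} {b} {a′} {b′} l l′ = case (τ-≡ {a} {a′} (trans (sym (log₁ l)) (log₁ l′)) , τ-≡ {b} {b′} (trans (sym (log₂ l)) (log₂ l′))) of λ where
      (inj₁ ea , inj₁ eb) → inj₁ (ea , eb)
      (inj₂ ia , inj₂ ib) → inj₂ (ia , ib)
      (inj₁ ea , inj₂ ib) → mixed ea (inverse⇒h^ {b} ib)
      (inj₂ ia , inj₁ eb) → mixed′ (inverse⇒h^ {a} ia) eb
    where
    prod : g ^ a * g ^ b + h ^ a * h ^ b ≡ g ^ a′ * g ^ b′ + h ^ a′ * h ^ b′
    prod = trans (sym (τ-+ a b)) (trans (trans (sym (log₃ l)) (log₃ l′)) (τ-+ a′ b′))
    crossed : ∀ {u u′ v v′} → u * v + u′ * v′ ≡ u * v′ + u′ * v → u ≡ u′ ⊎ v ≡ v′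
    crossed {u} {u′} {v} {v′} e = Sum.map x-y≡0⇒x≡y x-y≡0⇒x≡y (domain (begin
      (u + - u′) * (v + - v′)                           ≡⟨ solve 4 (λ u u′ v v′ → (u :- u′) :* (v :- v′) := (u :* v :+ u′ :* v′) :- (u :* v′ :+ u′ :* v)) refl u u′ v v′ ⟩
      (u * v + u′ * v′) + - (u * v′ + u′ * v)           ≡⟨ cong (λ w → w + - (u * v′ + u′ * v)) e ⟩
      (u * v′ + u′ * v) + - (u * v′ + u′ * v)           ≡⟨ -‿inverseʳ _ ⟩
      0# ∎))
    Result = (g ^ a ≡ g ^ a′ ∧ g ^ b ≡ g ^ b′) ⊎ (g ^ a * g ^ a′ ≡ 1# ∧ g ^ b * g ^ b′ ≡ 1#)
    inv : ∀ {c c′} → g ^ c′ ≡ h ^ c → g ^ c * g ^ c′ ≡ 1#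
    inv {c} e = trans (cong (g ^ c *_) e) (g^*h^ c)
    mixed : g ^ a ≡ g ^ a′ → g ^ b′ ≡ h ^ b → Result
    mixed ea eb = [ (λ e → inj₂ (inv {a} {a′} (trans (sym ea) e) , inv {b} {b′} eb)) , (λ e → inj₁ (ea , trans e (sym eb))) ]′
      (crossed (trans prod (cong₂ _+_ (cong₂ _*_ (sym ea) eb) (cong₂ _*_ (sym (h^-cong {a} {a′} ea)) (h^-flip {b} {b′} eb)))))
    mixed′ : g ^ a′ ≡ h ^ a → g ^ b ≡ g ^ b′ → Result
    mixed′ ea eb = [ (λ e → inj₁ (trans e (sym ea) , eb)) , (λ e → inj₂ (inv {a} {a′} ea , inv {b} {b′} (trans (sym eb) e))) ]′
      (crossed (trans prod (trans (cong₂ _+_ (cong₂ _*_ ea (sym eb)) (cong₂ _*_ (h^-flip {a} {a′} ea) (sym (h^-cong {b} {b′} eb)))) (+-comm _ _))))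

  g^-% : ∀ a → g ^ a ≡ g ^ (a % N p)
  g^-% a = trans (cong (g ^_) (m≡m%n+[m/n]*n a (N p))) (g^+N {a % N p} (n∣m*n (a / N p)))

  %-cong⇒g^ : ∀ {a b} → a % N p ≡ b % N p → g ^ a ≡ g ^ b
  %-cong⇒g^ {a} {b} e = trans (g^-% a) (trans (cong (g ^_) e) (sym (g^-% b)))

  g^⇒%-cong : ∀ {a b} → g ^ a ≡ g ^ b → a % N p ≡ b % N p
  g^⇒%-cong {a} {b} e = ^-injective g-order (m%n<n a (N p)) (m%n<n b (N p)) (trans (sym (g^-% a)) (trans e (g^-% b)))

  ∣+⇒h^ : ∀ {a b} → N p ∣ a ℕ.+ b → g ^ b ≡ h ^ a
  ∣+⇒h^ {a} {b} d = inverse⇒h^ {a} (trans (sym (^-homo-* g a b)) (^-∣ (^order g-order) d))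

  log-% : ∀ {P a b a′ b′} → a % N p ≡ a′ % N p → b % N p ≡ b′ % N p → Log P a b → Log P a′ b′
  log-% {P} {a} {b} {a′} {b′} ea eb = log-cong (%-cong⇒g^ {a} {a′} ea) (%-cong⇒g^ {b} {b′} eb)

  log-inverse : ∀ {P a b a′ b′} → N p ∣ a ℕ.+ a′ → N p ∣ b ℕ.+ b′ → Log P a b → Log P a′ b′
  log-inverse {P} {a} {b} {a′} {b′} da db = log-neg (∣+⇒h^ {a} {a′} da) (∣+⇒h^ {b} {b′} db)

  log-unique-% : ∀ {P a b a′ b′} → Log P a b → Log P a′ b′ →
    (a % N p ≡ a′ % N p ∧ b % N p ≡ b′ % N p) ⊎ (N p ∣ a ℕ.+ a′ ∧ N p ∣ b ℕ.+ b′)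
  log-unique-% {P} {a} {b} {a′} {b′} l l′ = Sum.map (λ { (ea , eb) → g^⇒%-cong {a} {a′} ea , g^⇒%-cong {b} {b′} eb })
    (λ { (ia , ib) → g^*g^≡1⇒∣ {a} {a′} ia , g^*g^≡1⇒∣ {b} {b′} ib }) (log-unique l l′)

open import Data.Nat using (_+_; _*_; _^_)
open import Data.Nat.Properties
open import Data.Product using (_×_)

-- Orbit sizes

module OrbitSizes (p : ℕ) .{{p≢0 : NonZero p}} .{{N≢0 : NonZero (N p)}}
  (Log : Point p → ℕ → ℕ → Set) (pointAt : ℕ → ℕ → Point p)
  (log⇒≡ : ∀ {P a b} → Log P a b → P ≡ pointAt a b)
  (pointAt-log : ∀ {t} → InD p t → ∀ a b → t ∣ a → t ∣ b → Log (pointAt a b) a b)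
  (∃-log : ∀ {P} → IsSol p P → ∃₂ (λ a b → Log P a b))
  (log-% : ∀ {P a b a′ b′} → a % N p ≡ a′ % N p → b % N p ≡ b′ % N p → Log P a b → Log P a′ b′)
  (log-inverse : ∀ {P a b a′ b′} → N p ∣ a + a′ → N p ∣ b + b′ → Log P a b → Log P a′ b′)
  (log-unique : ∀ {P a b a′ b′} → Log P a b → Log P a′ b′ →
    (a % N p ≡ a′ % N p × b % N p ≡ b′ % N p) ⊎ (N p ∣ a + a′ × N p ∣ b + b′))
  (log⇒∼ : ∀ {P a b} → Log P a b → SameOrbit p P (pointAt 0 (gcd (N p) (gcd a b))))
  (log-InD : ∀ {P a b} → Log P a b → InD p (gcd (N p) (gcd a b)))
  (isSol : ∀ {t} → InD p t → IsSol p (pointAt 0 t))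
  (∼-isSol : ∀ {P Q} → SameOrbit p P Q → IsSol p P → IsSol p Q)
  (injective : ∀ {t t′} → InD p t → InD p t′ → SameOrbit p (pointAt 0 t) (pointAt 0 t′) → t ≡ t′)
  {t : ℕ} (D : InD p t) (M : ℕ) (N≡ : N p ≡ M * t) where

  private
    instance
      Mt≢0 : NonZero (M * t)
      Mt≢0 = subst NonZero N≡ (≢-nonZero (≢-nonZero⁻¹ (N p)))
      M≢0 : NonZero M
      M≢0 = m*n≢0⇒m≢0 M
      t≢0 : NonZero t
      t≢0 = m*n≢0⇒n≢0 M

    _≟P_ : DecidableEquality (Point p)
    _≟P_ = ≡-dec Fin._≟_ (≡-dec Fin._≟_ Fin._≟_)

    pairs : List (ℕ × ℕ)
    pairs = coprimePairs M

    f : ℕ × ℕ → Point p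
    f (a , b) = pointAt (a * t) (b * t)

    f-log : ∀ a b → Log (f (a , b)) (a * t) (b * t)
    f-log a b = pointAt-log D (a * t) (b * t) (n∣m*n a) (n∣m*n b)

    level-scale : ∀ a b → gcd (N p) (gcd (a * t) (b * t)) ≡ t * gcd (gcd a b) M
    level-scale a b = begin
      gcd (N p) (gcd (a * t) (b * t))        ≡⟨ cong₂ gcd (trans N≡ (*-comm M t)) (cong₂ gcd (*-comm a t) (*-comm b t)) ⟩
      gcd (t * M) (gcd (t * a) (t * b))      ≡⟨ cong (gcd (t * M)) (c*gcd[m,n]≡gcd[cm,cn] t a b) ⟨
      gcd (t * M) (t * gcd a b)              ≡⟨ c*gcd[m,n]≡gcd[cm,cn] t M (gcd a b) ⟨
      t * gcd M (gcd a b)                    ≡⟨ cong (t *_) (gcd-comm M (gcd a b)) ⟩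
      t * gcd (gcd a b) M                    ∎
      where open ≡-Reasoning

    scale-% : ∀ a → (a * t) % N p ≡ (a % M * t) % N p
    scale-% a = begin
      (a * t) % N p                              ≡⟨ cong (λ x → (x * t) % N p) (m≡m%n+[m/n]*n a M) ⟩
      ((a % M + a / M * M) * t) % N p            ≡⟨ cong (_% N p) (trans (*-distribʳ-+ t (a % M) (a / M * M)) (cong (a % M * t +_) (trans (*-assoc (a / M) M t) (cong (a / M *_) (sym N≡))))) ⟩
      (a % M * t + a / M * N p) % N p            ≡⟨ [m+kn]%n≡m%n (a % M * t) (a / M) (N p) ⟩
      (a % M * t) % N p                          ∎
      where open ≡-Reasoning

    orbit : List (Point p)
    orbit = deduplicate _≟P_ (map f pairs)

    orbit⁺ : ∀ {P} → P ∈ orbit → SameOrbit p (pointAt 0 t) P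
    orbit⁺ {P} P∈ with ∈-map⁻ f (∈-deduplicate⁻ _≟P_ (map f pairs) P∈)
    ... | (a , b) , ab∈ , refl = EqC.symmetric (Step p) (subst (λ s → SameOrbit p (f (a , b)) (pointAt 0 s))
            (trans (level-scale a b) (trans (cong (t *_) (proj₂ (proj₂ (∈-boundedCoprimePairs⁻ {M} {M} ab∈)))) (*-identityʳ t))) (log⇒∼ (f-log a b)))

    log⇒∈orbit : ∀ {P} a b → Log P a b → t ≡ gcd (N p) (gcd a b) → P ∈ orbit
    log⇒∈orbit {P} a b l t≡ = scaled (∣-trans t∣gcd (gcd[m,n]∣m a b)) (∣-trans t∣gcd (gcd[m,n]∣n a b))
      where
      t∣gcd : t ∣ gcd a b
      t∣gcd = subst (_∣ gcd a b) (sym t≡) (gcd[m,n]∣n (N p) (gcd a b))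
      scaled : t ∣ a → t ∣ b → P ∈ orbit
      scaled (divides a′ refl) (divides b′ refl) = ∈-deduplicate⁺ _≟P_ (subst (_∈ map f pairs)
        (sym (log⇒≡ (log-% (scale-% a′) (scale-% b′) l)))
        (∈-map⁺ f (∈-boundedCoprimePairs⁺ (m%n<n a′ M) (m%n<n b′ M) (coprime₃-%⁺ M {a′} {b′}
          (*-cancelˡ-≡ _ 1 t (trans (sym (level-scale a′ b′)) (trans (sym t≡) (sym (*-identityʳ t)))))))))

    -- The level of any point of the orbit is again t, by injectivity on D; so both logarithms are
    -- multiples of t, and dividing by t leaves a pair coprime to M.
    orbit⁻ : ∀ {P} → SameOrbit p (pointAt 0 t) P → P ∈ orbit
    orbit⁻ {P} r = go (∃-log (∼-isSol r (isSol D)))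
      where
      go : (∃₂ λ a b → Log P a b) → P ∈ orbit
      go (a , b , l) = log⇒∈orbit a b l (injective D (log-InD l) (r ◅◅ log⇒∼ l))

    orbitSize : OrbitSize p (pointAt 0 t) (length orbit)
    orbitSize = orbit , deduplicate-! _≟P_ (map f pairs) , refl , λ P → mk⇔ orbit⁺ orbit⁻

    -- Negation modulo M; the outer reduction matters for a = 0, where `M ∸ a` is not below M.
    inverse : ℕ → ℕ
    inverse a = (M ∸ a) % M

    M∣inverse+ : ∀ {a} → a < M → M ∣ a + inverse a
    M∣inverse+ {a} a<M = m%n≡0⇒n∣m _ M (begin
      (a + (M ∸ a) % M) % M           ≡⟨ %-distribˡ-+ a ((M ∸ a) % M) M ⟩
      (a % M + (M ∸ a) % M % M) % M   ≡⟨ cong (λ x → (a % M + x) % M) (m%n%n≡m%n (M ∸ a) M) ⟩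
      (a % M + (M ∸ a) % M) % M       ≡⟨ %-distribˡ-+ a (M ∸ a) M ⟨
      (a + (M ∸ a)) % M               ≡⟨ cong (_% M) (m+[n∸m]≡n (<⇒≤ a<M)) ⟩
      M % M                           ≡⟨ n%n≡0 M ⟩
      0                               ∎)
      where open ≡-Reasoning

    inverse-unique : ∀ {a b} → a < M → b < M → M ∣ a + b → b ≡ inverse a
    inverse-unique {a} {b} a<M b<M d = begin
      b                          ≡⟨ m<n⇒m%n≡m b<M ⟨
      b % M                      ≡⟨ [m+n]%n≡m%n b M ⟨
      (b + M) % M                ≡⟨ cong (λ x → (b + x) % M) (m+[n∸m]≡n (<⇒≤ a<M)) ⟨
      (b + (a + (M ∸ a))) % M    ≡⟨ cong (_% M) (trans (sym (+-assoc b a (M ∸ a))) (cong (_+ (M ∸ a)) (+-comm b a))) ⟩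
      (a + b + (M ∸ a)) % M      ≡⟨ %-remove-+ˡ (M ∸ a) d ⟩
      (M ∸ a) % M                ∎
      where open ≡-Reasoning

    scale-∣⁺ : ∀ {a b} → M ∣ a + b → N p ∣ a * t + b * t
    scale-∣⁺ {a} {b} d = subst₂ _∣_ (sym N≡) (*-distribʳ-+ t a b) (*-monoˡ-∣ t d)

    scale-∣⁻ : ∀ {a b} → N p ∣ a * t + b * t → M ∣ a + b
    scale-∣⁻ {a} {b} d = *-cancelʳ-∣ t (subst₂ _∣_ N≡ (sym (*-distribʳ-+ t a b)) d)

    scale-injective : ∀ {a b} → a < M → b < M → (a * t) % N p ≡ (b * t) % N p → a ≡ b
    scale-injective {a} {b} a<M b<M e = *-cancelʳ-≡ a b t (trans (sym (m<n⇒m%n≡m (small a<M))) (trans e (m<n⇒m%n≡m (small b<M))))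
      where
      small : ∀ {a} → a < M → a * t < N p
      small {a} a<M = subst (a * t <_) (sym N≡) (*-monoˡ-< t a<M)

    inversePair : ℕ × ℕ → ℕ × ℕ
    inversePair (a , b) = inverse a , inverse b

    fibre : ∀ {x y} → x ∈ pairs → y ∈ pairs → f x ≡ f y → x ≡ y ⊎ x ≡ inversePair y
    fibre {a , b} {a′ , b′} x∈ y∈ e with ∈-boundedCoprimePairs⁻ {M} {M} x∈ | ∈-boundedCoprimePairs⁻ {M} {M} y∈
    ... | a< , b< , _ | a′< , b′< , _ = Sum.map
      (λ { (ea , eb) → cong₂ _,_ (scale-injective a< a′< ea) (scale-injective b< b′< eb) })
      (λ { (da , db) → cong₂ _,_ (inverse-unique a′< a< (subst (M ∣_) (+-comm a a′) (scale-∣⁻ {a} {a′} da))) (inverse-unique b′< b< (subst (M ∣_) (+-comm b b′) (scale-∣⁻ {b} {b′} db))) })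
      (log-unique (f-log a b) (subst (λ P → Log P (a′ * t) (b′ * t)) (sym e) (f-log a′ b′)))

    inversePair-∈ : ∀ {x} → x ∈ pairs → inversePair x ∈ pairs
    inversePair-∈ {a , b} x∈ with ∈-boundedCoprimePairs⁻ {M} {M} x∈
    ... | a< , b< , c = ∈-boundedCoprimePairs⁺ (m%n<n (M ∸ a) M) (m%n<n (M ∸ b) M) (noCommonPrime⇒coprime₃ {inverse a} {inverse b} λ r pr ra rb rM →
            coprime₃⇒noCommonPrime {a} {b} c r pr (back a< rM ra) (back b< rM rb) rM)
      where
      back : ∀ {r a} → a < M → r ∣ M → r ∣ inverse a → r ∣ a
      back {r} {a} a<M rM ri = ∣m+n∣m⇒∣n (subst (r ∣_) (+-comm a (inverse a)) (∣-trans rM (M∣inverse+ a<M))) ri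

    f-inversePair : ∀ {x} → x ∈ pairs → f (inversePair x) ≡ f x
    f-inversePair {a , b} x∈ with ∈-boundedCoprimePairs⁻ {M} {M} x∈
    ... | a< , b< , _ = sym (log⇒≡ (log-inverse (scale-∣⁺ {a} {inverse a} (M∣inverse+ a<)) (scale-∣⁺ {b} {inverse b} (M∣inverse+ b<)) (f-log a b)))

    -- A pair equal to its negative has M ∣ 2a and M ∣ 2b; together with M ∣ 2M this gives M ∣ 2
    -- gcd(a, b, M) = 2.
    fixed⇒M∣2 : ∀ {x} → x ∈ pairs → x ≡ inversePair x → M ∣ 2
    fixed⇒M∣2 {a , b} x∈ e with ∈-boundedCoprimePairs⁻ {M} {M} x∈
    ... | a< , b< , c = subst (M ∣_) two (gcd-greatest (gcd-greatest (double a< (cong proj₁ e)) (double b< (cong proj₂ e))) (n∣m*n 2))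
      where
      double : ∀ {a} → a < M → a ≡ inverse a → M ∣ 2 * a
      double {a} a<M e = subst (M ∣_) (cong (a +_) (trans (sym e) (sym (+-identityʳ a)))) (M∣inverse+ a<M)
      two : gcd (gcd (2 * a) (2 * b)) (2 * M) ≡ 2
      two = trans (cong (λ x → gcd x (2 * M)) (sym (c*gcd[m,n]≡gcd[cm,cn] 2 a b))) (trans (sym (c*gcd[m,n]≡gcd[cm,cn] 2 (gcd a b) M)) (cong (2 *_) c))

    M∣2⇒fixed : ∀ {x} → x ∈ pairs → M ∣ 2 → x ≡ inversePair x
    M∣2⇒fixed {a , b} x∈ d with ∈-boundedCoprimePairs⁻ {M} {M} x∈
    ... | a< , b< , _ = cong₂ _,_ (inverse-unique a< a< (double a)) (inverse-unique b< b< (double b))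
      where
      double : ∀ a → M ∣ a + a
      double a = subst (M ∣_) (cong (a +_) (+-identityʳ a)) (∣m⇒∣m*n a d)

    fibreList : Point p → List (ℕ × ℕ)
    fibreList P = filter (λ x → f x ≟P P) pairs

    fibreList-length : ∀ {x ys} → x ∈ pairs → Unique ys → (∀ {y} → y ∈ ys → y ≡ x ⊎ y ≡ inversePair x) → x ∈ ys → inversePair x ∈ ys →
      length (fibreList (f x)) ≡ length ys
    fibreList-length {x} {ys} x∈ u only x∈ys ix∈ys = unique-⇔⇒length≡ (Uniq.filter⁺ (λ y → f y ≟P f x) boundedCoprimePairs-unique) u
      (λ {y} y∈ → let y∈pairs , e = ∈-filter⁻ (λ y → f y ≟P f x) {xs = pairs} y∈ in
        [ (λ y≡ → subst (_∈ ys) (sym y≡) x∈ys) , (λ y≡ → subst (_∈ ys) (sym y≡) ix∈ys) ]′ (fibre {y} {x} y∈pairs x∈ e))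
      (λ y∈ → [ (λ y≡ → subst (_∈ fibreList (f x)) (sym y≡) (∈-filter⁺ (λ y → f y ≟P f x) x∈ refl))
              , (λ y≡ → subst (_∈ fibreList (f x)) (sym y≡) (∈-filter⁺ (λ y → f y ≟P f x) (inversePair-∈ x∈) (f-inversePair x∈))) ]′ (only y∈))

    -- `sizeProduct` counts the coprime pairs modulo M, and `f` maps them onto the orbit with fibres
    -- of constant size c.
    count : ∀ c → (∀ {x} → x ∈ pairs → length (fibreList (f x)) ≡ c) → sizeProduct p t ≡ c * length orbit
    count c h = trans (sym (length-coprimePairs (N p) M t N≡)) (length-fibres _≟P_ f c boundedCoprimePairs-unique (deduplicate-! _≟P_ (map f pairs))
      (λ x∈ → ∈-deduplicate⁺ _≟P_ (∈-map⁺ f x∈))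
      (λ {P} P∈ → let x , x∈ , P≡ = ∈-map⁻ f (∈-deduplicate⁻ _≟P_ (map f pairs) P∈) in subst (λ Q → length (fibreList Q) ≡ c) (sym P≡) (h x∈)))

  generic-size : ¬ (M ∣ 2) → ∃ λ n → OrbitSize p (pointAt 0 t) n × 2 * n ≡ sizeProduct p t
  generic-size M∤2 = length orbit , orbitSize , sym (count 2 (λ {x} x∈ → fibreList-length {x} {x ∷ inversePair x ∷ []} x∈
    (((λ e → M∤2 (fixed⇒M∣2 x∈ e)) ∷ []) ∷ [] ∷ []) (λ { (here e) → inj₁ e ; (there (here e)) → inj₂ e }) (here refl) (there (here refl))))

  special-size : M ∣ 2 → ∃ λ n → OrbitSize p (pointAt 0 t) n × n ≡ sizeProduct p t
  special-size M∣2 = length orbit , orbitSize , sym (trans (count 1 (λ {x} x∈ → fibreList-length {x} {x ∷ []} x∈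
    ([] ∷ []) (λ { (here e) → inj₁ e }) (here refl) (here (sym (M∣2⇒fixed x∈ M∣2))))) (*-identityˡ _))

-- The number of orbits

record Split (p A B : ℕ) : Set where
  field
    cofactor : ℕ
    B≡       : B ≡ 2 ^ 1 * suc (2 * cofactor)
    2∣A      : 2 ∣ A
    sides    : (A ≡ p ∸ 1 × B ≡ p + 1) ⊎ (A ≡ p + 1 × B ≡ p ∸ 1)

-- For either odd residue of p modulo 4, p + ε ≡ 2 modulo 4, so p + ε is twice an odd number. The
-- factor `2 ^ 1` in `B≡` is the form that `val-power` reads.
split-ε : ∀ p → ¬ (2 ∣ p) → Split p (pMinusε p) (pPlusε p)
split-ε p 2∤p = go (p % 4) (p / 4) (m≡m%n+[m/n]*n p 4) (m%n<n p 4)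
  where
  open +-*-Solver
  go : ∀ r j → p ≡ r + j * 4 → r < 4 → Split p (if r ≡ᵇ 1 then p ∸ 1 else p + 1) (if r ≡ᵇ 1 then p + 1 else p ∸ 1)
  go 0 j e _ = contradiction (subst (2 ∣_) (sym e) (∣n⇒∣m*n j (divides 2 refl))) 2∤p
  go 1 j e _ = record { cofactor = j ; B≡ = trans (cong (_+ 1) e) (solve 1 (λ j → con 1 :+ j :* con 4 :+ con 1 := con 2 :* (con 1 :+ con 2 :* j)) refl j)
    ; 2∣A = subst (2 ∣_) (sym (cong (_∸ 1) e)) (∣n⇒∣m*n j (divides 2 refl)) ; sides = inj₁ (refl , refl) }
  go 2 j e _ = contradiction (subst (2 ∣_) (sym e) (∣m∣n⇒∣m+n ∣-refl (∣n⇒∣m*n j (divides 2 refl)))) 2∤p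
  go 3 j e _ = record { cofactor = j ; B≡ = trans (cong (_∸ 1) e) (solve 1 (λ j → con 2 :+ j :* con 4 := con 2 :* (con 1 :+ con 2 :* j)) refl j)
    ; 2∣A = subst (2 ∣_) (sym (cong (_+ 1) e)) (divides (2 * j + 2) (solve 1 (λ j → con 3 :+ j :* con 4 :+ con 1 := (con 2 :* j :+ con 2) :* con 2) refl j)) ; sides = inj₂ (refl , refl) }
  go (suc (suc (suc (suc r)))) j e (s≤s (s≤s (s≤s (s≤s ()))))

module OrbitCount (p : ℕ) .{{p≢0 : NonZero p}} (2≤p : 2 ≤ p) (2∤p : ¬ (2 ∣ p))
  (Φ : ℕ → Point p) (isSol : ∀ {t} → InD p t → IsSol p (Φ t))
  (injective : ∀ {t t′} → InD p t → InD p t′ → SameOrbit p (Φ t) (Φ t′) → t ≡ t′)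
  (surjective : ∀ P → IsSol p P → ∃ (λ t → InD p t × SameOrbit p P (Φ t))) where

  private
    A B : ℕ
    A = pMinusε p
    B = pPlusε p
    open Split (split-ε p 2∤p)

    N≡ : N p ≡ (p + 1) * (p ∸ 1)
    N≡ = N-factor p

    instance
      p+1≢0 : NonZero (p + 1)
      p+1≢0 = subst NonZero (+-comm 1 p) _
      p-1≢0 : NonZero (p ∸ 1)
      p-1≢0 = >-nonZero (m<n⇒0<n∸m 2≤p)
      N≢0 : NonZero (N p)
      N≢0 = subst NonZero (sym N≡) (m*n≢0 (p + 1) (p ∸ 1))

    N≡AB : N p ≡ A * B
    N≡AB = trans N≡ ([ (λ (a , b) → trans (*-comm (p + 1) (p ∸ 1)) (sym (cong₂ _*_ a b))) , (λ (a , b) → sym (cong₂ _*_ a b)) ]′ sides)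

    instance
      AB≢0 : NonZero (A * B)
      AB≢0 = subst NonZero N≡AB N≢0
      A≢0 : NonZero A
      A≢0 = m*n≢0⇒m≢0 A
      B≢0 : NonZero B
      B≢0 = m*n≢0⇒n≢0 A

    common∣2 : ∀ {d} → d ∣ A → d ∣ B → d ∣ 2
    common∣2 {d} dA dB = [ (λ (a , b) → diff (subst (d ∣_) a dA) (subst (d ∣_) b dB)) , (λ (a , b) → diff (subst (d ∣_) b dB) (subst (d ∣_) a dA)) ]′ sides
      where
      diff : d ∣ p ∸ 1 → d ∣ p + 1 → d ∣ 2
      diff d₁ d₂ = ∣m+n∣m⇒∣n (subst (d ∣_) p+1≡ d₂) d₁
        where
        p+1≡ : p + 1 ≡ p ∸ 1 + 2
        p+1≡ = trans (cong (_+ 1) (sym (m∸n+n≡m (<⇒≤ 2≤p)))) (+-assoc (p ∸ 1) 1 1)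

    2∣B : 2 ∣ B
    2∣B = subst (2 ∣_) (sym B≡) (m∣m*n (suc (2 * cofactor)))

    val2B : val 2 B ≡ 1
    val2B = trans (cong (val 2) B≡) (val-power 1 (suc (2 * cofactor)) (s≤s (s≤s z≤n))
      (λ d → contradiction (∣1⇒≡1 (∣m+n∣m⇒∣n (subst (2 ∣_) (+-comm 1 (2 * cofactor)) d) (m∣m*n cofactor))) λ ()))

    oddPrimes⁻ : ∀ {n q} → q ∈ oddPrimeDivisors n → Prime q × q ∣ n × q ≢ 2
    oddPrimes⁻ {n} q∈ = let q∈′ , q≢2 = ∈-filter⁻ (λ q → ¬? (q ≟ 2)) {xs = primeDivisors n} q∈
                            pq , q∣n = primeDivisors⁻ {n} q∈′ in pq , q∣n , q≢2

    divisors : ∀ n .{{_ : NonZero n}} → Σ (List ℕ) λ ds → Unique ds × (∀ {d} → d ∈ ds → d ∣ n) × (∀ {d} → d ∣ n → d ∈ ds) ×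
      length ds ≡ (val 2 n + 1) * product (map (λ q → val q n + 1) (oddPrimeDivisors n))
    divisors n = divisors-of (2 ∷ oddPrimeDivisors n) n
      (All.tabulate (λ q∈ e → proj₂ (proj₂ (oddPrimes⁻ {n} q∈)) (sym e)) ∷ Uniq.filter⁺ (λ q → ¬? (q ≟ 2)) (primeDivisors-unique n))
      (prime[2] ∷ All.tabulate (λ q∈ → proj₁ (oddPrimes⁻ {n} q∈)))
      (λ {r} pr r∣n → case r ≟ 2 of λ where
        (yes r≡2) → here r≡2
        (no r≢2) → there (∈-filter⁺ (λ q → ¬? (q ≟ 2)) (primeDivisors⁺ pr r∣n) r≢2))

    product-cong : ∀ (f g : ℕ → ℕ) xs → (∀ {x} → x ∈ xs → f x ≡ g x) → product (map f xs) ≡ product (map g xs)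
    product-cong f g xs h = cong product (map-cong-local {f = f} {g} {xs} (All.tabulate h))

    oddA oddB : ℕ
    oddA = product (map (λ q → val q (N p) + 1) (oddPrimeDivisors A))
    oddB = product (map (λ q → val q (N p) + 1) (oddPrimeDivisors B))

    val-N : ∀ {q} → Prime q → val q (N p) ≡ val q A + val q B
    val-N {q} pq = trans (cong (val q) N≡AB) (val-* pq A B)

    odd-common : ∀ {q} → Prime q → q ≢ 2 → q ∣ A → q ∣ B → ⊥
    odd-common pq q≢2 qA qB = q≢2 (prime∣prime⇒≡ pq prime[2] (common∣2 qA qB))

    divisorsA divisorsB otherDivisorsB : List ℕ
    divisorsA = proj₁ (divisors A)
    divisorsB = proj₁ (divisors B)
    -- The divisors 1 and 2 of B divide A as well and already occur in `divisorsA`.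
    otherDivisorsB = filter (λ d → ¬? (d ∣? 2)) divisorsB

    ∈A⁻ : ∀ {d} → d ∈ divisorsA → d ∣ A
    ∈A⁻ = proj₁ (proj₂ (proj₂ (divisors A)))
    ∈A⁺ : ∀ {d} → d ∣ A → d ∈ divisorsA
    ∈A⁺ = proj₁ (proj₂ (proj₂ (proj₂ (divisors A))))
    ∈B⁻ : ∀ {d} → d ∈ divisorsB → d ∣ B
    ∈B⁻ = proj₁ (proj₂ (proj₂ (divisors B)))
    ∈B⁺ : ∀ {d} → d ∣ B → d ∈ divisorsB
    ∈B⁺ = proj₁ (proj₂ (proj₂ (proj₂ (divisors B))))

    ∈other⁻ : ∀ {d} → d ∈ otherDivisorsB → d ∣ B × ¬ (d ∣ 2)
    ∈other⁻ d∈ = let d∈B , d∤2 = ∈-filter⁻ (λ d → ¬? (d ∣? 2)) {xs = divisorsB} d∈ in ∈B⁻ d∈B , d∤2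

    -- The factor of the divisor count at 2 is `val 2 A + 1`, which is `val 2 (N p)` because B
    -- contains 2 exactly once. At an odd prime of A, the valuations of A and of `N p` agree.
    length-A : length divisorsA ≡ val 2 (N p) * oddA
    length-A = trans (proj₂ (proj₂ (proj₂ (proj₂ (divisors A))))) (cong₂ _*_
      (sym (trans (val-N prime[2]) (cong (val 2 A +_) val2B)))
      (product-cong _ _ (oddPrimeDivisors A) (λ {q} q∈ → let pq , qA , q≢2 = oddPrimes⁻ {A} q∈ in
        cong (_+ 1) (sym (trans (val-N pq) (trans (cong (val q A +_) (val-∤ pq (odd-common pq q≢2 qA))) (+-identityʳ _)))))))

    length-B : length divisorsB ≡ 2 * oddB
    length-B = trans (proj₂ (proj₂ (proj₂ (proj₂ (divisors B))))) (cong₂ _*_ (cong (_+ 1) val2B)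
      (product-cong _ _ (oddPrimeDivisors B) (λ {q} q∈ → let pq , qB , q≢2 = oddPrimes⁻ {B} q∈ in
        cong (_+ 1) (sym (trans (val-N pq) (cong (_+ val q B) (val-∤ pq (λ qA → odd-common pq q≢2 qA qB))))))))

    -- Stated additively, to keep truncated subtraction out until the final `∸ 2` of `orbitCount`.
    length-other : 2 + length otherDivisorsB ≡ length divisorsB
    length-other = unique-⇔⇒length≡ {xs = 1 ∷ 2 ∷ otherDivisorsB} uniq (proj₁ (proj₂ (divisors B))) to from
      where
      uniq : Unique (1 ∷ 2 ∷ otherDivisorsB)
      uniq = ((λ ()) ∷ All.tabulate (λ d∈ e → proj₂ (∈other⁻ d∈) (subst (_∣ 2) e (1∣ 2))))
        ∷ All.tabulate (λ d∈ e → proj₂ (∈other⁻ d∈) (subst (_∣ 2) e ∣-refl))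
        ∷ Uniq.filter⁺ (λ d → ¬? (d ∣? 2)) (proj₁ (proj₂ (divisors B)))
      to : ∀ {d} → d ∈ 1 ∷ 2 ∷ otherDivisorsB → d ∈ divisorsB
      to (here refl) = ∈B⁺ (1∣ B)
      to (there (here refl)) = ∈B⁺ 2∣B
      to (there (there d∈)) = ∈B⁺ (proj₁ (∈other⁻ d∈))
      from : ∀ {d} → d ∈ divisorsB → d ∈ 1 ∷ 2 ∷ otherDivisorsB
      from {d} d∈ = case d ∣? 2 of λ where
        (no d∤2) → there (there (∈-filter⁺ (λ d → ¬? (d ∣? 2)) d∈ d∤2))
        (yes d∣2) → case irreducible[2] d∣2 of λ where
          (inj₁ d≡1) → here d≡1
          (inj₂ d≡2) → there (here d≡2)

    -- The values of M = N / t for t in D, each listed once: p + 1 ∣ t corresponds to M ∣ p - 1, and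
    -- p - 1 ∣ t to M ∣ p + 1.
    orders : List ℕ
    orders = divisorsA ++ otherDivisorsB

    orders-unique : Unique orders
    orders-unique = Uniq.++⁺ (proj₁ (proj₂ (divisors A))) (Uniq.filter⁺ (λ d → ¬? (d ∣? 2)) (proj₁ (proj₂ (divisors B))))
      (λ (d∈A , d∈B) → let dB , d∤2 = ∈other⁻ d∈B in d∤2 (common∣2 (∈A⁻ d∈A) dB))

    length-orders : length orders ≡ orbitCount p
    length-orders = begin
      length orders                                      ≡⟨ length-++ divisorsA ⟩
      length divisorsA + length otherDivisorsB           ≡⟨ m+n∸n≡m _ 2 ⟨
      length divisorsA + length otherDivisorsB + 2 ∸ 2   ≡⟨ cong (_∸ 2) (trans (+-assoc (length divisorsA) _ 2) (cong (length divisorsA +_) (+-comm (length otherDivisorsB) 2))) ⟩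
      length divisorsA + (2 + length otherDivisorsB) ∸ 2 ≡⟨ cong₂ (λ x y → x + y ∸ 2) length-A (trans length-other length-B) ⟩
      orbitCount p                                       ∎
      where open ≡-Reasoning

    -- The value at 0 is a default; 0 does not divide `N p`.
    codivisor : ℕ → ℕ
    codivisor zero = 0
    codivisor (suc m) = N p / suc m

    *-codivisor : ∀ {m} → m ∣ N p → m * codivisor m ≡ N p
    *-codivisor {zero} d = contradiction (0∣⇒≡0 d) (≢-nonZero⁻¹ (N p))
    *-codivisor {suc m} d = m*[n/m]≡n d

    ∈orders⁻ : ∀ {m} → m ∈ orders → m ∣ p ∸ 1 ⊎ m ∣ p + 1
    ∈orders⁻ {m} m∈ = case (∈-++⁻ divisorsA m∈ , sides) of λ where
      (inj₁ m∈A , inj₁ (a , b)) → inj₁ (subst (m ∣_) a (∈A⁻ m∈A))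
      (inj₁ m∈A , inj₂ (a , b)) → inj₂ (subst (m ∣_) a (∈A⁻ m∈A))
      (inj₂ m∈B , inj₁ (a , b)) → inj₂ (subst (m ∣_) b (proj₁ (∈other⁻ m∈B)))
      (inj₂ m∈B , inj₂ (a , b)) → inj₁ (subst (m ∣_) b (proj₁ (∈other⁻ m∈B)))

    ∈orders⁺ : ∀ {m} → m ∣ p ∸ 1 ⊎ m ∣ p + 1 → m ∈ orders
    ∈orders⁺ {m} d = case (d , sides) of λ where
        (inj₁ d , inj₁ (a , b)) → inA (subst (m ∣_) (sym a) d)
        (inj₁ d , inj₂ (a , b)) → inB (subst (m ∣_) (sym b) d)
        (inj₂ d , inj₁ (a , b)) → inB (subst (m ∣_) (sym b) d)
        (inj₂ d , inj₂ (a , b)) → inA (subst (m ∣_) (sym a) d)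
      where
      inA : m ∣ A → m ∈ orders
      inA d = ∈-++⁺ˡ (∈A⁺ d)
      inB : m ∣ B → m ∈ orders
      inB d = case m ∣? 2 of λ where
        (yes m∣2) → inA (∣-trans m∣2 2∣A)
        (no m∤2) → ∈-++⁺ʳ divisorsA (∈-filter⁺ (λ d → ¬? (d ∣? 2)) (∈B⁺ d) m∤2)

    orders∣N : ∀ {m} → m ∈ orders → m ∣ N p
    orders∣N {m} m∈ = subst (m ∣_) (sym N≡) ([ ∣n⇒∣m*n (p + 1) , ∣m⇒∣m*n (p ∸ 1) ]′ (∈orders⁻ m∈))

    -- Serves both directions of t ↔ N / t, with x and y the numbers p + 1 and p - 1 in either
    -- order.
    cross : ∀ {m t x y} .{{_ : NonZero m}} → m * t ≡ x * y → m ∣ x → y ∣ t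
    cross {m} {t} {x} {y} e (divides c refl) = divides c (*-cancelˡ-≡ t (c * y) m (trans e (trans (cong (_* y) (*-comm c m)) (*-assoc m c y))))

    codivisor-InD : ∀ {m} → m ∈ orders → InD p (codivisor m)
    codivisor-InD {m} m∈ = n≢0⇒n>0 (≢-nonZero⁻¹ (codivisor m)) , divides m (sym eq) ,
      [ (λ d → inj₁ (cross (trans eq (trans N≡ (*-comm (p + 1) (p ∸ 1)))) d)) , (λ d → inj₂ (cross (trans eq N≡) d)) ]′ (∈orders⁻ m∈)
      where
      eq = *-codivisor (orders∣N m∈)
      instance
        prod≢0 : NonZero (m * codivisor m)
        prod≢0 = subst NonZero (sym eq) N≢0
        m≢0 : NonZero m
        m≢0 = m*n≢0⇒m≢0 m
        c≢0 : NonZero (codivisor m)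
        c≢0 = m*n≢0⇒n≢0 m

    codivisor-injective : ∀ {m m′} → m ∈ orders → m′ ∈ orders → codivisor m ≡ codivisor m′ → m ≡ m′
    codivisor-injective {m} {m′} m∈ m′∈ e = *-cancelʳ-≡ m m′ (codivisor m) {{>-nonZero (proj₁ (codivisor-InD m∈))}}
      (trans (*-codivisor (orders∣N m∈)) (sym (trans (cong (m′ *_) e) (*-codivisor (orders∣N m′∈)))))

    representative : ℕ → Point p
    representative m = Φ (codivisor m)

    complete : ∀ {P} → (∃ λ t → InD p t × SameOrbit p P (Φ t)) → Any (SameOrbit p P) (map representative orders)
    complete {P} (t , (0<t , divides m N≡mt , side) , r) = lose {P = SameOrbit p P} (∈-map⁺ representative m∈)
      (subst (λ s → SameOrbit p P (Φ s)) t≡ r)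
      where
      instance
        t≢0 : NonZero t
        t≢0 = >-nonZero 0<t
        m≢0 : NonZero m
        m≢0 = m*n≢0⇒m≢0 m {{subst NonZero N≡mt N≢0}}
      tm≡ : t * m ≡ (p + 1) * (p ∸ 1)
      tm≡ = trans (*-comm t m) (trans (sym N≡mt) N≡)
      m∈ : m ∈ orders
      m∈ = ∈orders⁺ (Sum.map (back tm≡) (back (trans tm≡ (*-comm (p + 1) (p ∸ 1)))) side)
        where
        back : ∀ {x y} .{{_ : NonZero x}} → t * m ≡ x * y → x ∣ t → m ∣ y
        back {x} {y} e d = cross {x} {y} {t} {m} (sym e) d
      t≡ : t ≡ codivisor m
      t≡ = *-cancelˡ-≡ t (codivisor m) m (trans (sym N≡mt) (sym (*-codivisor (orders∣N m∈))))

  numOrbits : NumOrbits p (orbitCount p)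
  numOrbits = map representative orders
    , AllP.map⁺ (All.tabulate (λ m∈ → isSol (codivisor-InD m∈)))
    , AllPairsP.map⁺ (allPairs-map∈ (λ m∈ m′∈ m≢m′ r → m≢m′ (codivisor-injective m∈ m′∈ (injective (codivisor-InD m∈) (codivisor-InD m′∈) r))) orders-unique)
    , trans (length-map representative orders) length-orders
    , λ P s → complete (surjective P s)

-- Residues modulo p as a field

module PrimeField (p : ℕ) .{{p≢0 : NonZero p}} (pp : Prime p) (2<p : 2 < p) where

  open ModularRing p
  private module F = RingTheory isCommutativeRing

  <⇒[]≢0 : ∀ n .{{_ : NonZero n}} → n < p → [ n ] ≢ [ 0 ]
  <⇒[]≢0 n n<p e = <⇒≱ n<p (∣⇒≤ ([]≡0⇒∣ e))

  1≢0 : [ 1 ] ≢ [ 0 ]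
  1≢0 = <⇒[]≢0 1 (<⇒≤ 2<p)

  domain : ∀ {x y} → x ⊗ y ≡ [ 0 ] → x ≡ [ 0 ] ⊎ y ≡ [ 0 ]
  domain {x} {y} e with euclidsLemma (toℕ x) (toℕ y) pp ([]≡0⇒∣ e)
  ... | inj₁ d = inj₁ (trans (sym ([toℕ] x)) (∣⇒[]≡0 d))
  ... | inj₂ d = inj₂ (trans (sym ([toℕ] y)) (∣⇒[]≡0 d))

  1+1≢0 : [ 1 ] ⊕ [ 1 ] ≢ [ 0 ]
  1+1≢0 e = <⇒[]≢0 2 2<p (trans ([]-+ 1 1) e)

  2x≡0⇒x≡0 : ∀ {x} → x ⊕ x ≡ [ 0 ] → x ≡ [ 0 ]
  2x≡0⇒x≡0 {x} e = [ (λ e′ → contradiction e′ 1+1≢0) , id ]′ (domain {[ 1 ] ⊕ [ 1 ]} {x}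
    (trans (F.distribʳ x [ 1 ] [ 1 ]) (trans (cong₂ _⊕_ (F.*-identityˡ x) (F.*-identityˡ x)) e)))

  ×[1] : ∀ n → n F.× [ 1 ] ≡ [ n ]
  ×[1] zero = refl
  ×[1] (suc n) = trans (cong ([ 1 ] ⊕_) (×[1] n)) (sym ([]-+ 1 n))

  characteristic : p F.× [ 1 ] ≡ [ 0 ]
  characteristic = trans (×[1] p) (∣⇒[]≡0 ∣-refl)

  span : ∀ x → ∃ λ n → n F.× [ 1 ] ≡ x
  span x = toℕ x , trans (×[1] (toℕ x)) ([toℕ] x)

-- The choice of √d and g, and the classification of the orbits

module Assembly (p : ℕ) .{{p≢0 : NonZero p}} (pp : Prime p) (k : ℕ) (p≡ : p ≡ suc (2 * suc k)) where

  private
    2<p : 2 < p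
    2<p = subst (2 <_) (sym p≡) (s≤s (s≤s (subst (1 ≤_) (sym (+-suc k (k + 0))) (s≤s z≤n))))

  open ModularRing p
  open PrimeField p pp 2<p
  module FF = FiniteField p pp k p≡ isCommutativeRing domain 1≢0 Fin._≟_ 2x≡0⇒x≡0 characteristic span
    (allFin p) (Uniq.allFin⁺ p) ∈-allFin (length-tabulate id)

  module _ (d : Fin p) (nonsquare : ∀ x → x ⊗ x ≢ d) where

    module E = FF.Extension d nonsquare

    module _ (g : E.K) (g-order : E.D.HasOrder g (N p)) where

      private
        module G = E.Generated g g-order
        module T = Torus p k p≡ E.Q.isCommutativeRing E.domainK E.1≢0K (λ e → 1+1≢0 (cong proj₁ e)) E._≟K_
          E.^p-+ E.ι proj₁ (λ _ → refl) E.ι-+ E.ι-* E.ι-neg refl E.ι^p G.^p-fixed g g-order G.g-generates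

        2∤p : ¬ (2 ∣ p)
        2∤p d = contradiction (∣1⇒≡1 (∣m+n∣m⇒∣n (subst (2 ∣_) (trans p≡ (+-comm 1 (2 * suc k))) d) (m∣m*n (suc k)))) λ ()

        module Size {t : ℕ} (D : InD p t) (M : ℕ) (eq : N p ≡ M * t) = OrbitSizes p {{p≢0}} {{E.N≢0}} T.Log T.pointAt T.log⇒≡ T.pointAt-log (λ {P} → T.∃-log {P}) T.log-% T.log-inverse T.log-unique-%
          T.log⇒∼Φ T.level-InD T.Φ-isSol T.∼-isSol T.Φ-injective D M eq

        module Count = OrbitCount p (<⇒≤ 2<p) 2∤p T.Φ T.Φ-isSol T.Φ-injective T.Φ-surjective

        generic : ∀ t → InD p t → t ≢ N p → 2 * t ≢ N p → ∃ λ n → OrbitSize p (T.Φ t) n × 2 * n ≡ sizeProduct p t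
        generic t D@(_ , divides M eq , _) t≢N 2t≢N = Size.generic-size D M eq
          (λ M∣2 → case irreducible[2] M∣2 of λ where
            (inj₁ refl) → t≢N (sym (trans eq (*-identityˡ t)))
            (inj₂ refl) → 2t≢N (sym eq))

        special : ∀ t → InD p t → t ≡ N p ⊎ 2 * t ≡ N p → ∃ λ n → OrbitSize p (T.Φ t) n × n ≡ sizeProduct p t
        special t D@(0<t , divides M eq , _) e = Size.special-size D M eq ([ (λ t≡N → subst (_∣ 2) (M≡ 1 (trans (*-identityˡ t) t≡N)) (1∣ 2)) , (λ 2t≡N → subst (_∣ 2) (M≡ 2 2t≡N) ∣-refl) ]′ e)
          where
          M≡ : ∀ c → c * t ≡ N p → c ≡ M
          M≡ c e = *-cancelʳ-≡ c M t {{>-nonZero 0<t}} (trans e eq)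

      classification :
        Σ (ℕ → Point p) (λ Φ →
          (∀ t → InD p t → IsSol p (Φ t))
          × (∀ t t′ → InD p t → InD p t′ → SameOrbit p (Φ t) (Φ t′) → t ≡ t′)
          × (∀ s → IsSol p s → ∃ (λ t → InD p t × SameOrbit p s (Φ t)))
          × (∀ t → InD p t → t ≢ N p → 2 * t ≢ N p → ∃ (λ k → OrbitSize p (Φ t) k × 2 * k ≡ sizeProduct p t))
          × (∀ t → InD p t → (t ≡ N p ⊎ 2 * t ≡ N p) → ∃ (λ k → OrbitSize p (Φ t) k × k ≡ sizeProduct p t)))
        × NumOrbits p (orbitCount p)
      classification = (T.Φ , (λ t D → T.Φ-isSol D) , (λ t t′ D D′ r → T.Φ-injective D D′ r) , T.Φ-surjective , generic , special) , Count.numOrbits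

odd-prime : ∀ {p} → Prime p → 5 ≤ p → ∃ λ k → p ≡ suc (2 * suc k)
odd-prime {p} pp 5≤p = go (p % 2) (p / 2) (m≡m%n+[m/n]*n p 2) (m%n<n p 2)
  where
  go : ∀ r j → p ≡ r + j * 2 → r < 2 → ∃ λ k → p ≡ suc (2 * suc k)
  go 0 j e _ with prime⇒irreducible pp (subst (2 ∣_) (sym e) (n∣m*n j))
  ... | inj₂ 2≡p = contradiction (subst (5 ≤_) (sym 2≡p) 5≤p) λ { (s≤s (s≤s ())) }
  go 1 zero e _ = contradiction (subst (5 ≤_) e 5≤p) λ { (s≤s ()) }
  go 1 (suc k) e _ = k , trans e (cong suc (*-comm (suc k) 2))
  go (suc (suc r)) j e (s≤s (s≤s ()))

theorem1 : (p : ℕ) .{{_ : NonZero p}} → Prime p → 5 ≤ p →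
    Σ (ℕ → Point p) (λ Φ →
    (∀ t → InD p t → IsSol p (Φ t))
    × (∀ t t′ → InD p t → InD p t′ → SameOrbit p (Φ t) (Φ t′) → t ≡ t′)
    × (∀ s → IsSol p s → ∃ (λ t → InD p t × SameOrbit p s (Φ t)))
    × (∀ t → InD p t → t ≢ N p → 2 * t ≢ N p →
    ∃ (λ k → OrbitSize p (Φ t) k × 2 * k ≡ sizeProduct p t))
    × (∀ t → InD p t → (t ≡ N p ⊎ 2 * t ≡ N p) → ∃ (λ k → OrbitSize p (Φ t) k × k ≡ sizeProduct p t)))
    × NumOrbits p (orbitCount p)
theorem1 p pp 5≤p =
  let k , p≡ = odd-prime pp 5≤p
      d , nonsquare = Assembly.FF.∃-nonsquare p pp k p≡
      g , g-order = Assembly.E.∃-primitive p pp k p≡ d nonsquare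
  in Assembly.classification p pp k p≡ d nonsquare g g-order
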